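{- Let $(V,d)$ be a finite rational metric space with $n=|V|\ge2$ and let $k$ be an even integer with $0<k<n$. Put $p=k/n$. The set $T_n$ returned by the centered all-cut algorithm with parameter $m=n$ satisfies $|T_n|=k$ and \[ \mu(T_n)\ \ge\ \min\{p,\,2(1-p)\}\,\mathrm{OPT}_k , \] i.e. the algorithm has approximation factor $1/\min\{p,2(1-p)\}$. The feasible endpoint cases $k=0$ and $k=n$ (the latter when $n$ is even) are solved exactly.
   Context: For $T\subseteq V$ with $|T|$ even, $\mu(T)$ denotes the minimum total $d$-cost of a perfect matching on $T$ ($\mu(\varnothing)=0$). For even $k$ with $0\le k\le n$, $\mathrm{OPT}_k:=\max\{\mu(T):T\subseteq V,\ |T|=k\}$. Cut packings. For nonempty $X\subseteq V$ let $d_X$ be the restriction of $d$, $E_X=\binom X2$, and for nonempty proper $S\subsetneq X$ let $\delta_X(S)=\{uv\in E_X:|\{u,v\}\cap S|=1\}$. Fix a root $r\in X$ and let $\mathcal A(X)=\{S:\varnothing\ne S\subseteq X\setminus\{r\}\}$ (one representative per nontrivial cut of $X$). A feasible all-cut packing on $(X,d_X)$ is a vector $y\ge0$ indexed by $\mathcal A(X)$ with $\sum_{S\in\mathcal A(X):\,e\in\delta_X(S)}y_S\le d_X(e)$ for all $e\in E_X$; it is optimal if it maximizes $\sum_S y_S$. It is laminar if any two sets $S$ with $y_S>0$ are disjoint or nested. Laminar tree. For a laminar packing $y$ with support $\mathcal L=\{S:y_S>0\}$, $\mathcal T_y$ is the inclusion tree of $\mathcal L\cup\{X\}\cup\{\{v\}:v\in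 X\}$, rooted at $X$, in which each proper set is joined to its smallest strict superset in the family; the edge from $S\in\mathcal L$ to its parent has weight $y_S$, all other edges have weight $0$; the singleton $\{v\}$ is the leaf labelled $v$. Nodes with more than two children are then refined by zero-weight edges into a rooted binary tree (every internal node having exactly two children) with the same labelled leaves. For even $T\subseteq X$, $J_{\mathcal T_y}(T)$ is the set of tree edges $e$ such that the number of leaves labelled by elements of $T$ below $e$ is odd, and $w(F)$ is the total weight of an edge set $F$. Farthest-first. For $1\le\ell\le|X|$, $\mathrm{FarthestFirst}(X,\ell)$ starts with an arbitrary point of $X$ (fixed by the input order) and repeatedly adds a not yet selected point whose distance from the set of points chosen so far is maximum (ties broken by input order), until $\ell$ points are selected. Centered all-cut algorithm (for even $k$ with $2\le k<n$ and integer parameter $m\in\{k,\dots,n\}$): set $C:=\mathrm{FarthestFirst}(V,m)$; compute an optimal laminar all-cut packing $y^C$ on $(C,d_C)$; construct $\mathcal T_C:=\mathcal T_{y^C}$; return a set $T_m\in\arg\max\{w(J_{\mathcal T_C}(T)):T\subseteq C,\ |T|=k\}$. This is implemented as a deterministic polynomial-time algorithm. -}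

module Defs where

open import Data.Fin using (Fin)
import Data.Fin as Fin
import Data.Fin.Properties as Fin
open import Data.Fin.Subset
  using (Subset; inside; outside; ⊤; ⊥; ⁅_⁆; _∈_; _⊆_; _⊂_; _∩_; _∪_; _─_; _-_; ∣_∣; Nonempty; Empty)
open import Data.Fin.Subset.Properties using (_∈?_; _⊆?_; nonempty?)
open import Data.Integer using (+_)
open import Data.List
  using (List; []; _∷_; _++_; map; filter; foldr; length; allFin; cartesianProduct)
open import Data.List.Membership.Propositional using () renaming (_∈_ to _∈ˡ_)
open import Data.List.Relation.Binary.Permutation.Propositional using (_↭_)
open import Data.List.Relation.Binary.Pointwise using (Pointwise)
open import Data.List.Relation.Unary.All using (All; all?)
open import Data.List.Relation.Unary.Unique.Propositional using (Unique)
open import Data.Nat using (ℕ; zero; suc; NonZero)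
import Data.Nat as ℕ
open import Data.Nat.Divisibility using (_∣?_)
open import Data.Product using (_×_; _,_; ∃; proj₁; proj₂)
open import Data.Rational using (ℚ; 0ℚ; 1ℚ; _+_; _*_; _/_; _⊓_; _⊔_; _≤_; _<_)
  renaming (_-_ to _-ℚ_)
open import Data.Rational.Properties using (_<?_)
open import Data.Sum using (_⊎_)
import Data.Vec as Vec
open import Function using (_⇔_)
open import Function.Metric.Rational using (DistanceFunction)
open import Data.Bool using (if_then_else_)
open import Relation.Binary.PropositionalEquality using (_≡_; _≢_)
open import Relation.Nullary using (¬_; Dec; does)
open import Relation.Nullary.Decidable using (_×-dec_; _⊎-dec_; ¬?)

private
  variable
    n : ℕ
    A : Set

-- The value on the empty list is a junk value; only addFarthest relies on it.

minimum : List ℚ → ℚ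
minimum []       = 0ℚ
minimum (x ∷ xs) = foldr _⊓_ x xs

maximum : List ℚ → ℚ
maximum []       = 0ℚ
maximum (x ∷ xs) = foldr _⊔_ x xs

∑ : List A → (A → ℚ) → ℚ
∑ xs f = foldr _+_ 0ℚ (map f xs)

-- Ties are resolved in favour of the earlier element.
firstArgmax : (A → ℚ) → A → List A → A
firstArgmax f x []       = x
firstArgmax f x (y ∷ ys) =
  if does (f x <? f y) then firstArgmax f y ys else firstArgmax f x ys

sublists : List A → List (List A)
sublists []       = [] ∷ []
sublists (x ∷ xs) = map (x ∷_) (sublists xs) ++ sublists xs

allSubsets : ∀ n → List (Subset n)
allSubsets zero    = Vec.[] ∷ []
allSubsets (suc n) =
  map (inside Vec.∷_) (allSubsets n) ++ map (outside Vec.∷_) (allSubsets n)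

elements : Subset n → List (Fin n)
elements {n} S = filter (_∈? S) (allFin n)

-- The edge uv is represented by the pair (u , v) with u < v.
Edge : ℕ → Set
Edge n = Fin n × Fin n

edgesWithin : Subset n → List (Edge n)
edgesWithin T =
  filter (λ e → proj₁ e Fin.<? proj₂ e) (cartesianProduct (elements T) (elements T))

degree : List (Edge n) → Fin n → ℕ
degree M v = length (filter (λ e → (proj₁ e Fin.≟ v) ⊎-dec (proj₂ e Fin.≟ v)) M)

IsPerfectOn : Subset n → List (Edge n) → Set
IsPerfectOn T M = All (λ v → degree M v ≡ 1) (elements T)

isPerfectOn? : (T : Subset n) (M : List (Edge n)) → Dec (IsPerfectOn T M)
isPerfectOn? T M = all? (λ v → degree M v ℕ.≟ 1) (elements T)

perfectMatchings : Subset n → List (List (Edge n))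
perfectMatchings T = filter (isPerfectOn? T) (sublists (edgesWithin T))

cost : DistanceFunction (Fin n) → List (Edge n) → ℚ
cost d M = ∑ M (λ e → d (proj₁ e) (proj₂ e))

-- Junk value 0 when ∣ T ∣ is odd.
μ : DistanceFunction (Fin n) → Subset n → ℚ
μ d T = minimum (map (cost d) (perfectMatchings T))

OPT : DistanceFunction (Fin n) → ℕ → ℚ
OPT {n} d k = maximum (map (μ d) (filter (λ T → ∣ T ∣ ℕ.≟ k) (allSubsets n)))

distanceTo : DistanceFunction (Fin n) → Subset n → Fin n → ℚ
distanceTo d S v = minimum (map (d v) (elements S))

-- The input order is the order of Fin n.  Every point has distance 0 to the
-- empty set, so the first point selected is the first point of X.
addFarthest : DistanceFunction (Fin n) → Subset n → Subset n → Subset n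
addFarthest d X S with elements (X ─ S)
... | []     = S
... | v ∷ vs = S ∪ ⁅ firstArgmax (distanceTo d S) v vs ⁆

farthestFirst : DistanceFunction (Fin n) → Subset n → ℕ → Subset n
farthestFirst d X zero    = ⊥
farthestFirst d X (suc ℓ) = addFarthest d X (farthestFirst d X ℓ)

IsCut : Subset n → Fin n → Subset n → Set
IsCut X r S = Nonempty S × S ⊆ X - r

isCut? : (X : Subset n) (r : Fin n) (S : Subset n) → Dec (IsCut X r S)
isCut? X r S = nonempty? S ×-dec (S ⊆? X - r)

cuts : Subset n → Fin n → List (Subset n)
cuts {n} X r = filter (isCut? X r) (allSubsets n)

Crosses : Fin n → Fin n → Subset n → Set
Crosses u v S = ∣ (⁅ u ⁆ ∪ ⁅ v ⁆) ∩ S ∣ ≡ 1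

crosses? : (u v : Fin n) (S : Subset n) → Dec (Crosses u v S)
crosses? u v S = ∣ (⁅ u ⁆ ∪ ⁅ v ⁆) ∩ S ∣ ℕ.≟ 1

-- A packing is indexed by all subsets; its values outside cuts X r are
-- never used.
Packing : ℕ → Set
Packing n = Subset n → ℚ

record IsFeasible (d : DistanceFunction (Fin n)) (X : Subset n) (r : Fin n)
                  (y : Packing n) : Set where
  field
    nonNegative : ∀ S → IsCut X r S → 0ℚ ≤ y S
    capacity    : ∀ u v → u ∈ X → v ∈ X → u ≢ v →
                  ∑ (filter (crosses? u v) (cuts X r)) y ≤ d u v

total : Subset n → Fin n → Packing n → ℚ
total X r y = ∑ (cuts X r) y

record IsOptimal (d : DistanceFunction (Fin n)) (X : Subset n) (r : Fin n)
                 (y : Packing n) : Set where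
  field
    feasible : IsFeasible d X r y
    optimal  : ∀ y′ → IsFeasible d X r y′ → total X r y′ ≤ total X r y

InSupport : Subset n → Fin n → Packing n → Subset n → Set
InSupport X r y S = IsCut X r S × 0ℚ < y S

inSupport? : (X : Subset n) (r : Fin n) (y : Packing n) (S : Subset n) →
             Dec (InSupport X r y S)
inSupport? X r y S = isCut? X r S ×-dec (0ℚ <? y S)

IsLaminar : Subset n → Fin n → Packing n → Set
IsLaminar X r y = ∀ S S′ → InSupport X r y S → InSupport X r y S′ →
                  Empty (S ∩ S′) ⊎ S ⊆ S′ ⊎ S′ ⊆ S

-- Each child is paired with the weight of the edge leading to it.
data Tree (n : ℕ) : Set where
  leaf : Fin n → Tree n
  node : List (ℚ × Tree n) → Tree n

data BinaryTree (n : ℕ) : Set where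
  leaf : Fin n → BinaryTree n
  node : ℚ × BinaryTree n → ℚ × BinaryTree n → BinaryTree n

InFamily : Subset n → Fin n → Packing n → Subset n → Set
InFamily X r y S = InSupport X r y S ⊎ S ≡ X ⊎ (∃ λ v → v ∈ X × S ≡ ⁅ v ⁆)

record IsParent (X : Subset n) (r : Fin n) (y : Packing n) (P S : Subset n) : Set where
  field
    parent∈family : InFamily X r y P
    child∈family  : InFamily X r y S
    child⊂parent  : S ⊂ P
    smallest      : ∀ U → InFamily X r y U → S ⊂ U → P ⊆ U

edgeWeight : Subset n → Fin n → Packing n → Subset n → ℚ
edgeWeight X r y S = if does (inSupport? X r y S) then y S else 0ℚ

-- IsInclusionTree X r y S t: t is the part of the inclusion tree at and
-- below the member S of the family.
data IsInclusionTree (X : Subset n) (r : Fin n) (y : Packing n) :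
                     Subset n → Tree n → Set where
  leaf : ∀ {v} → v ∈ X → IsInclusionTree X r y ⁅ v ⁆ (leaf v)
  node : ∀ {S children edges} →
         InFamily X r y S →
         (∀ v → S ≢ ⁅ v ⁆) →
         Unique children →
         (∀ S′ → S′ ∈ˡ children ⇔ IsParent X r y S S′) →
         Pointwise (λ S′ e → proj₁ e ≡ edgeWeight X r y S′ ×
                             IsInclusionTree X r y S′ (proj₂ e))
                   children edges →
         IsInclusionTree X r y S (node edges)

-- A binary refinement distributes the children of a node over two nonempty
-- groups.  A group of one child keeps its edge; a larger group hangs from a
-- new node, attached by an edge of weight 0 and refined in the same way.
mutual
  data Refines {n : ℕ} : Tree n → BinaryTree n → Set where
    leaf : ∀ {v} → Refines (leaf v) (leaf v)
    node : ∀ {es es₁ es₂ e₁ e₂} → es ↭ es₁ ++ es₂ →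
           RefinesGroup es₁ e₁ → RefinesGroup es₂ e₂ →
           Refines (node es) (node e₁ e₂)

  data RefinesGroup {n : ℕ} : List (ℚ × Tree n) → ℚ × BinaryTree n → Set where
    single  : ∀ {w t b} → Refines t b → RefinesGroup ((w , t) ∷ []) (w , b)
    newNode : ∀ {es b} → Refines (node es) b → RefinesGroup es (0ℚ , b)

leaves : BinaryTree n → List (Fin n)
leaves (leaf v)                 = v ∷ []
leaves (node (_ , t₁) (_ , t₂)) = leaves t₁ ++ leaves t₂

-- An edge is given by its weight and the subtree below it.
treeEdges : BinaryTree n → List (ℚ × BinaryTree n)
treeEdges (leaf v) = []
treeEdges (node (w₁ , t₁) (w₂ , t₂)) =
  (w₁ , t₁) ∷ (w₂ , t₂) ∷ treeEdges t₁ ++ treeEdges t₂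

oddEdges : BinaryTree n → Subset n → List (ℚ × BinaryTree n)
oddEdges t T = filter (λ e → ¬? (2 ∣? length (filter (_∈? T) (leaves (proj₂ e))))) (treeEdges t)

weight : List (ℚ × BinaryTree n) → ℚ
weight F = ∑ F proj₁

-- T is an output of the algorithm on input (V , d), V = Fin n, with
-- parameters k and m, for some way of making the choices that the
-- description leaves open: the root, the optimal laminar packing, the binary
-- refinement and the maximiser.
record IsOutput {n : ℕ} (d : DistanceFunction (Fin n)) (k m : ℕ) (T : Subset n) : Set where
  C : Subset n
  C = farthestFirst d ⊤ m
  field
    root          : Fin n
    root∈C        : root ∈ C
    y             : Packing n
    isOptimal     : IsOptimal d C root y
    isLaminar     : IsLaminar C root y
    inclusionTree : Tree n
    isInclusion   : IsInclusionTree C root y C inclusionTree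
    tree          : BinaryTree n
    refines       : Refines inclusionTree tree
    T⊆C           : T ⊆ C
    ∣T∣≡k         : ∣ T ∣ ≡ k
    maximal       : ∀ T′ → T′ ⊆ C → ∣ T′ ∣ ≡ k →
                    weight (oddEdges tree T′) ≤ weight (oddEdges tree T)

guarantee : (k n : ℕ) → .{{NonZero n}} → ℚ
guarantee k n = p ⊓ ((+ 2 / 1) * (1ℚ -ℚ p))
  where
  p : ℚ
  p = + k / n

{-# OPTIONS --safe #-}
module Submission where

-- Let D be the value of the optimal packing y.
--
-- OPT_k ≤ D, because for even T the value μ(T) is attained by a packing of
-- T-odd cuts.  For integral distances this is proved by induction on the
-- minimum length of a T-join: if x₀ is an end of an edge of positive length of
-- a shortest T-join, and v is the point for which the shortest
-- (T + x₀ + v)-join is shortest, then lowering all distances across the cut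
-- around v by one lowers the minimum only by one.
--
-- w(J(T)) ≤ μ(T), because a perfect matching on T crosses every cut that
-- splits T into odd parts.
--
-- Some T with |T| = k has w(J(T)) ≥ min{p, 2(1 - p)} D: there are n sets of k
-- leaves such that every tree edge is odd for at least min{k, 2(n - k)} of
-- them.  They are built bottom-up, as n rows for every subtree; the rows of
-- two siblings can be paired in any order, and they are paired such that the
-- right number of sums is odd while all counts in a subtree stay within three
-- consecutive values.  At the root this forces all counts to be k.

-- The constant has a local origin. In each row the parities of the two children of a node add up to
-- that of the node, so the row is odd at none or at exactly two of these three. If the three are
-- odd in 2a, 2b and 2c of the n rows, then a, b, c satisfy the triangle inequalities and a + b + c
-- ≤ n, and conversely such numbers can be realised. A leaf occurs in k rows, so leaf edges have the
-- value k/2. Clipping a system of such numbers to an interval [l, k/2] keeps the triangle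
-- inequalities, and it keeps the sum condition if l + k/2 + k/2 ≤ n. The largest such l satisfies
-- 2l = min{k, 2(n - k)}. Parity is also what makes an integral packing of T-cuts possible. For four
-- points at mutual distance 1 and T = V the shortest T-join has length 2, but no two T-cuts fit
-- with integral weights. Scaled to even integers, the distances have the parity pattern of a
-- bipartite graph, and this pattern survives the lowering across a cut.

module Discrete where
  import Algebra.Solver.CommutativeMonoid as CMSolver
  open import Data.Bool using (Bool; _xor_; _∧_; false; if_then_else_; not; true)
  open import Data.Bool.Properties using (not-involutive; xor-assoc; xor-comm; xor-identityʳ; xor-same)
  import Data.Bool.Properties as Bool
  open import Data.Empty using (⊥-elim)
  open import Data.List using (List; []; _++_; _∷_; length; map; zip)
  open import Data.List.Properties using (length-++; map-++)
  open import Data.List.Relation.Binary.Permutation.Propositional using (_↭_; ↭-refl; ↭-reflexive; ↭-trans)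
  import Data.List.Relation.Binary.Permutation.Propositional.Properties as Perm
  open import Data.List.Relation.Unary.All using (All; []; _∷_)
  import Data.List.Relation.Unary.All as All
  import Data.List.Relation.Unary.All.Properties as All
  open import Data.Nat using (_*_; _+_; _<_; _∸_; _≤?_; _≤_; _⊓_; _⊔_; pred; suc; s≤s; zero; z≤n; ℕ; ⌊_/2⌋)
  import Data.Nat as ℕ
  import Data.Nat.Properties as ℕ
  open import Data.Nat.Tactic.RingSolver using (solve-∀)
  open import Data.Product using (_,_; _×_; proj₁; proj₂; ∃)
  open import Data.Sum using (_⊎_; inj₁; inj₂)
  open import Relation.Binary.Definitions using (DecidableEquality)
  open import Relation.Binary.PropositionalEquality
  open import Relation.Nullary using (does; no; yes; ¬_)

  -- T-joins and packings of T-cuts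

  Table : ℕ → Set
  Table zero    = Bool × Bool
  Table (suc n) = Bool → Table n

  Holds : ∀ n → Table n → Set
  Holds zero    (x , y) = x ≡ y
  Holds (suc n) f       = ∀ b → Holds n (f b)

  check : ∀ n → Table n → Bool
  check zero    (x , y) = not (x xor y)
  check (suc n) f       = check n (f true) ∧ check n (f false)

  infix 2 _:=_
  _:=_ : Bool → Bool → Bool × Bool
  _:=_ = _,_

  -- Reflection: `check` runs through the truth table of an equation in `n` Boolean variables, so
  -- identities of parities are proved by `refl`.
  solve : ∀ n f → check n f ≡ true → Holds n f
  solve zero    (true  , true)  _ = refl
  solve zero    (false , false) _ = refl
  solve (suc n) f e true  = solve n (f true) (Bool.∧-conicalˡ _ _ e)
  solve (suc n) f e false = solve n (f false) (Bool.∧-conicalʳ (check n (f true)) _ e)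

  xor-≡ : ∀ {x y} → x xor y ≡ false → x ≡ y
  xor-≡ {true}  {true}  _ = refl
  xor-≡ {false} {false} _ = refl

  ≡-xor : ∀ {x y} → x ≡ y → x xor y ≡ false
  ≡-xor {x} refl = xor-same x

  -- Parities are vectors over the field with two elements: an equation holds if
  -- the sum of its two sides is the sum of all sides of equations that hold.
  combine₁ : ∀ {x y a b} → x xor y ≡ a xor b → a ≡ b → x ≡ y
  combine₁ e p = xor-≡ (trans e (≡-xor p))

  combine₂ : ∀ {x y a b c d} → x xor y ≡ (a xor b) xor (c xor d) →
             a ≡ b → c ≡ d → x ≡ y
  combine₂ e p q = xor-≡ (trans e (cong₂ _xor_ (≡-xor p) (≡-xor q)))

  par : {V : Set} → (V → Bool) → List V → Bool
  par χ []       = false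
  par χ (x ∷ xs) = χ x xor par χ xs

  infix 4 _∼_

  -- Lists stand for vectors over the field with two elements, so multiplicities matter modulo 2
  -- only. Testing with every `χ`, not only with single points, makes the relation directly
  -- applicable to cuts and colourings.
  record _∼_ {V : Set} (xs ys : List V) : Set where
    constructor parity
    field at : ∀ χ → par χ xs ≡ par χ ys

  open _∼_ public

  par-++ : ∀ {V : Set} (χ : V → Bool) xs ys → par χ (xs ++ ys) ≡ par χ xs xor par χ ys
  par-++ χ []       ys = refl
  par-++ χ (x ∷ xs) ys =
    trans (cong (χ x xor_) (par-++ χ xs ys)) (sym (xor-assoc (χ x) (par χ xs) (par χ ys)))

  odd : ℕ → Bool
  odd zero    = false
  odd (suc n) = not (odd n)

  odd-+ : ∀ m n → odd (m + n) ≡ odd m xor odd n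
  odd-+ zero    n = refl
  odd-+ (suc m) n = trans (cong not (odd-+ m n)) (Bool.not-distribˡ-xor (odd m) (odd n))

  bit : Bool → ℕ
  bit b = if b then 1 else 0

  -- A T-join is a list L of edges with ends L ∼ T.

  ends : {V : Set} → List (V × V) → List V
  ends []            = []
  ends ((u , w) ∷ L) = u ∷ w ∷ ends L

  -- If there is no least element, strong induction excludes all numbers below any bound. As `P`
  -- need not be decidable, the least element exists only under a double negation.
  ¬¬-least : (P : ℕ → Set) → ∃ P → ¬ ¬ (∃ λ m → P m × (∀ j → P j → m ≤ j))
  ¬¬-least P (n , p) ¬least = below (suc n) n ℕ.≤-refl p
    where
    below : ∀ b j → j < b → ¬ P j
    below (suc b) j (s≤s j≤b) pj = ¬least (j , pj , λ i pi → ℕ.≮⇒≥ λ i<j →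
      below b i (ℕ.<-≤-trans i<j j≤b) pi)

  ℕ-swap : ∀ a b c → a + (b + c) ≡ b + (a + c)
  ℕ-swap a b c = trans (sym (ℕ.+-assoc a b c)) (trans (cong (_+ c) (ℕ.+-comm a b)) (ℕ.+-assoc b a c))

  module Points {V : Set} (_≟_ : DecidableEquality V) where

    point : V → V → Bool
    point a x = does (a ≟ x)

    point-≡ : ∀ {a x} → point a x ≡ true → a ≡ x
    point-≡ {a} {x} e with a ≟ x
    ... | yes a≡x = a≡x

    point-≢ : ∀ {a x} → point a x ≡ false → a ≢ x
    point-≢ {a} {x} e a≡x with a ≟ x
    ... | no a≢x = a≢x a≡x

    point-refl : ∀ a → point a a ≡ true
    point-refl a with a ≟ a
    ... | yes _  = refl
    ... | no a≢a = ⊥-elim (a≢a refl)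

    point-no : ∀ {a x} → a ≢ x → point a x ≡ false
    point-no {a} {x} a≢x with a ≟ x
    ... | yes a≡x = ⊥-elim (a≢x a≡x)
    ... | no _    = refl

  totalLength : {V : Set} → (V → V → ℕ) → List (V × V) → ℕ
  totalLength d []            = 0
  totalLength d ((u , w) ∷ L) = d u w + totalLength d L

  -- Exchanging edges between two joins

  module Joins {V : Set} (_≟_ : DecidableEquality V) (d : V → V → ℕ)
               (d-sym : ∀ u w → d u w ≡ d w u) where

    open Points _≟_

    record Crossing (χ : V → Bool) (L : List (V × V)) : Set where
      field
        inner outer : V
        rest        : List (V × V)
        inside      : χ inner ≡ true
        outside     : χ outer ≡ false
        ends∼       : ends L ∼ inner ∷ outer ∷ ends rest
        cost≡       : totalLength d L ≡ d inner outer + totalLength d rest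
        length≡     : length L ≡ suc (length rest)

    crossing-∷ : ∀ {χ L} u w → Crossing χ L → Crossing χ ((u , w) ∷ L)
    crossing-∷ u w c = record
      { inner = inner ; outer = outer ; inside = inside ; outside = outside
      ; rest = (u , w) ∷ rest
      ; ends∼ = parity λ ψ → trans (cong (λ b → ψ u xor (ψ w xor b)) (at ends∼ ψ))
          (solve 5 (λ a b c e f → a xor (b xor (c xor (e xor f))) := c xor (e xor (a xor (b xor f)))) refl
             (ψ u) (ψ w) (ψ inner) (ψ outer) (par ψ (ends rest)))
      ; cost≡ = trans (cong (d u w +_) cost≡) (ℕ-swap (d u w) (d inner outer) (totalLength d rest))
      ; length≡ = cong suc length≡ }
      where
      open Crossing c

    -- Edges with both ends or no end in `χ` do not affect the parity, so an odd parity leaves an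
    -- edge with exactly one end in `χ`.
    crossing : ∀ χ L → par χ (ends L) ≡ true → Crossing χ L
    crossing χ ((u , w) ∷ L) e with χ u in χu | χ w in χw
    ... | true | false = record
      { inside = χu ; outside = χw ; rest = L ; ends∼ = parity λ _ → refl ; cost≡ = refl ; length≡ = refl }
    ... | false | true = record
      { inside = χw ; outside = χu ; rest = L
      ; ends∼ = parity λ ψ → solve 3 (λ a b c → a xor (b xor c) := b xor (a xor c)) refl (ψ u) (ψ w) (par ψ (ends L))
      ; cost≡ = cong (_+ totalLength d L) (d-sym u w) ; length≡ = refl }
    ... | true | true = crossing-∷ u w (crossing χ L (trans (sym (not-involutive _)) e))
    ... | false | false = crossing-∷ u w (crossing χ L e)

    OddIn : V → List (V × V) → List (V × V) → Set
    OddIn a M N = par (point a) (ends M) xor par (point a) (ends N) ≡ true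

    -- Describes a trail from `a` to another vertex of odd degree in the multigraph formed by `M`
    -- and `N`. Exchanging its edges between the two lists changes the degree parities of both at
    -- the two ends of the trail and nowhere else, while the total length stays the same.
    record Exchange (a : V) (M N : List (V × V)) : Set where
      field
        partner  : V
        partner≢ : partner ≢ a
        oddIn    : OddIn partner M N
        left     : List (V × V)
        right    : List (V × V)
        left∼    : ends left ∼ a ∷ partner ∷ ends M
        right∼   : ends right ∼ a ∷ partner ∷ ends N
        total≡   : totalLength d left + totalLength d right ≡ totalLength d M + totalLength d N

    exchange-swap : ∀ {a M N} → Exchange a N M → Exchange a M N
    exchange-swap {M = M} {N} x = record
      { partner = partner ; partner≢ = partner≢
      ; oddIn = trans (xor-comm (par (point partner) (ends M)) _) oddIn
      ; left = right ; right = left ; left∼ = right∼ ; right∼ = left∼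
      ; total≡ = trans (ℕ.+-comm (totalLength d right) _) (trans total≡ (ℕ.+-comm (totalLength d N) _)) }
      where open Exchange x

    odd-move : ∀ {a c M M₁} N b → ends M ∼ a ∷ c ∷ ends M₁ →
               par (point b) (ends M) xor par (point b) (ends N) ≡
               point b a xor (point b c xor (par (point b) (ends M₁) xor par (point b) (ends N)))
    odd-move {a} {c} {M} {M₁} N b M∼ = trans (cong (_xor par (point b) (ends N)) (at M∼ (point b)))
      (solve 4 (λ x y m n → (x xor (y xor m)) xor n := x xor (y xor (m xor n))) refl
        (point b a) (point b c) (par (point b) (ends M₁)) (par (point b) (ends N)))

    exchange-stop : ∀ {a c M M₁ N} → c ≢ a → ends M ∼ a ∷ c ∷ ends M₁ →
                    totalLength d M ≡ d a c + totalLength d M₁ → OddIn c M N → Exchange a M N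
    exchange-stop {a} {c} {M} {M₁} {N} c≢a M∼ cM o = record
      { partner = c ; partner≢ = c≢a ; oddIn = o
      ; left = M₁ ; right = (a , c) ∷ N
      ; left∼ = parity λ ψ → combine₁
          (solve 4 (λ x y z w → z xor (x xor (y xor w)) := w xor (x xor (y xor z))) refl
            (ψ a) (ψ c) (par ψ (ends M₁)) (par ψ (ends M))) (at M∼ ψ)
      ; right∼ = parity λ _ → refl
      ; total≡ = trans (sym (ℕ.+-assoc (totalLength d M₁) _ _))
          (cong (_+ totalLength d N) (trans (ℕ.+-comm (totalLength d M₁) _) (sym cM))) }

    exchange-move : ∀ {a c M M₁ N} → c ≢ a → ends M ∼ a ∷ c ∷ ends M₁ →
                    totalLength d M ≡ d a c + totalLength d M₁ → OddIn a M N → Exchange c M₁ N → Exchange a M N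
    exchange-move {a} {c} {M} {M₁} {N} c≢a M∼ cM o x = record
      { partner = partner ; partner≢ = partner≢a
      ; oddIn = trans (odd-move N partner M∼)
          (cong₂ _xor_ (point-no partner≢a) (cong₂ _xor_ (point-no partner≢) oddIn))
      ; left = left ; right = (a , c) ∷ right
      ; left∼ = parity λ ψ → combine₂
          (solve 6 (λ l x b m c m₁ → l xor (x xor (b xor m)) := (l xor (c xor (b xor m₁))) xor
              (m xor (x xor (c xor m₁)))) refl
            (par ψ (ends left)) (ψ a) (ψ partner) (par ψ (ends M)) (ψ c) (par ψ (ends M₁)))
          (at left∼ ψ) (at M∼ ψ)
      ; right∼ = parity λ ψ → combine₁
          (solve 5 (λ l x b m c → (x xor (c xor l)) xor (x xor (b xor m)) := l xor (c xor (b xor m))) refl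
            (par ψ (ends right)) (ψ a) (ψ partner) (par ψ (ends N)) (ψ c))
          (at right∼ ψ)
      ; total≡ = begin
          totalLength d left + (d a c + totalLength d right) ≡⟨ ℕ-swap (totalLength d left) (d a c)
              (totalLength d right) ⟩
          d a c + (totalLength d left + totalLength d right)   ≡⟨ cong (d a c +_) total≡ ⟩
          d a c + (totalLength d M₁ + totalLength d N)         ≡⟨ ℕ.+-assoc (d a c) _ _ ⟨
          d a c + totalLength d M₁ + totalLength d N           ≡⟨ cong (_+ totalLength d N) cM ⟨
          totalLength d M + totalLength d N                    ∎ }
      where
      open ≡-Reasoning
      open Exchange x
      partner≢a : partner ≢ a
      -- Deleting the edge at `a` makes the joint degree of `a` even, so the walk continued from `c`
      -- cannot end there.
      partner≢a refl with trans (sym o) (trans (odd-move N a M∼)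
        (cong₂ _xor_ (point-refl a) (cong₂ _xor_ (point-no (λ a≡c → c≢a (sym a≡c))) oddIn)))
      ... | ()

    -- Walk along edges of M and N, moving each edge to the other side, until a
    -- vertex of odd degree is reached.
    mutual
      exchange : ∀ k M N a → length M + length N ≤ k → OddIn a M N → Exchange a M N
      exchange k M N a len o with par (point a) (ends M) in eM
      ... | true  = exchange-from k M N a len (trans (cong (_xor par (point a) (ends N)) eM) o) eM
      ... | false = exchange-swap (exchange-from k N M a
                      (subst (_≤ k) (ℕ.+-comm (length M) _) len)
                      (trans (xor-comm _ (par (point a) (ends M))) (trans (cong (_xor par (point a) (ends N)) eM) o)) o)

      exchange-from : ∀ k M N a → length M + length N ≤ k → OddIn a M N →
                      par (point a) (ends M) ≡ true → Exchange a M N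
      exchange-from k M N a len o oM with crossing (point a) M oM
      ... | record { outer = c ; rest = M₁ ; inside = ia ; outside = oc
                   ; ends∼ = M∼ ; cost≡ = cM ; length≡ = lM } with point-≡ ia
      ... | refl = exchange-via k a c M₁ (λ c≡a → point-≢ oc (sym c≡a)) M∼ cM o
                     (subst (λ l → l + length N ≤ k) lM len)

      exchange-via : ∀ k {M N} a c M₁ → c ≢ a → ends M ∼ a ∷ c ∷ ends M₁ →
                     totalLength d M ≡ d a c + totalLength d M₁ → OddIn a M N →
                     suc (length M₁) + length N ≤ k → Exchange a M N
      exchange-via (suc k) {M} {N} a c M₁ c≢a M∼ cM o (s≤s len)
        with par (point c) (ends M) xor par (point c) (ends N) in oc
      ... | true  = exchange-stop {M₁ = M₁} c≢a M∼ cM oc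
      ... | false = exchange-move {M₁ = M₁} c≢a M∼ cM o (exchange k M₁ N c len
        (xor-true (trans (sym (cong₂ _xor_ (point-no c≢a)
            (cong (_xor (par (point c) (ends M₁) xor par (point c) (ends N))) (point-refl c))))
          (trans (sym (odd-move {M₁ = M₁} N c M∼)) oc))))
        where
        xor-true : ∀ {x} → true xor x ≡ false → x ≡ true
        xor-true {true} _ = refl

  -- Lowering the distances across one cut

  isZero : ℕ → Bool
  isZero zero    = true
  isZero (suc _) = false

  isZero-true : ∀ {n} → isZero n ≡ true → n ≡ 0
  isZero-true {zero} _ = refl

  isZero-false : ∀ {n} → isZero n ≡ false → 0 < n
  isZero-false {suc n} _ = s≤s z≤n

  ≤-suc-pred : ∀ n → n ≤ suc (pred n)
  ≤-suc-pred zero    = z≤n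
  ≤-suc-pred (suc n) = ℕ.≤-refl

  same-parity-< : ∀ {i j} → i < j → odd i ≡ odd j → 2 + i ≤ j
  same-parity-< {i} {j} i<j e with ℕ.m≤n⇒m<n∨m≡n i<j
  ... | inj₁ 1+i<j = 1+i<j
  ... | inj₂ refl with odd i | e
  ... | true  | ()
  ... | false | ()

  -- `d-parity` says that `c` is a 2-colouring: all closed walks have even length, as in a bipartite
  -- graph. Distinct points may have distance 0, since lowering distances can make points coincide.
  record IsIntegral {V : Set} (d : V → V → ℕ) (c : V → Bool) : Set where
    field
      d-sym      : ∀ u w → d u w ≡ d w u
      d-self     : ∀ u → d u u ≡ 0
      d-triangle : ∀ u x w → d u w ≤ d u x + d x w
      d-parity   : ∀ u w → odd (d u w) ≡ c u xor c w

  sumOf : {V : Set} → (V → ℕ) → List V → ℕ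
  sumOf e []       = 0
  sumOf e (x ∷ xs) = e x + sumOf e xs

  module _ {V : Set} (χ : V → Bool) (e : V → ℕ) where

    pluck : ∀ B → par χ B ≡ true → ∃ λ x → ∃ λ B₁ →
            χ x ≡ true × B ∼ x ∷ B₁ × sumOf e B ≡ e x + sumOf e B₁ × length B ≡ suc (length B₁)
    pluck (x ∷ B) o with χ x in χx
    ... | true  = x , B , χx , parity (λ _ → refl) , refl , refl
    ... | false with pluck B o
    ...   | y , B₁ , χy , B∼ , sB , lB = y , x ∷ B₁ , χy
      , parity (λ ψ → trans (cong (ψ x xor_) (at B∼ ψ))
          (solve 3 (λ a b r → a xor (b xor r) := b xor (a xor r)) refl (ψ x) (ψ y) (par ψ B₁)))
      , trans (cong (e x +_) sB) (ℕ-swap (e x) (e y) _) , cong suc lB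

  module Reduction {V : Set} (_≟_ : DecidableEquality V) (d : V → V → ℕ) (c : V → Bool)
                   (int : IsIntegral d c) where
    open IsIntegral int
    open Points _≟_
    open Joins _≟_ d d-sym

    -- In the sum of the edge lengths the colours of inner vertices cancel, so only the ends of the
    -- join remain. Joins of one set therefore have lengths of one parity, and different lengths
    -- differ by at least 2.
    odd-total : ∀ L → odd (totalLength d L) ≡ par c (ends L)
    odd-total []            = refl
    odd-total ((u , w) ∷ L) = trans (odd-+ (d u w) (totalLength d L))
      (trans (cong₂ _xor_ (d-parity u w) (odd-total L)) (xor-assoc (c u) (c w) _))

    positive-edge : ∀ L → 0 < totalLength d L → ∃ λ x → ∃ λ z → ∃ λ R →
                    0 < d x z × ends L ∼ x ∷ z ∷ ends R × totalLength d L ≡ d x z + totalLength d R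
    positive-edge ((u , w) ∷ L) pos with d u w in duw
    ... | suc k = u , w , L , subst (0 <_) (sym duw) (s≤s z≤n) , parity (λ _ → refl)
                , cong (_+ totalLength d L) (sym duw)
    ... | zero with positive-edge L pos
    ...   | x , z , R , dxz , L∼ , tL = x , z , (u , w) ∷ R , dxz
      , parity (λ ψ → trans (cong (λ b → ψ u xor (ψ w xor b)) (at L∼ ψ))
         (solve 5 (λ a b p q r → a xor (b xor (p xor (q xor r))) := p xor (q xor (a xor (b xor r)))) refl
           (ψ u) (ψ w) (ψ x) (ψ z) (par ψ (ends R))))
      , trans tL (cong (λ k → d x z + (k + totalLength d R)) (sym duw))

    -- Applied with `m` the minimum length of a T-join. Among the joins of T + `x₀` + a, for all
    -- points a, `M` is a shortest one, and `v` is the point a at which it is attained. The aim is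
    -- that lowering the distances around `v` costs only one unit of `m`.
    module Step (T : List V) (m : ℕ) (x₀ v : V) (M : List (V × V))
      (T-min : ∀ L → ends L ∼ T → m ≤ totalLength d L)
      (M∼ : ends M ∼ v ∷ x₀ ∷ T)
      (M-min : ∀ a L → ends L ∼ a ∷ x₀ ∷ T → totalLength d M ≤ totalLength d L)
      (M<m : totalLength d M < m) where

      -- d′ is the shortest-path closure of d minus the cut metric of near.
      near : V → Bool
      near u = isZero (d u v)

      e : V → ℕ
      e u = pred (d u v)

      d′ : V → V → ℕ
      d′ u w = d u w ⊓ (e u + e w)

      -- A unit removed across `near` flips the parity of exactly the separated pairs, so the colour
      -- changes on `near`.
      c′ : V → Bool
      c′ u = c u xor near u

      -- `M` is strictly shorter than `L` together with an edge from `a` to `v`, because `d a v` is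
      -- positive. Both have the ends `v`, `x₀` and T modulo 2, hence lengths of the same parity,
      -- and the gap is at least 2.
      strict-bound : ∀ a L → ends L ∼ a ∷ x₀ ∷ T → 0 < d a v → 2 + totalLength d M ≤ totalLength d L + d a v
      strict-bound a L L∼ pos = same-parity-<
        (ℕ.≤-<-trans (M-min a L L∼)
          (ℕ.<-≤-trans (ℕ.m<m+n (totalLength d L) pos) ℕ.≤-refl))
        (trans (odd-total M) (trans (combine₂
           (solve 6 (λ m l a v x t → m xor (l xor (a xor v)) := (m xor (v xor (x xor t))) xor
               (l xor (a xor (x xor t)))) refl
            (par c (ends M)) (par c (ends L)) (c a) (c v) (c x₀) (par c T))
           (at M∼ c) (at L∼ c))
         (sym (trans (odd-+ (totalLength d L) (d a v)) (cong₂ _xor_ (odd-total L) (d-parity a v))))))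

      -- An edge from `b₂` to `v` turns `L` into a join of T + `x₀` + `b₁`. The gap of 2 then pays
      -- for the two units by which `e b₁` and `e b₂` fall short of the distances to `v`.
      swap-pos : ∀ b₁ b₂ L → ends L ∼ b₁ ∷ b₂ ∷ v ∷ x₀ ∷ T → 0 < d b₁ v →
                 totalLength d M ≤ totalLength d L + (e b₁ + e b₂)
      swap-pos b₁ b₂ L L∼ pos = ℕ.+-cancelˡ-≤ 2 _ _ (begin
        2 + totalLength d M                            ≤⟨ strict-bound b₁ ((b₂ , v) ∷ L) b₁∼ pos ⟩
        d b₂ v + totalLength d L + d b₁ v ≤⟨ ℕ.+-mono-≤
            (ℕ.+-monoˡ-≤ (totalLength d L) (≤-suc-pred (d b₂ v))) (≤-suc-pred (d b₁ v)) ⟩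
        suc (e b₂) + totalLength d L + suc (e b₁)      ≡⟨ rearrange (e b₂) (totalLength d L) (e b₁) ⟩
        2 + (totalLength d L + (e b₁ + e b₂))          ∎)
        where
        open ℕ.≤-Reasoning
        rearrange : ∀ p q r → suc p + q + suc r ≡ 2 + (q + (r + p))
        rearrange = solve-∀
        b₁∼ : ends ((b₂ , v) ∷ L) ∼ b₁ ∷ x₀ ∷ T
        b₁∼ = parity λ ψ → combine₁
          (solve 6 (λ b₁ b₂ v l x t → (b₂ xor (v xor l)) xor (b₁ xor (x xor t)) := l xor
              (b₁ xor (b₂ xor (v xor (x xor t))))) refl
            (ψ b₁) (ψ b₂) (ψ v) (par ψ (ends L)) (ψ x₀) (par ψ T)) (at L∼ ψ)

      swap-bound : ∀ b₁ b₂ L → ends L ∼ b₁ ∷ b₂ ∷ v ∷ x₀ ∷ T → totalLength d M ≤ totalLength d L + (e b₁ + e b₂)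
      swap-bound b₁ b₂ L L∼ with d b₁ v ℕ.≟ 0 | d b₂ v ℕ.≟ 0
      ... | no b₁≢0 | _       = swap-pos b₁ b₂ L L∼ (ℕ.n≢0⇒n>0 b₁≢0)
      ... | yes _   | no b₂≢0 = subst (λ k → totalLength d M ≤ totalLength d L + k) (ℕ.+-comm (e b₂) (e b₁))
        (swap-pos b₂ b₁ L (parity λ ψ → trans (at L∼ ψ)
          (solve 3 (λ a b r → a xor (b xor r) := b xor (a xor r)) refl (ψ b₁) (ψ b₂) (par ψ (v ∷ x₀ ∷ T))))
          (ℕ.n≢0⇒n>0 b₂≢0))
      ... | yes _ | yes b₂≡0 = ℕ.≤-trans
        (M-min b₁ ((b₂ , v) ∷ L) (parity λ ψ → combine₁
          (solve 6 (λ b₁ b₂ v l x t → (b₂ xor (v xor l)) xor (b₁ xor (x xor t)) := l xor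
              (b₁ xor (b₂ xor (v xor (x xor t))))) refl
            (ψ b₁) (ψ b₂) (ψ v) (par ψ (ends L)) (ψ x₀) (par ψ T)) (at L∼ ψ)))
        (ℕ.≤-trans (ℕ.≤-reflexive (cong (_+ totalLength d L) b₂≡0)) (ℕ.m≤m+n (totalLength d L) _))

      -- The lowered distances admit nothing shorter than `M`: the points of `B` are thought of as
      -- linked to `v` at the lowered price `e`. A trail from a point of `B` exchanges `M` and `N`
      -- for one list that `swap-bound` controls and one that needs fewer points of `B`. In the sum
      -- of the two bounds one copy of the length of `M` cancels.
      anchored-bound : ∀ k N B → length B ≤ k → ends N ++ B ∼ v ∷ x₀ ∷ T →
                       totalLength d M ≤ totalLength d N + sumOf e B
      anchored-bound k N [] _ N∼ = ℕ.≤-trans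
        (M-min v N (parity λ ψ → trans (sym (trans (par-++ ψ (ends N) []) (xor-identityʳ _))) (at N∼ ψ)))
        (ℕ.m≤m+n (totalLength d N) 0)
      anchored-bound (suc k) N (b ∷ B) (s≤s len) N∼ with par (point b) B in oB
      -- Another copy of `b` in `B` cancels this one, and dropping both only lowers the right-hand
      -- side.
      ... | true with pluck (point b) e B oB
      ...   | b′ , B₁ , bb′ , B∼ , sB , lB with point-≡ bb′
      ...     | refl = ℕ.≤-trans
        (anchored-bound k N B₁ (ℕ.≤-trans (ℕ.n≤1+n _) (subst (_≤ k) lB len))
          (parity λ ψ → combine₂
            (solve 5 (λ nb₁ n b1 b r → nb₁ xor r := ((n xor (b xor (b xor b1))) xor r) xor (nb₁ xor (n xor b1))) refl
               (par ψ (ends N ++ B₁)) (par ψ (ends N)) (par ψ B₁) (ψ b) (par ψ (v ∷ x₀ ∷ T)))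
            (trans (cong (λ x → par ψ (ends N) xor (ψ b xor x)) (sym (at B∼ ψ)))
              (trans (sym (par-++ ψ (ends N) (b ∷ B))) (at N∼ ψ)))
            (par-++ ψ (ends N) B₁)))
        (ℕ.+-monoʳ-≤ (totalLength d N) (ℕ.≤-trans (ℕ.m≤n+m _ (e b))
          (ℕ.≤-trans (ℕ.≤-reflexive (sym sB)) (ℕ.m≤n+m _ (e b)))))
      anchored-bound (suc k) N (b ∷ B) (s≤s len) N∼ | false = swap
        where
        gap : ∀ ψ → par ψ (ends M) xor par ψ (ends N) ≡ ψ b xor par ψ B
        gap ψ = combine₂
          (solve 5 (λ m n b bb r → (m xor n) xor (b xor bb) := (m xor r) xor ((n xor (b xor bb)) xor r)) refl
            (par ψ (ends M)) (par ψ (ends N)) (ψ b) (par ψ B) (par ψ (v ∷ x₀ ∷ T)))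
          (at M∼ ψ) (trans (sym (par-++ ψ (ends N) (b ∷ B))) (at N∼ ψ))
        x : Exchange b M N
        x = exchange (length M + length N) M N b ℕ.≤-refl
              (trans (gap (point b)) (cong₂ _xor_ (point-refl b) oB))
        open Exchange x
        oddB : par (point partner) B ≡ true
        oddB = trans (sym (cong (_xor par (point partner) B) (point-no partner≢)))
                 (trans (sym (gap (point partner))) oddIn)
        swap : totalLength d M ≤ totalLength d N + (e b + sumOf e B)
        swap with pluck (point partner) e B oddB
        ... | b′ , B₁ , bb′ , B∼ , sB , lB with point-≡ bb′
        ...   | refl = ℕ.+-cancelˡ-≤ (totalLength d M) _ _ (begin
          totalLength d M + totalLength d M ≤⟨ ℕ.+-mono-≤
            (swap-bound b partner left (parity λ ψ → trans (at left∼ ψ)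
                (cong (λ y → ψ b xor (ψ partner xor y)) (at M∼ ψ))))
            (anchored-bound k right B₁ (ℕ.≤-trans (ℕ.n≤1+n _) (subst (_≤ k) lB len)) right∼′) ⟩
          (totalLength d left + (e b + e partner)) + (totalLength d right + sumOf e B₁)
            ≡⟨ rearrange₁ (totalLength d left) (e b) (e partner) (totalLength d right) (sumOf e B₁) ⟩
          (totalLength d left + totalLength d right) + (e b + (e partner + sumOf e B₁))
            ≡⟨ cong₂ (λ p q → p + (e b + q)) total≡ (sym sB) ⟩
          (totalLength d M + totalLength d N) + (e b + sumOf e B)
            ≡⟨ ℕ.+-assoc (totalLength d M) (totalLength d N) _ ⟩
          totalLength d M + (totalLength d N + (e b + sumOf e B)) ∎)
          where
          open ℕ.≤-Reasoning
          rearrange₁ : ∀ p q r s t → (p + (q + r)) + (s + t) ≡ (p + s) + (q + (r + t))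
          rearrange₁ = solve-∀
          right∼′ : ends right ++ B₁ ∼ v ∷ x₀ ∷ T
          right∼′ = parity λ ψ → trans (par-++ ψ (ends right) B₁) (combine₂
            (solve 6 (λ r b p n b1 t → (r xor b1) xor t := (r xor (b xor (p xor n))) xor
                ((n xor (b xor (p xor b1))) xor t)) refl
              (par ψ (ends right)) (ψ b) (ψ partner) (par ψ (ends N)) (par ψ B₁) (par ψ (v ∷ x₀ ∷ T)))
            (at right∼ ψ)
            (trans (cong (λ y → par ψ (ends N) xor (ψ b xor y)) (sym (at B∼ ψ)))
              (trans (sym (par-++ ψ (ends N) (b ∷ B))) (at N∼ ψ))))

      near-v : near v ≡ true
      near-v rewrite d-self v = refl

      x₀v-join : ends ((x₀ , v) ∷ M) ∼ T
      x₀v-join = parity λ ψ → combine₁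
        (solve 4 (λ x v m t → (x xor (v xor m)) xor t := m xor (v xor (x xor t))) refl
          (ψ x₀) (ψ v) (par ψ (ends M)) (par ψ T)) (at M∼ ψ)

      -- Otherwise `M` and an edge of length 0 from `x₀` to `v` would form a T-join shorter than
      -- `m`.
      near-x₀ : near x₀ ≡ false
      near-x₀ with d x₀ v in dxv
      ... | suc _ = refl
      ... | zero  = ⊥-elim (ℕ.<⇒≱ M<m (subst (λ k → m ≤ k + totalLength d M) dxv (T-min _ x₀v-join)))

      -- Otherwise M would leave the zero-class of v, and replacing the edge on
      -- which it does by one of length 0 would contradict the choice of v.
      near-T : par near T ≡ true
      near-T with par near T in oT
      ... | true  = refl
      ... | false with crossing near M (trans (at M∼ near) (cong₂ _xor_ near-v (cong₂ _xor_ near-x₀ oT)))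
      ...   | record { inner = s ; outer = a ; rest = R ; inside = ns ; outside = na ; ends∼ = E∼ ; cost≡ = tM } =
        ⊥-elim (ℕ.<⇒≱ short (M-min a ((s , v) ∷ R) (parity λ ψ → combine₂
          (solve 7 (λ m s a v r x t → (s xor (v xor r)) xor (a xor (x xor t)) := (m xor (s xor (a xor r)))
              xor (m xor (v xor (x xor t)))) refl
            (par ψ (ends M)) (ψ s) (ψ a) (ψ v) (par ψ (ends R)) (ψ x₀) (par ψ T))
          (at E∼ ψ) (at M∼ ψ))))
        where
        dsv : d s v ≡ 0
        dsv = isZero-true ns
        dsa : 0 < d s a
        dsa = ℕ.<-≤-trans (isZero-false na) (ℕ.≤-trans (d-triangle a s v)
          (ℕ.≤-reflexive (trans (cong₂ _+_ (d-sym a s) dsv) (ℕ.+-identityʳ _))))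
        short : d s v + totalLength d R < totalLength d M
        short = subst₂ _<_ (cong (_+ totalLength d R) (sym dsv)) (sym tM) (ℕ.+-monoˡ-< (totalLength d R) dsa)

      e-near : ∀ {u} → near u ≡ true → e u ≡ 0
      e-near {u} nu = cong pred (isZero-true nu)

      e-step : ∀ u w → e u ≤ d u w + e w
      e-step u w with d w v in dwv
      ... | zero  = ℕ.≤-trans ℕ.pred[n]≤n (ℕ.≤-trans (d-triangle u w v) (ℕ.≤-reflexive (cong (d u w +_) dwv)))
      ... | suc k = ℕ.pred-mono-≤ (ℕ.≤-trans (d-triangle u w v)
                      (ℕ.≤-reflexive (trans (cong (d u w +_) dwv) (ℕ.+-suc (d u w) k))))

      -- One of the two points lies at distance 0 from `v`, so its `e` vanishes and `e-step` bounds
      -- the other. Hence `d′` of a separated pair is always the detour through `v`.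
      detour : ∀ u w → near u xor near w ≡ true → e u + e w ≤ d u w
      detour u w o with near u in nu | near w in nw
      ... | true | false = ℕ.≤-trans (ℕ.≤-reflexive (cong (_+ e w) (e-near nu)))
        (ℕ.≤-trans (e-step w u) (ℕ.≤-reflexive (trans (cong₂ _+_ (d-sym w u) (e-near nu)) (ℕ.+-identityʳ _))))
      ... | false | true = ℕ.≤-trans (ℕ.≤-reflexive (trans (cong (e u +_) (e-near nw)) (ℕ.+-identityʳ _)))
        (ℕ.≤-trans (e-step u w) (ℕ.≤-reflexive (trans (cong (d u w +_) (e-near nw)) (ℕ.+-identityʳ _))))

      -- N consists of the edges kept as they are, B of the ends of those
      -- replaced by a path through v.
      split : ∀ L → ∃ λ N → ∃ λ B → ends L ∼ ends N ++ B × totalLength d N + sumOf e B ≤ totalLength d′ L ×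
              par near (ends N) ≡ false
      split [] = [] , [] , parity (λ _ → refl) , z≤n , refl
      split ((u , w) ∷ L) with split L
      ... | N , B , L∼ , len , nN = choose
        where
        via : e u + e w ≤ d u w → ∃ λ N → ∃ λ B → ends ((u , w) ∷ L) ∼ ends N ++ B ×
              totalLength d N + sumOf e B ≤ totalLength d′ ((u , w) ∷ L) × par near (ends N) ≡ false
        via le = N , u ∷ w ∷ B
          , parity (λ ψ → combine₂
             (solve 6 (λ u w l n b q → (u xor (w xor l)) xor (n xor (u xor (w xor b))) := (l xor q) xor
                 (q xor (n xor b))) refl
               (ψ u) (ψ w) (par ψ (ends L)) (par ψ (ends N)) (par ψ B) (par ψ (ends N ++ B)))
             (at L∼ ψ) (par-++ ψ (ends N) B)
             ⟨trans⟩ sym (par-++ ψ (ends N) (u ∷ w ∷ B)))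
          , ℕ.≤-trans (ℕ.≤-reflexive (rearrange (totalLength d N) (e u) (e w) (sumOf e B)))
              (ℕ.+-mono-≤ (ℕ.⊓-glb le ℕ.≤-refl) len)
          , nN
          where
          _⟨trans⟩_ : ∀ {x y z : Bool} → x ≡ y → y ≡ z → x ≡ z
          _⟨trans⟩_ = trans
          rearrange : ∀ p q r s → p + (q + (r + s)) ≡ (q + r) + (p + s)
          rearrange = solve-∀
        choose : ∃ λ N → ∃ λ B → ends ((u , w) ∷ L) ∼ ends N ++ B ×
                 totalLength d N + sumOf e B ≤ totalLength d′ ((u , w) ∷ L) × par near (ends N) ≡ false
        choose with near u xor near w in nuw | ℕ.≤-total (e u + e w) (d u w)
        ... | true  | _       = via (detour u w nuw)
        ... | false | inj₁ le = via le
        ... | false | inj₂ ge = (u , w) ∷ N , B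
          , parity (λ ψ → cong (λ b → ψ u xor (ψ w xor b)) (at L∼ ψ))
          , ℕ.≤-trans (ℕ.≤-reflexive (ℕ.+-assoc (d u w) (totalLength d N) _))
              (ℕ.+-mono-≤ (ℕ.⊓-glb ℕ.≤-refl ge) len)
          , trans (sym (xor-assoc (near u) (near w) _)) (cong₂ _xor_ nuw nN)

      -- T is odd in `near`, hence so is `B`, and a point of `B` in `near` is linked to `v` for
      -- free. What remains has the ends of T + `v`, whereas `anchored-bound` speaks about T + `v` +
      -- `x₀`. Supplying `x₀` takes one edge to `v` at its full length instead of `e`: this is the
      -- single unit lost. The edge starts at `x₀` if `x₀` is odd in `A`, and otherwise at the point
      -- of `A` that a trail from `x₀` reaches.
      lower : ∀ L → ends L ∼ T → m ≤ suc (totalLength d′ L)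
      lower L L∼T with split L
      ... | N , B , L∼ , len , nN with pluck near e B near-B
        where
        near-B : par near B ≡ true
        near-B = trans (sym (cong (_xor par near B) nN))
          (trans (sym (par-++ near (ends N) B)) (trans (sym (at L∼ near)) (trans (at L∼T near) near-T)))
      ... | s , A , ns , B∼ , sB , _ = ℕ.≤-trans bound
          (s≤s (ℕ.≤-trans (ℕ.≤-reflexive (cong (totalLength d N +_) (sym sumB))) len))
        where
        open ℕ.≤-Reasoning
        sumB : sumOf e B ≡ sumOf e A
        sumB = trans sB (cong (_+ sumOf e A) (e-near ns))
        N₁ : List (V × V)
        N₁ = (s , v) ∷ N
        N₁-total : totalLength d N₁ ≡ totalLength d N
        N₁-total = cong (_+ totalLength d N) (isZero-true ns)
        N₁∼ : ∀ ψ → par ψ (ends N₁) xor par ψ A ≡ ψ v xor par ψ T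
        N₁∼ ψ = combine₂
          (solve 7 (λ s v n a b t l → ((s xor (v xor n)) xor a) xor (v xor t) := (t xor (n xor b)) xor
              (b xor (s xor a))) refl
            (ψ s) (ψ v) (par ψ (ends N)) (par ψ A) (par ψ B) (par ψ T) true)
          (trans (sym (at L∼T ψ)) (trans (at L∼ ψ) (par-++ ψ (ends N) B)))
          (at B∼ ψ)
        rearrange₁ : ∀ p q r → suc p + (q + r) ≡ suc (q + (p + r))
        rearrange₁ = solve-∀
        bound : m ≤ suc (totalLength d N + sumOf e A)
        bound with par (point x₀) A in oA
        ... | true with pluck (point x₀) e A oA
        ...   | x′ , A₁ , xx′ , A∼ , sA , _ with point-≡ xx′
        ...     | refl = begin
          m                                   ≤⟨ T-min _ x₀v-join ⟩
          d x₀ v + totalLength d M                    ≤⟨ ℕ.+-mono-≤ (≤-suc-pred (d x₀ v))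
                                                  (anchored-bound (length A₁) N₁ A₁ ℕ.≤-refl (parity λ ψ → trans (par-++ ψ (ends N₁) A₁) (combine₂
                                                    (solve 6 (λ n a1 x a v t → (n xor a1) xor (v xor (x xor t)) := ((n xor a) xor (v xor t)) xor (a xor (x xor a1))) refl
                                                      (par ψ (ends N₁)) (par ψ A₁) (ψ x₀) (par ψ A) (ψ v) (par ψ T))
                                                    (N₁∼ ψ) (at A∼ ψ)))) ⟩
          suc (e x₀) + (totalLength d N₁ + sumOf e A₁) ≡⟨ rearrange₁ (e x₀) (totalLength d N₁) (sumOf e A₁) ⟩
          suc (totalLength d N₁ + (e x₀ + sumOf e A₁)) ≡⟨ cong₂ (λ p q → suc (p + q)) N₁-total (sym sA) ⟩
          suc (totalLength d N + sumOf e A)           ∎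
        bound | false = exchanged
          where
          gap : ∀ ψ → par ψ (ends M) xor par ψ (ends N₁) ≡ ψ x₀ xor par ψ A
          gap ψ = combine₂
            (solve 6 (λ m n x a v t → (m xor n) xor (x xor a) := (m xor (v xor (x xor t))) xor
                ((n xor a) xor (v xor t))) refl
              (par ψ (ends M)) (par ψ (ends N₁)) (ψ x₀) (par ψ A) (ψ v) (par ψ T))
            (at M∼ ψ) (N₁∼ ψ)
          x : Exchange x₀ M N₁
          x = exchange (length M + length N₁) M N₁ x₀ ℕ.≤-refl
                (trans (gap (point x₀)) (cong₂ _xor_ (point-refl x₀) oA))
          open Exchange x
          odd-A : par (point partner) A ≡ true
          odd-A = trans (sym (cong (_xor par (point partner) A) (point-no partner≢)))
                    (trans (sym (gap (point partner))) oddIn)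
          exchanged : m ≤ suc (totalLength d N + sumOf e A)
          exchanged with pluck (point partner) e A odd-A
          ... | b′ , A₁ , bb′ , A∼ , sA , _ with point-≡ bb′
          ...   | refl = ℕ.+-cancelʳ-≤ (totalLength d M) _ _ (begin
            m + totalLength d M ≤⟨ ℕ.+-mono-≤ (ℕ.≤-trans (T-min ((partner , v) ∷ left) left∼′)
                (ℕ.+-monoˡ-≤ (totalLength d left) (≤-suc-pred (d partner v))))
                             (anchored-bound (length A₁) right A₁ ℕ.≤-refl right∼′) ⟩
            (suc (e partner) + totalLength d left) + (totalLength d right + sumOf e A₁)
              ≡⟨ rearrange₂ (e partner) (totalLength d left) (totalLength d right) (sumOf e A₁) ⟩
            suc ((totalLength d left + totalLength d right) + (e partner + sumOf e A₁))
              ≡⟨ cong₂ (λ p q → suc (p + q)) (trans total≡ (cong (totalLength d M +_) N₁-total)) (sym sA) ⟩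
            suc ((totalLength d M + totalLength d N) + sumOf e A)
              ≡⟨ rearrange₃ (totalLength d M) (totalLength d N) (sumOf e A) ⟩
            suc (totalLength d N + sumOf e A) + totalLength d M ∎)
            where
            rearrange₂ : ∀ p q r t → (suc p + q) + (r + t) ≡ suc ((q + r) + (p + t))
            rearrange₂ = solve-∀
            rearrange₃ : ∀ p q r → suc ((p + q) + r) ≡ suc (q + r) + p
            rearrange₃ = solve-∀
            left∼′ : ends ((partner , v) ∷ left) ∼ T
            left∼′ = parity λ ψ → combine₂
              (solve 6 (λ p v l t x m → (p xor (v xor l)) xor t := (l xor (x xor (p xor m))) xor
                  (m xor (v xor (x xor t)))) refl
                (ψ partner) (ψ v) (par ψ (ends left)) (par ψ T) (ψ x₀) (par ψ (ends M)))
              (at left∼ ψ) (at M∼ ψ)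
            right∼′ : ends right ++ A₁ ∼ v ∷ x₀ ∷ T
            right∼′ = parity λ ψ → trans (par-++ ψ (ends right) A₁) (combine₂
              (solve 7 (λ r a1 v x t p n → (r xor a1) xor (v xor (x xor t)) := (r xor (x xor (p xor n))) xor
                  ((n xor (p xor a1)) xor (v xor t))) refl
                (par ψ (ends right)) (par ψ A₁) (ψ v) (ψ x₀) (par ψ T) (ψ partner) (par ψ (ends N₁)))
              (at right∼ ψ)
              (trans (cong (par ψ (ends N₁) xor_) (sym (at A∼ ψ))) (N₁∼ ψ)))

      -- The two terms of the minimum in d′ have the same parity, unless the pair is
      -- separated by near; then the second term is the smaller one.
      e-parity : ∀ u → odd (e u) ≡ c u xor (c v xor not (near u))
      e-parity u with d u v in duv | d-parity u v
      ... | zero  | p = trans p (cong (c u xor_) (sym (xor-identityʳ (c v))))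
      ... | suc k | p = trans (sym (not-involutive _)) (trans (cong not p)
                          (solve 2 (λ a b → not (a xor b) := a xor (b xor true)) refl (c u) (c v)))

      d′-cross : ∀ u w → near u xor near w ≡ true → d′ u w ≡ e u + e w
      d′-cross u w o = ℕ.m≥n⇒m⊓n≡n (detour u w o)

      d′-parity : ∀ u w → odd (d′ u w) ≡ c′ u xor c′ w
      d′-parity u w with ℕ.≤-total (d u w) (e u + e w) | near u xor near w in o
      ... | inj₁ le | false = trans (cong odd (ℕ.m≤n⇒m⊓n≡m le)) (trans (d-parity u w) (combine₁
            (solve 4 (λ a b x y → (a xor b) xor ((a xor x) xor (b xor y)) := (x xor y) xor false) refl (c u)
                (c w) (near u) (near w)) o))
      ... | inj₁ le | true = trans (cong odd (d′-cross u w o))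
          (trans (odd-+ (e u) (e w)) (trans (cong₂ _xor_ (e-parity u) (e-parity w))
            (solve 5 (λ a b x y z → (a xor (z xor not x)) xor (b xor (z xor not y)) := (a xor x) xor
                (b xor y)) refl (c u) (c w) (near u) (near w) (c v))))
      ... | inj₂ ge | _ = trans (cong odd (ℕ.m≥n⇒m⊓n≡n ge))
          (trans (odd-+ (e u) (e w)) (trans (cong₂ _xor_ (e-parity u) (e-parity w))
            (solve 5 (λ a b x y z → (a xor (z xor not x)) xor (b xor (z xor not y)) := (a xor x) xor
                (b xor y)) refl (c u) (c w) (near u) (near w) (c v))))

      d′-triangle : ∀ u x w → d′ u w ≤ d′ u x + d′ x w
      d′-triangle u x w with ℕ.≤-total (d u x) (e u + e x) | ℕ.≤-total (d x w) (e x + e w)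
      ... | inj₁ le | inj₁ le′ rewrite ℕ.m≤n⇒m⊓n≡m le | ℕ.m≤n⇒m⊓n≡m le′ =
        ℕ.≤-trans (ℕ.m⊓n≤m (d u w) _) (d-triangle u x w)
      ... | inj₁ le | inj₂ ge′ rewrite ℕ.m≤n⇒m⊓n≡m le | ℕ.m≥n⇒m⊓n≡n ge′ =
        ℕ.≤-trans (ℕ.m⊓n≤n (d u w) _) (ℕ.≤-trans (ℕ.+-monoˡ-≤ (e w) (e-step u x))
            (ℕ.≤-reflexive (ℕ.+-assoc (d u x) _ _)))
      ... | inj₂ ge | inj₁ le′ rewrite ℕ.m≥n⇒m⊓n≡n ge | ℕ.m≤n⇒m⊓n≡m le′ =
        ℕ.≤-trans (ℕ.m⊓n≤n (d u w) _) (ℕ.≤-trans (ℕ.+-monoʳ-≤ (e u) (e-step w x))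
          (ℕ.≤-reflexive (trans (cong (λ k → e u + (k + e x)) (d-sym w x)) (rearrange (e u) (d x w) (e x)))))
        where
        rearrange : ∀ p q r → p + (q + r) ≡ (p + r) + q
        rearrange = solve-∀
      ... | inj₂ ge | inj₂ ge′ rewrite ℕ.m≥n⇒m⊓n≡n ge | ℕ.m≥n⇒m⊓n≡n ge′ =
        ℕ.≤-trans (ℕ.m⊓n≤n (d u w) _) (ℕ.+-mono-≤ (ℕ.m≤m+n (e u) (e x)) (ℕ.m≤n+m (e w) (e x)))

      d′-integral : IsIntegral d′ c′
      d′-integral = record
        { d-sym = λ u w → cong₂ _⊓_ (d-sym u w) (ℕ.+-comm (e u) (e w))
        ; d-self = λ u → cong (_⊓ (e u + e u)) (d-self u)
        ; d-triangle = d′-triangle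
        ; d-parity = d′-parity }

      across : ∀ u w → near u ≡ false → near w ≡ true → suc (e u + e w) ≤ d u w
      across u w nu nw = begin
        suc (e u + e w)   ≡⟨ cong (λ k → suc (e u + k)) (e-near nw) ⟩
        suc (e u + 0)     ≡⟨ cong suc (ℕ.+-identityʳ (e u)) ⟩
        suc (e u)         ≡⟨ ℕ.suc-pred (d u v) {{ℕ.>-nonZero (isZero-false nu)}} ⟩
        d u v             ≤⟨ d-triangle u w v ⟩
        d u w + d w v     ≡⟨ cong (d u w +_) (isZero-true nw) ⟩
        d u w + 0         ≡⟨ ℕ.+-identityʳ (d u w) ⟩
        d u w             ∎
        where open ℕ.≤-Reasoning

      d′-capacity : ∀ u w → bit (near u xor near w) + d′ u w ≤ d u w
      d′-capacity u w with near u in nu | near w in nw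
      ... | true  | true  = ℕ.m⊓n≤m (d u w) _
      ... | false | false = ℕ.m⊓n≤m (d u w) _
      ... | true  | false = ℕ.≤-trans (s≤s (ℕ.m⊓n≤n (d u w) _)) (subst₂ (λ j k → suc j ≤ k)
                              (ℕ.+-comm (e w) (e u)) (d-sym w u) (across w u nw nu))
      ... | false | true  = ℕ.≤-trans (s≤s (ℕ.m⊓n≤n (d u w) _)) (across u w nu nw)

  crossings : {V : Set} → List (V → Bool) → V → V → ℕ
  crossings []       u w = 0
  crossings (χ ∷ χs) u w = bit (χ u xor χ w) + crossings χs u w

  module _ {V : Set} (_≟_ : DecidableEquality V) (T : List V) (J₀ : List (V × V)) (J₀∼ : ends J₀ ∼ T) where

    record CutPacking (d : V → V → ℕ) (m : ℕ) : Set where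
      field
        cuts     : List (V → Bool)
        size     : length cuts ≡ m
        T-odd    : All (λ χ → par χ T ≡ true) cuts
        capacity : ∀ u w → crossings cuts u w ≤ d u w

    -- The integral form of the Edmonds–Johnson theorem.  The minima used in the
    -- proof need not be computable, hence the double negation.
    T-cut-packing : ∀ m d c (int : IsIntegral d c) →
      (∀ L → ends L ∼ T → m ≤ totalLength d L) →
      ¬ ¬ CutPacking d m
    T-cut-packing zero    d c int lb none = none (record
      { cuts = [] ; size = refl ; T-odd = [] ; capacity = λ _ _ → z≤n })
    T-cut-packing (suc m) d c int lb none =
      ¬¬-least (λ k → ∃ λ J → ends J ∼ T × totalLength d J ≡ k) (_ , J₀ , J₀∼ , refl) minimal-join
      where
      open Reduction _≟_ d c int
      minimal-join : ¬ ∃ λ k → (∃ λ J → ends J ∼ T × totalLength d J ≡ k) ×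
                     (∀ j → (∃ λ J → ends J ∼ T × totalLength d J ≡ j) → k ≤ j)
      minimal-join (k , (J , J∼ , refl) , J-min) with positive-edge J (ℕ.≤-trans (s≤s z≤n) (lb J J∼))
      ... | x₀ , z , R , pos , J∼′ , tJ =
        ¬¬-least (λ k → ∃ λ v → ∃ λ M → ends M ∼ v ∷ x₀ ∷ T × totalLength d M ≡ k)
          (_ , z , R , R∼ , refl) minimal-end
        where
        R∼ : ends R ∼ z ∷ x₀ ∷ T
        R∼ = parity λ ψ → combine₂
          (solve 5 (λ r z x t j → r xor (z xor (x xor t)) := (j xor (x xor (z xor r))) xor (j xor t)) refl
            (par ψ (ends R)) (ψ z) (ψ x₀) (par ψ T) (par ψ (ends J)))
          (at J∼′ ψ) (at J∼ ψ)
        minimal-end : ¬ ∃ λ k → (∃ λ v → ∃ λ M → ends M ∼ v ∷ x₀ ∷ T × totalLength d M ≡ k) ×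
                      (∀ j → (∃ λ v → ∃ λ M → ends M ∼ v ∷ x₀ ∷ T × totalLength d M ≡ j) → k ≤ j)
        minimal-end (_ , (v , M , M∼ , refl) , M-min) =
          -- The lower bound falls from `suc m` to `m`, and the cut `near` makes up for it with the
          -- unit that `d′-capacity` leaves.
          T-cut-packing m d′ c′ d′-integral (λ L L∼ → ℕ.≤-pred (ℕ.≤-trans (lb J J∼) (lower L L∼))) λ p →
            none (record
              { cuts = near ∷ CutPacking.cuts p
              ; size = cong suc (CutPacking.size p)
              ; T-odd = near-T ∷ CutPacking.T-odd p
              ; capacity = λ u w → ℕ.≤-trans (ℕ.+-monoʳ-≤ (bit (near u xor near w)) (CutPacking.capacity p u w))
                                     (d′-capacity u w) })
          where
          -- The minimum itself is passed on, not the bound `suc m`: `M` is strictly shorter than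
          -- `J`, because `R` is `J` without an edge of positive length.
          open Step T (totalLength d J) x₀ v M (λ L L∼ → J-min _ (L , L∼ , refl)) M∼
            (λ a L L∼ → M-min _ (a , L , L∼ , refl))
            (ℕ.≤-<-trans (M-min _ (z , R , R∼ , refl))
              (subst (totalLength d R <_) (sym tJ) (ℕ.m<n+m (totalLength d R) pos)))

  -- Pairing the rows of two subtrees

  private
    variable
      X Y : Set

  splitAt : ∀ a b (xs : List X) → length xs ≡ a + b →
            ∃ λ ys → ∃ λ zs → xs ≡ ys ++ zs × length ys ≡ a × length zs ≡ b
  splitAt zero    b xs       l = [] , xs , refl , refl , l
  splitAt (suc a) b (x ∷ xs) l with splitAt a b xs (ℕ.suc-injective l)
  ... | ys , zs , refl , la , lb = x ∷ ys , zs , refl , cong suc la , lb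

  ≤⇒∃+ : ∀ {m n} → m ≤ n → ∃ λ k → n ≡ m + k
  ≤⇒∃+ {m} {n} m≤n = n ∸ m , sym (ℕ.m+[n∸m]≡n m≤n)

  -- A row is central if its count is the middle one of three consecutive values;
  -- oo rows are to be paired off-centre with off-centre, oe off-centre with
  -- central, and so on.  Opposite deviations are paired as long as possible; if
  -- one sign runs out, the sums fall into a shifted window.
  data Plan (m₁ k₁ p₁ m₂ k₂ p₂ oo oe eo ee : ℕ) : Set where
    balanced : ∀ u v m₁′ p₁′ m₂′ p₂′ → p₁ ≡ u + p₁′ → m₁ ≡ v + m₁′ → p₂ ≡ v + p₂′ → m₂ ≡ u + m₂′ →
               u + v ≡ oo → m₁′ + p₁′ ≡ oe → m₂′ + p₂′ ≡ eo → Plan m₁ k₁ p₁ m₂ k₂ p₂ oo oe eo ee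
    up       : ∀ t → p₁ ≡ m₂ + (t + oe) → p₂ ≡ m₁ + (t + eo) → m₁ + (m₂ + t) ≡ oo → Plan m₁ k₁ p₁ m₂ k₂ p₂ oo oe eo ee
    down     : ∀ t → m₁ ≡ p₂ + (t + oe) → m₂ ≡ p₁ + (t + eo) → p₁ + (p₂ + t) ≡ oo → Plan m₁ k₁ p₁ m₂ k₂ p₂ oo oe eo ee

  module _ {m₁ k₁ p₁ m₂ k₂ p₂ oo oe eo ee : ℕ}
           (off₁ : m₁ + p₁ ≡ oo + oe) (off₂ : m₂ + p₂ ≡ oo + eo) where

    private
      P = Plan m₁ k₁ p₁ m₂ k₂ p₂ oo oe eo ee

      shift : ∀ {m p t q e} → m + p ≡ (m + (q + t)) + e → p ≡ q + (t + e)
      shift {m} {p} {t} {q} {e} h = ℕ.+-cancelˡ-≡ m p (q + (t + e)) (trans h (rearrange m q t e))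
        where
        rearrange : ∀ m q t e → (m + (q + t)) + e ≡ m + (q + (t + e))
        rearrange = solve-∀

      use : ∀ u v → u + v ≡ oo → u ≤ p₁ → v ≤ m₁ → v ≤ p₂ → u ≤ m₂ → P
      use u v uv u≤p₁ v≤m₁ v≤p₂ u≤m₂ with ≤⇒∃+ u≤p₁ | ≤⇒∃+ v≤m₁ | ≤⇒∃+ v≤p₂ | ≤⇒∃+ u≤m₂
      ... | p₁′ , e₁ | m₁′ , e₂ | p₂′ , e₃ | m₂′ , e₄ = balanced u v m₁′ p₁′ m₂′ p₂′ e₁ e₂ e₃ e₄ uv
        (ℕ.+-cancelˡ-≡ oo _ _ (trans (trans (cong (_+ (m₁′ + p₁′)) (sym uv))
            (trans (rearrange₁ u v m₁′ p₁′) (sym (cong₂ _+_ e₂ e₁)))) off₁))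
        (ℕ.+-cancelˡ-≡ oo _ _ (trans (trans (cong (_+ (m₂′ + p₂′)) (sym uv))
            (trans (rearrange₂ u v m₂′ p₂′) (sym (cong₂ _+_ e₄ e₃)))) off₂))
        where
        rearrange₁ : ∀ u v m p → (u + v) + (m + p) ≡ (v + m) + (u + p)
        rearrange₁ = solve-∀
        rearrange₂ : ∀ u v m p → (u + v) + (m + p) ≡ (u + m) + (v + p)
        rearrange₂ = solve-∀

      oo≤₁ : oo ≤ m₁ + p₁
      oo≤₁ = ℕ.≤-trans (ℕ.m≤m+n oo oe) (ℕ.≤-reflexive (sym off₁))

      oo≤₂ : oo ≤ m₂ + p₂
      oo≤₂ = ℕ.≤-trans (ℕ.m≤m+n oo eo) (ℕ.≤-reflexive (sym off₂))

      rest≤ : ∀ {u x} → u ≤ oo → oo ≤ x + u → oo ∸ u ≤ x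
      rest≤ {u} {x} u≤ h = ℕ.≤-trans (ℕ.∸-monoˡ-≤ u h) (ℕ.≤-reflexive (ℕ.m+n∸n≡m x u))

      -- The greedy choice is u = min{`oo`, `p₁`, `m₂`}. Whichever of the three attains the minimum,
      -- the four lower bounds on sums of two sign counts leave room for v = `oo` - u in `m₁` and in
      -- `p₂`.
      balance : oo ≤ m₁ + m₂ → oo ≤ p₁ + p₂ → P
      balance hm hp with ℕ.≤-total oo p₁ | ℕ.≤-total oo m₂ | ℕ.≤-total p₁ m₂
      ... | inj₁ a | inj₁ b | _      = use oo 0 (ℕ.+-identityʳ oo) a z≤n z≤n b
      ... | inj₂ a | _      | inj₁ c = use p₁ (oo ∸ p₁) (ℕ.m+[n∸m]≡n a) ℕ.≤-refl (rest≤ a oo≤₁)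
                                         (rest≤ a (ℕ.≤-trans hp (ℕ.≤-reflexive (ℕ.+-comm p₁ p₂)))) c
      ... | _      | inj₂ b | inj₂ c = use m₂ (oo ∸ m₂) (ℕ.m+[n∸m]≡n b) c (rest≤ b hm)
                                         (rest≤ b (ℕ.≤-trans oo≤₂ (ℕ.≤-reflexive (ℕ.+-comm m₂ p₂)))) ℕ.≤-refl
      ... | inj₁ a | inj₂ b | inj₁ c = use oo 0 (ℕ.+-identityʳ oo) a z≤n z≤n (ℕ.≤-trans a c)
      ... | inj₂ a | inj₁ b | inj₂ c = use oo 0 (ℕ.+-identityʳ oo) (ℕ.≤-trans b c) z≤n z≤n b

    -- If `oo` exceeds `m₁ + m₂`, each negative deviation meets a positive one and the shortage `t`
    -- has to be filled with pairs of two positive ones; `down` is the mirror image.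
    plan : P
    plan with oo ≤? m₁ + m₂ | oo ≤? p₁ + p₂
    ... | yes hm | yes hp = balance hm hp
    ... | no ¬hm | _ with ≤⇒∃+ (ℕ.<⇒≤ (ℕ.≰⇒> ¬hm))
    ...   | t , refl = up t
        (shift {m₁} {t = t} {m₂} (trans off₁ (cong (_+ oe) (ℕ.+-assoc m₁ m₂ t))))
        (shift {m₂} {t = t} {m₁} (trans off₂ (cong (_+ eo) (rearrange m₁ m₂ t))))
        (sym (ℕ.+-assoc m₁ m₂ t))
        where
        rearrange : ∀ a b c → (a + b) + c ≡ b + (a + c)
        rearrange = solve-∀
    plan | yes _ | no ¬hp with ≤⇒∃+ (ℕ.<⇒≤ (ℕ.≰⇒> ¬hp))
    ...   | t , refl = down t
        (shift {p₁} {t = t} {p₂} (trans (ℕ.+-comm p₁ m₁) (trans off₁ (cong (_+ oe) (ℕ.+-assoc p₁ p₂ t)))))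
        (shift {p₂} {t = t} {p₁} (trans (ℕ.+-comm p₂ m₂) (trans off₂ (cong (_+ eo) (rearrange p₁ p₂ t)))))
        (sym (ℕ.+-assoc p₁ p₂ t))
        where
        rearrange : ∀ a b c → (a + b) + c ≡ b + (a + c)
        rearrange = solve-∀

  record Rows (c : X → ℕ) (b l m h : ℕ) (xs : List X) : Set where
    field
      low mid high : List X
      perm         : low ++ mid ++ high ↭ xs
      low≡         : All (λ x → c x ≡ b) low
      mid≡         : All (λ x → c x ≡ 1 + b) mid
      high≡        : All (λ x → c x ≡ 2 + b) high
      low-length   : length low ≡ l
      mid-length   : length mid ≡ m
      high-length  : length high ≡ h

  zip-proj₁ : ∀ {N} (as : List X) (bs : List Y) → length as ≡ N → length bs ≡ N → map proj₁ (zip as bs) ≡ as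
  zip-proj₁ []       _        _ _ = refl
  zip-proj₁ {N = suc N} (a ∷ as) (b ∷ bs) p q = cong (a ∷_) (zip-proj₁ as bs (ℕ.suc-injective p) (ℕ.suc-injective q))
  zip-proj₁ {N = zero} (a ∷ as) (b ∷ bs) () q
  zip-proj₁ {N = suc N} (a ∷ as) [] p ()

  zip-proj₂ : ∀ {N} (as : List X) (bs : List Y) → length as ≡ N → length bs ≡ N → map proj₂ (zip as bs) ≡ bs
  zip-proj₂ []       []       _ _ = refl
  zip-proj₂ (a ∷ as) []       _ _ = refl
  zip-proj₂ {N = suc N} (a ∷ as) (b ∷ bs) p q = cong (b ∷_) (zip-proj₂ as bs (ℕ.suc-injective p) (ℕ.suc-injective q))
  zip-proj₂ {N = zero} [] (b ∷ bs) _ ()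
  zip-proj₂ {N = suc N} [] (b ∷ bs) () _

  zip-length : ∀ {N} (as : List X) (bs : List Y) → length as ≡ N → length bs ≡ N → length (zip as bs) ≡ N
  zip-length []       _        p _ = p
  zip-length (a ∷ as) []       _ q = q
  zip-length {N = suc N} (a ∷ as) (b ∷ bs) p q = cong suc (zip-length as bs (ℕ.suc-injective p) (ℕ.suc-injective q))

  Zipped : List (X × Y) → List X → List Y → Set
  Zipped zs as bs = map proj₁ zs ≡ as × map proj₂ zs ≡ bs

  block : ∀ {N} (as : List X) (bs : List Y) → length as ≡ N → length bs ≡ N → Zipped (zip as bs) as bs
  block as bs p q = zip-proj₁ as bs p q , zip-proj₂ as bs p q

  infixr 5 _∙_
  _∙_ : ∀ {zs zs′} {as as′ : List X} {bs bs′ : List Y} → Zipped zs as bs → Zipped zs′ as′ bs′ →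
        Zipped (zs ++ zs′) (as ++ as′) (bs ++ bs′)
  _∙_ {zs = zs} {zs′} (p , q) (p′ , q′) = trans (map-++ proj₁ zs zs′) (cong₂ _++_ p p′) , trans
      (map-++ proj₂ zs zs′) (cong₂ _++_ q q′)

  infixr 5 _⊞_
  _⊞_ : (X → ℕ) → (Y → ℕ) → X × Y → ℕ
  (c₁ ⊞ c₂) (x , y) = c₁ x + c₂ y

  module _ {X Y : Set} (c₁ : X → ℕ) (c₂ : Y → ℕ) where

    private
      c : X × Y → ℕ
      c = c₁ ⊞ c₂

      zip-all : ∀ {v₁ v₂ v as bs} → v₁ + v₂ ≡ v → All (λ x → c₁ x ≡ v₁) as → All (λ y → c₂ y ≡ v₂) bs →
                All (λ z → c z ≡ v) (zip as bs)
      zip-all e []       _        = []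
      zip-all e (p ∷ ps) []       = []
      zip-all e (p ∷ ps) (q ∷ qs) = trans (cong₂ _+_ p q) e ∷ zip-all e ps qs

      length-++₂ : ∀ {A : Set} {a b} (xs ys : List A) → length xs ≡ a → length ys ≡ b → length (xs ++ ys) ≡ a + b
      length-++₂ xs ys p q = trans (length-++ xs) (cong₂ _+_ p q)

      0+1 : ∀ a b → a + (1 + b) ≡ 1 + (a + b)
      0+1 = solve-∀
      0+2 : ∀ a b → a + (2 + b) ≡ 2 + (a + b)
      0+2 = solve-∀
      1+0 : ∀ a b → (1 + a) + b ≡ 1 + (a + b)
      1+0 _ _ = refl
      2+0 : ∀ a b → (2 + a) + b ≡ 2 + (a + b)
      2+0 _ _ = refl
      2+1 : ∀ a b → (2 + a) + (1 + b) ≡ 3 + (a + b)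
      2+1 = solve-∀
      1+1 : ∀ a b → (1 + a) + (1 + b) ≡ 2 + (a + b)
      1+1 = solve-∀
      1+2 : ∀ a b → (1 + a) + (2 + b) ≡ 3 + (a + b)
      1+2 = solve-∀
      2+2 : ∀ a b → (2 + a) + (2 + b) ≡ 4 + (a + b)
      2+2 = solve-∀

    -- The first alternative keeps the window centred at the sum of the two centres. In the second
    -- it has moved by one, up or down, so that the formerly off-centre sums are central. Only the
    -- parity of `base` is recorded, which is the same for both directions.
    record Combined (b₁ b₂ oo oe eo ee : ℕ) (xs : List X) (ys : List Y) : Set where
      field
        zs        : List (X × Y)
        left↭     : map proj₁ zs ↭ xs
        right↭    : map proj₂ zs ↭ ys
        base      : ℕ
        l h       : ℕ
        placement : (odd base ≡ odd (1 + (b₁ + b₂)) × Rows c base l (oo + ee) h zs × l + h ≡ oe + eo) ⊎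
                    (odd base ≡ odd (b₁ + b₂) × Rows c base l (oe + eo) h zs × l + h ≡ oo + ee)

    module _ {b₁ m₁ k₁ p₁ b₂ m₂ k₂ p₂ oo oe eo ee : ℕ} {xs : List X} {ys : List Y}
             (r₁ : Rows c₁ b₁ m₁ k₁ p₁ xs) (r₂ : Rows c₂ b₂ m₂ k₂ p₂ ys)
             (k₁≡ : k₁ ≡ eo + ee) (k₂≡ : k₂ ≡ oe + ee) where

      private
        module R₁ = Rows r₁
        module R₂ = Rows r₂
        open module SX = CMSolver (Perm.++-commutativeMonoid {A = X}) using () renaming (_⊕_ to _⊕ˣ_; _⊜_ to _⊜ˣ_)
        open module SY = CMSolver (Perm.++-commutativeMonoid {A = Y}) using () renaming (_⊕_ to _⊕ʸ_; _⊜_ to _⊜ʸ_)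

        assoc₄ : ∀ a b c d → (a + (b + c)) + d ≡ (a + (b + d)) + c
        assoc₄ = solve-∀

      -- Measured from `b₁ + b₂`, the sums are 2 (opposite deviations, or two central rows), 3 (a
      -- high row with a central one) and 4 (the `t` pairs of high rows). In `combine-down` they are
      -- 0, 1 and 2, in `combine-balanced` 1, 2 and 3.
      combine-up : ∀ t → p₁ ≡ m₂ + (t + oe) → p₂ ≡ m₁ + (t + eo) → m₁ + (m₂ + t) ≡ oo →
                   Combined b₁ b₂ oo oe eo ee xs ys
      combine-up t e₁ e₂ e₃
        with splitAt m₂ (t + oe) R₁.high (trans R₁.high-length e₁) | splitAt m₁ (t + eo) R₂.high
            (trans R₂.high-length e₂)
           | splitAt eo ee R₁.mid (trans R₁.mid-length k₁≡) | splitAt oe ee R₂.mid (trans R₂.mid-length k₂≡)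
      ... | Pa , P′ , eP , lPa , lP′ | Qa , Q′ , eQ , lQa , lQ′ | Ka , Kb , eK , lKa , lKb | La , Lb , eL , lLa , lLb
        with splitAt t oe P′ lP′ | splitAt t eo Q′ lQ′
      ... | Pb , Pc , refl , lPb , lPc | Qb , Qc , refl , lQb , lQc = record
        { zs = low ++ mid ++ high
        ; left↭ = ↭-trans (↭-reflexive (proj₁ zipped)) (↭-trans
            (SX.solve 6 (λ m pa kb pc ka pb → ((m ⊕ˣ (pa ⊕ˣ kb)) ⊕ˣ ((pc ⊕ˣ ka) ⊕ˣ pb)) ⊜ˣ
                (m ⊕ˣ ((ka ⊕ˣ kb) ⊕ˣ (pa ⊕ˣ (pb ⊕ˣ pc))))) ↭-refl
              R₁.low Pa Kb Pc Ka Pb)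
            (↭-trans (↭-reflexive (cong₂ (λ k p → R₁.low ++ k ++ p) (sym eK) (sym eP))) R₁.perm))
        ; right↭ = ↭-trans (↭-reflexive (proj₂ zipped)) (↭-trans
            (SY.solve 6 (λ m qa lb qc la qb → ((qa ⊕ʸ (m ⊕ʸ lb)) ⊕ʸ ((la ⊕ʸ qc) ⊕ʸ qb)) ⊜ʸ
                (m ⊕ʸ ((la ⊕ʸ lb) ⊕ʸ (qa ⊕ʸ (qb ⊕ʸ qc))))) ↭-refl
              R₂.low Qa Lb Qc La Qb)
            (↭-trans (↭-reflexive (cong₂ (λ k p → R₂.low ++ k ++ p) (sym eL) (sym eQ))) R₂.perm))
        ; base = 2 + (b₁ + b₂)
        ; l = m₁ + (m₂ + ee) ; h = t
        ; placement = inj₂ (Bool.not-involutive _ , record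
          { low = low ; mid = mid ; high = high ; perm = ↭-refl
          ; low≡ = All.++⁺ (zip-all (0+2 b₁ b₂) R₁.low≡ (proj₁ Q≡))
                     (All.++⁺ (zip-all (2+0 b₁ b₂) (proj₁ P≡) R₂.low≡) (zip-all (1+1 b₁ b₂) (proj₂ K≡) (proj₂ L≡)))
          ; mid≡ = All.++⁺ (zip-all (2+1 b₁ b₂) (proj₂ P≡′) (proj₁ L≡)) (zip-all (1+2 b₁ b₂) (proj₁ K≡) (proj₂ Q≡′))
          ; high≡ = zip-all (2+2 b₁ b₂) (proj₁ P≡′) (proj₁ Q≡′)
          ; low-length = length-++₂ (zip R₁.low Qa) _ (zip-length R₁.low Qa R₁.low-length lQa)
              (length-++₂ (zip Pa R₂.low) _ (zip-length Pa R₂.low lPa R₂.low-length) (zip-length Kb Lb lKb lLb))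
          ; mid-length = length-++₂ (zip Pc La) _ (zip-length Pc La lPc lLa) (zip-length Ka Qc lKa lQc)
          ; high-length = zip-length Pb Qb lPb lQb } , trans (assoc₄ m₁ m₂ ee t) (cong (_+ ee) e₃)) }
        where
        low mid high : List (X × Y)
        low  = zip R₁.low Qa ++ (zip Pa R₂.low ++ zip Kb Lb)
        mid  = zip Pc La ++ zip Ka Qc
        high = zip Pb Qb
        zipped : Zipped (low ++ (mid ++ high)) _ _
        zipped = (block R₁.low Qa R₁.low-length lQa ∙ block Pa R₂.low lPa R₂.low-length ∙ block Kb Lb lKb lLb)
               ∙ ((block Pc La lPc lLa ∙ block Ka Qc lKa lQc) ∙ block Pb Qb lPb lQb)
        P≡ = All.++⁻ Pa (subst (All _) eP R₁.high≡)
        P≡′ = All.++⁻ Pb (proj₂ P≡)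
        Q≡ = All.++⁻ Qa (subst (All _) eQ R₂.high≡)
        Q≡′ = All.++⁻ Qb (proj₂ Q≡)
        K≡ = All.++⁻ Ka (subst (All _) eK R₁.mid≡)
        L≡ = All.++⁻ La (subst (All _) eL R₂.mid≡)

      combine-down : ∀ t → m₁ ≡ p₂ + (t + oe) → m₂ ≡ p₁ + (t + eo) → p₁ + (p₂ + t) ≡ oo →
                     Combined b₁ b₂ oo oe eo ee xs ys
      combine-down t e₁ e₂ e₃
        with splitAt p₂ (t + oe) R₁.low (trans R₁.low-length e₁) | splitAt p₁ (t + eo) R₂.low (trans R₂.low-length e₂)
           | splitAt eo ee R₁.mid (trans R₁.mid-length k₁≡) | splitAt oe ee R₂.mid (trans R₂.mid-length k₂≡)
      ... | Ma , M′ , eM , lMa , lM′ | Na , N′ , eN , lNa , lN′ | Ka , Kb , eK , lKa , lKb | La , Lb , eL , lLa , lLb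
        with splitAt t oe M′ lM′ | splitAt t eo N′ lN′
      ... | Mb , Mc , refl , lMb , lMc | Nb , Nc , refl , lNb , lNc = record
        { zs = low ++ mid ++ high
        ; left↭ = ↭-trans (↭-reflexive (proj₁ zipped)) (↭-trans
            (SX.solve 6 (λ p ma kb mc ka mb → (mb ⊕ˣ ((mc ⊕ˣ ka) ⊕ˣ (p ⊕ˣ (ma ⊕ˣ kb)))) ⊜ˣ
                ((ma ⊕ˣ (mb ⊕ˣ mc)) ⊕ˣ ((ka ⊕ˣ kb) ⊕ˣ p))) ↭-refl
              R₁.high Ma Kb Mc Ka Mb)
            (↭-trans (↭-reflexive (cong₂ (λ k m → m ++ k ++ R₁.high) (sym eK) (sym eM))) R₁.perm))
        ; right↭ = ↭-trans (↭-reflexive (proj₂ zipped)) (↭-trans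
            (SY.solve 6 (λ p na lb nc la nb → (nb ⊕ʸ ((la ⊕ʸ nc) ⊕ʸ (na ⊕ʸ (p ⊕ʸ lb)))) ⊜ʸ
                ((na ⊕ʸ (nb ⊕ʸ nc)) ⊕ʸ ((la ⊕ʸ lb) ⊕ʸ p))) ↭-refl
              R₂.high Na Lb Nc La Nb)
            (↭-trans (↭-reflexive (cong₂ (λ k m → m ++ k ++ R₂.high) (sym eL) (sym eN))) R₂.perm))
        ; base = b₁ + b₂
        ; l = t ; h = p₁ + (p₂ + ee)
        ; placement = inj₂ (refl , record
          { low = low ; mid = mid ; high = high ; perm = ↭-refl
          ; low≡ = zip-all refl (proj₁ M≡′) (proj₁ N≡′)
          ; mid≡ = All.++⁺ (zip-all (0+1 b₁ b₂) (proj₂ M≡′) (proj₁ L≡)) (zip-all (1+0 b₁ b₂) (proj₁ K≡) (proj₂ N≡′))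
          ; high≡ = All.++⁺ (zip-all (2+0 b₁ b₂) R₁.high≡ (proj₁ N≡))
                      (All.++⁺ (zip-all (0+2 b₁ b₂) (proj₁ M≡) R₂.high≡) (zip-all (1+1 b₁ b₂) (proj₂ K≡) (proj₂ L≡)))
          ; low-length = zip-length Mb Nb lMb lNb
          ; mid-length = length-++₂ (zip Mc La) _ (zip-length Mc La lMc lLa) (zip-length Ka Nc lKa lNc)
          ; high-length = length-++₂ (zip R₁.high Na) _ (zip-length R₁.high Na R₁.high-length lNa)
              (length-++₂ (zip Ma R₂.high) _ (zip-length Ma R₂.high lMa R₂.high-length) (zip-length Kb Lb lKb lLb))
          } , trans (ℕ.+-comm t _) (trans (assoc₄ p₁ p₂ ee t) (cong (_+ ee) e₃))) }
        where
        low mid high : List (X × Y)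
        low  = zip Mb Nb
        mid  = zip Mc La ++ zip Ka Nc
        high = zip R₁.high Na ++ (zip Ma R₂.high ++ zip Kb Lb)
        zipped : Zipped (low ++ (mid ++ high)) _ _
        zipped = block Mb Nb lMb lNb ∙ (block Mc La lMc lLa ∙ block Ka Nc lKa lNc)
               ∙ (block R₁.high Na R₁.high-length lNa ∙ block Ma R₂.high lMa R₂.high-length ∙ block Kb Lb lKb lLb)
        M≡ = All.++⁻ Ma (subst (All _) eM R₁.low≡)
        M≡′ = All.++⁻ Mb (proj₂ M≡)
        N≡ = All.++⁻ Na (subst (All _) eN R₂.low≡)
        N≡′ = All.++⁻ Nb (proj₂ N≡)
        K≡ = All.++⁻ Ka (subst (All _) eK R₁.mid≡)
        L≡ = All.++⁻ La (subst (All _) eL R₂.mid≡)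

      combine-balanced : ∀ u v m₁′ p₁′ m₂′ p₂′ → p₁ ≡ u + p₁′ → m₁ ≡ v + m₁′ → p₂ ≡ v + p₂′ → m₂ ≡ u + m₂′ →
                         u + v ≡ oo → m₁′ + p₁′ ≡ oe → m₂′ + p₂′ ≡ eo → Combined b₁ b₂ oo oe eo ee xs ys
      combine-balanced u v m₁′ p₁′ m₂′ p₂′ e₁ e₂ e₃ e₄ e₅ e₆ e₇
        with splitAt u p₁′ R₁.high (trans R₁.high-length e₁) | splitAt v m₁′ R₁.low (trans R₁.low-length e₂)
           | splitAt v p₂′ R₂.high (trans R₂.high-length e₃) | splitAt u m₂′ R₂.low (trans R₂.low-length e₄)
           | splitAt m₂′ (p₂′ + ee) R₁.mid (trans R₁.mid-length
               (trans k₁≡ (trans (cong (_+ ee) (sym e₇)) (ℕ.+-assoc m₂′ p₂′ ee))))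
           | splitAt m₁′ (p₁′ + ee) R₂.mid (trans R₂.mid-length
               (trans k₂≡ (trans (cong (_+ ee) (sym e₆)) (ℕ.+-assoc m₁′ p₁′ ee))))
      ... | Pa , Pb , eP , lPa , lPb | Ma , Mb , eM , lMa , lMb | Qa , Qb , eQ , lQa , lQb | Na , Nb , eN , lNa , lNb
          | Ka , K′ , eK , lKa , lK′ | La , L′ , eL , lLa , lL′
        with splitAt p₂′ ee K′ lK′ | splitAt p₁′ ee L′ lL′
      ... | Kb , Kc , refl , lKb , lKc | Lb , Lc , refl , lLb , lLc = record
        { zs = low ++ mid ++ high
        ; left↭ = ↭-trans (↭-reflexive (proj₁ zipped)) (↭-trans
            (SX.solve 7 (λ ma mb ka kb kc pa pb → ((mb ⊕ˣ ka) ⊕ˣ (((pa ⊕ˣ ma) ⊕ˣ kc) ⊕ˣ (pb ⊕ˣ kb))) ⊜ˣ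
                ((ma ⊕ˣ mb) ⊕ˣ ((ka ⊕ˣ (kb ⊕ˣ kc)) ⊕ˣ (pa ⊕ˣ pb)))) ↭-refl
              Ma Mb Ka Kb Kc Pa Pb)
            (↭-trans (↭-reflexive (cong₂ _++_ (sym eM) (cong₂ _++_ (sym eK) (sym eP)))) R₁.perm))
        ; right↭ = ↭-trans (↭-reflexive (proj₂ zipped)) (↭-trans
            (SY.solve 7 (λ na nb la lb lc qa qb → ((la ⊕ʸ nb) ⊕ʸ (((na ⊕ʸ qa) ⊕ʸ lc) ⊕ʸ (lb ⊕ʸ qb))) ⊜ʸ
                ((na ⊕ʸ nb) ⊕ʸ ((la ⊕ʸ (lb ⊕ʸ lc)) ⊕ʸ (qa ⊕ʸ qb)))) ↭-refl
              Na Nb La Lb Lc Qa Qb)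
            (↭-trans (↭-reflexive (cong₂ _++_ (sym eN) (cong₂ _++_ (sym eL) (sym eQ)))) R₂.perm))
        ; base = 1 + (b₁ + b₂)
        ; l = m₁′ + m₂′ ; h = p₁′ + p₂′
        ; placement = inj₁ (refl , record
          { low = low ; mid = mid ; high = high ; perm = ↭-refl
          ; low≡ = All.++⁺ (zip-all (0+1 b₁ b₂) (proj₂ M≡) (proj₁ L≡)) (zip-all (1+0 b₁ b₂) (proj₁ K≡) (proj₂ N≡))
          ; mid≡ = All.++⁺ (All.++⁺ (zip-all (2+0 b₁ b₂) (proj₁ P≡) (proj₁ N≡))
              (zip-all (0+2 b₁ b₂) (proj₁ M≡) (proj₁ Q≡)))
                     (zip-all (1+1 b₁ b₂) (proj₂ K≡′) (proj₂ L≡′))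
          ; high≡ = All.++⁺ (zip-all (2+1 b₁ b₂) (proj₂ P≡) (proj₁ L≡′)) (zip-all (1+2 b₁ b₂) (proj₁ K≡′) (proj₂ Q≡))
          ; low-length = length-++₂ (zip Mb La) _ (zip-length Mb La lMb lLa) (zip-length Ka Nb lKa lNb)
          ; mid-length = trans (length-++₂ (zip Pa Na ++ zip Ma Qa) _
              (length-++₂ (zip Pa Na) _ (zip-length Pa Na lPa lNa) (zip-length Ma Qa lMa lQa))
                  (zip-length Kc Lc lKc lLc)) (cong (_+ ee) e₅)
          ; high-length = length-++₂ (zip Pb Lb) _ (zip-length Pb Lb lPb lLb) (zip-length Kb Qb lKb lQb)
          } , trans (interchange m₁′ m₂′ p₁′ p₂′) (cong₂ _+_ e₆ e₇)) }
        where
        interchange : ∀ a b c d → (a + b) + (c + d) ≡ (a + c) + (b + d)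
        interchange = solve-∀
        low mid high : List (X × Y)
        low  = zip Mb La ++ zip Ka Nb
        mid  = (zip Pa Na ++ zip Ma Qa) ++ zip Kc Lc
        high = zip Pb Lb ++ zip Kb Qb
        zipped : Zipped (low ++ (mid ++ high)) _ _
        zipped = (block Mb La lMb lLa ∙ block Ka Nb lKa lNb)
               ∙ ((block Pa Na lPa lNa ∙ block Ma Qa lMa lQa) ∙ block Kc Lc lKc lLc)
               ∙ (block Pb Lb lPb lLb ∙ block Kb Qb lKb lQb)
        P≡ = All.++⁻ Pa (subst (All _) eP R₁.high≡)
        M≡ = All.++⁻ Ma (subst (All _) eM R₁.low≡)
        Q≡ = All.++⁻ Qa (subst (All _) eQ R₂.high≡)
        N≡ = All.++⁻ Na (subst (All _) eN R₂.low≡)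
        K≡ = All.++⁻ Ka (subst (All _) eK R₁.mid≡)
        K≡′ = All.++⁻ Kb (proj₂ K≡)
        L≡ = All.++⁻ La (subst (All _) eL R₂.mid≡)
        L≡′ = All.++⁻ Lb (proj₂ L≡)

      combine : Plan m₁ k₁ p₁ m₂ k₂ p₂ oo oe eo ee → Combined b₁ b₂ oo oe eo ee xs ys
      combine (balanced u v m₁′ p₁′ m₂′ p₂′ e₁ e₂ e₃ e₄ e₅ e₆ e₇) = combine-balanced u v m₁′ p₁′ m₂′ p₂′ e₁
          e₂ e₃ e₄ e₅ e₆ e₇
      combine (up t e₁ e₂ e₃)   = combine-up t e₁ e₂ e₃
      combine (down t e₁ e₂ e₃) = combine-down t e₁ e₂ e₃

  record Window (c : X → ℕ) (O E : ℕ) (xs : List X) : Set where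
    field
      base l m h : ℕ
      rows       : Rows c base l m h xs
      parities   : (odd base ≡ true × l + h ≡ O × m ≡ E) ⊎ (odd base ≡ false × m ≡ O × l + h ≡ E)

  -- The parameters count the pairs by the parities of their two components, so
  -- that a sum is odd for Oe + Eo of them.
  combine-windows : ∀ {c₁ : X → ℕ} {c₂ : Y → ℕ} {xs ys} Oo Oe Eo Ee →
    Window c₁ (Oo + Oe) (Eo + Ee) xs → Window c₂ (Oo + Eo) (Oe + Ee) ys →
    ∃ λ zs → map proj₁ zs ↭ xs × map proj₂ zs ↭ ys × Window (c₁ ⊞ c₂) (Oe + Eo) (Oo + Ee) zs
  combine-windows {c₁ = c₁} {c₂} {xs} {ys} Oo Oe Eo Ee w₁ w₂ = cases W₁.parities W₂.parities
    where
    module W₁ = Window w₁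
    module W₂ = Window w₂
    Result : Set
    Result = ∃ λ zs → map proj₁ zs ↭ xs × map proj₂ zs ↭ ys × Window (c₁ ⊞ c₂) (Oe + Eo) (Oo + Ee) zs

    combined : ∀ oo oe eo ee → W₁.l + W₁.h ≡ oo + oe → W₂.l + W₂.h ≡ oo + eo → W₁.m ≡ eo + ee → W₂.m ≡ oe + ee →
               Combined c₁ c₂ W₁.base W₂.base oo oe eo ee xs ys
    combined oo oe eo ee f₁ f₂ k₁ k₂ = combine c₁ c₂ W₁.rows W₂.rows k₁ k₂ (plan f₁ f₂)

    odd-base : ∀ {o₁ o₂} → odd W₁.base ≡ o₁ → odd W₂.base ≡ o₂ → odd (W₁.base + W₂.base) ≡ o₁ xor o₂
    odd-base p q = trans (odd-+ W₁.base W₂.base) (cong₂ _xor_ p q)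

    same : ∀ {oo oe eo ee} → odd (W₁.base + W₂.base) ≡ false → oe + eo ≡ Oe + Eo → oo + ee ≡ Oo + Ee →
           Combined c₁ c₂ W₁.base W₂.base oo oe eo ee xs ys → Result
    same b O E c = zs , left↭ , right↭ , window placement
      where
      open Combined c
      window : _ → Window (c₁ ⊞ c₂) (Oe + Eo) (Oo + Ee) zs
      window (inj₁ (b′ , r , lh)) = record { rows = r ; parities = inj₁ (trans b′ (cong not b) , trans lh O , E) }
      window (inj₂ (b′ , r , lh)) = record { rows = r ; parities = inj₂ (trans b′ b , O , trans lh E) }

    different : ∀ {oo oe eo ee} → odd (W₁.base + W₂.base) ≡ true → oe + eo ≡ Oo + Ee → oo + ee ≡ Oe + Eo →
                Combined c₁ c₂ W₁.base W₂.base oo oe eo ee xs ys → Result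
    different b E O c = zs , left↭ , right↭ , window placement
      where
      open Combined c
      window : _ → Window (c₁ ⊞ c₂) (Oe + Eo) (Oo + Ee) zs
      window (inj₁ (b′ , r , lh)) = record { rows = r ; parities = inj₂ (trans b′ (cong not b) , O , trans lh E) }
      window (inj₂ (b′ , r , lh)) = record { rows = r ; parities = inj₁ (trans b′ b , trans lh O , E) }

    -- Off-centre means odd for an odd base and even for an even one. So the four numbers of pairs,
    -- classified by parity, become the numbers classified by position after a permutation that
    -- depends on the two bases.
    cases : _ → _ → Result
    cases (inj₁ (b₁ , f₁ , k₁)) (inj₁ (b₂ , f₂ , k₂)) = same (odd-base b₁ b₂) refl refl
        (combined Oo Oe Eo Ee f₁ f₂ k₁ k₂)
    cases (inj₁ (b₁ , f₁ , k₁)) (inj₂ (b₂ , k₂ , f₂)) = different (odd-base b₁ b₂) refl refl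
      (combined Oe Oo Ee Eo (trans f₁ (ℕ.+-comm Oo Oe)) f₂ (trans k₁ (ℕ.+-comm Eo Ee)) k₂)
    cases (inj₂ (b₁ , k₁ , f₁)) (inj₁ (b₂ , f₂ , k₂)) = different (odd-base b₁ b₂) (ℕ.+-comm Ee Oo) (ℕ.+-comm Eo Oe)
      (combined Eo Ee Oo Oe f₁ (trans f₂ (ℕ.+-comm Oo Eo)) k₁ (trans k₂ (ℕ.+-comm Oe Ee)))
    cases (inj₂ (b₁ , k₁ , f₁)) (inj₂ (b₂ , k₂ , f₂)) = same (odd-base b₁ b₂) (ℕ.+-comm Eo Oe) (ℕ.+-comm Ee Oo)
      (combined Ee Eo Oe Oo (trans f₁ (ℕ.+-comm Eo Ee)) (trans f₂ (ℕ.+-comm Oe Ee))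
          (trans k₁ (ℕ.+-comm Oo Oe)) (trans k₂ (ℕ.+-comm Oo Eo)))

  -- Numbers of odd rows at the edges of the tree

  -- The conditions under which 2 a, 2 b, 2 c out of n rows can be the rows in
  -- which a first count, a second count and their sum are odd.
  record Triple (n a b c : ℕ) : Set where
    constructor triple
    field
      a≤ : a ≤ b + c
      b≤ : b ≤ a + c
      c≤ : c ≤ a + b
      Σ≤ : a + b + c ≤ n

  record Split (n a b c : ℕ) : Set where
    field
      Oo Oe Eo Ee : ℕ
      first  : Oo + Oe ≡ 2 * a
      second : Oo + Eo ≡ 2 * b
      sum    : Oe + Eo ≡ 2 * c
      all    : Oo + Oe + (Eo + Ee) ≡ n

  -- The linear system has a unique solution, and its unknowns are the slacks of the four
  -- inequalities: `Oo` is a + b - c, `Oe` is a + c - b, `Eo` is b + c - a, and `Ee` is n - (a + b +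
  -- c).
  split-triple : ∀ {n a b c} → Triple n a b c → Split n a b c
  split-triple {n} {a} {b} {c} (triple a≤ b≤ c≤ Σ≤) with ≤⇒∃+ a≤ | ≤⇒∃+ b≤ | ≤⇒∃+ c≤ | ≤⇒∃+ Σ≤
  ... | Eo , e₁ | Oe , e₂ | Oo , e₃ | Ee , e₄ = record
    { Oo = Oo ; Oe = Oe ; Eo = Eo ; Ee = Ee
    ; first = first
    ; second = ℕ.+-cancelˡ-≡ (a + c) _ _ (trans (r₂ a c Oo Eo) (trans (sym (cong₂ _+_ e₃ e₁)) (s₂ a b c)))
    ; sum = ℕ.+-cancelˡ-≡ (a + b) _ _ (trans (r₃ a b Oe Eo) (trans (sym (cong₂ _+_ e₂ e₁)) (s₃ a b c)))
    ; all = trans (cong (_+ (Eo + Ee)) first) (trans (r₄ a Eo Ee)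
        (trans (cong (λ x → a + x + Ee) (sym e₁)) (trans (cong (_+ Ee) (sym (ℕ.+-assoc a b c))) (sym e₄)))) }
    where
    r₁ : ∀ b c x y → (b + c) + (x + y) ≡ (c + x) + (b + y)
    r₁ = solve-∀
    s₁ : ∀ a b c → (a + b) + (a + c) ≡ (b + c) + 2 * a
    s₁ = solve-∀
    r₂ : ∀ a c x y → (a + c) + (x + y) ≡ (c + x) + (a + y)
    r₂ = solve-∀
    s₂ : ∀ a b c → (a + b) + (b + c) ≡ (a + c) + 2 * b
    s₂ = solve-∀
    r₃ : ∀ a b x y → (a + b) + (x + y) ≡ (b + x) + (a + y)
    r₃ = solve-∀
    s₃ : ∀ a b c → (a + c) + (b + c) ≡ (a + b) + 2 * c
    s₃ = solve-∀
    r₄ : ∀ a x y → 2 * a + (x + y) ≡ a + (a + x) + y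
    r₄ = solve-∀
    first : Oo + Oe ≡ 2 * a
    first = ℕ.+-cancelˡ-≡ (b + c) _ _ (trans (r₁ b c Oo Oe) (trans (sym (cong₂ _+_ e₃ e₂)) (s₁ a b c)))

  data HalfView : ℕ → Set where
    isDouble : ∀ i → HalfView (i + i)
    isSucDouble : ∀ i → HalfView (suc (i + i))

  halfView : ∀ n → HalfView n
  halfView zero = isDouble 0
  halfView (suc n) with halfView n
  ... | isDouble i = isSucDouble i
  ... | isSucDouble i = subst HalfView (cong suc (ℕ.+-suc i i)) (isDouble (suc i))

  odd-double′ : ∀ i → odd (i + i) ≡ false
  odd-double′ i = trans (odd-+ i i) (≡-xor {odd i} refl)

  double-cancel-≤ : ∀ {i j} → i + i ≤ j + j → i ≤ j
  double-cancel-≤ {i} {j} h = ℕ.≮⇒≥ λ j<i → ℕ.<⇒≱ (ℕ.+-mono-< j<i j<i) h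

  double-cancel-≤-suc : ∀ {i j} → i + i ≤ suc (j + j) → i ≤ j
  double-cancel-≤-suc {i} {j} h = ℕ.≮⇒≥ λ j<i → ℕ.<⇒≱ (s≤s (ℕ.≤-reflexive (sym (ℕ.+-suc j j))))
      (ℕ.≤-trans (ℕ.+-mono-≤ j<i j<i) h)

  -- 2 * φ n s is the number of odd counts on a subtree with s of the n leaves
  -- among the n complements of single leaves (n odd) or among n copies of the
  -- full leaf set (n even).
  φ : ℕ → ℕ → ℕ
  φ n s = if odd n then (if odd s then ⌊ n /2⌋ ∸ ⌊ s /2⌋ else ⌊ s /2⌋) else (if odd s then ⌊ n /2⌋ else 0)

  half-double : ∀ i → ⌊ i + i /2⌋ ≡ i
  half-double i = sym (ℕ.n≡⌊n+n/2⌋ i)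

  half-suc-double : ∀ i → ⌊ suc (i + i) /2⌋ ≡ i
  half-suc-double i = sym (ℕ.n≡⌈n+n/2⌉ i)

  φ-odd-even : ∀ N i → φ (suc (N + N)) (i + i) ≡ i
  φ-odd-even N i rewrite odd-double′ N | odd-double′ i = half-double i

  φ-odd-odd : ∀ N i → φ (suc (N + N)) (suc (i + i)) ≡ N ∸ i
  φ-odd-odd N i rewrite odd-double′ N | odd-double′ i = cong₂ _∸_ (half-suc-double N) (half-suc-double i)

  φ-even-even : ∀ N i → φ (N + N) (i + i) ≡ 0
  φ-even-even N i rewrite odd-double′ N | odd-double′ i = refl

  φ-even-odd : ∀ N i → φ (N + N) (suc (i + i)) ≡ N
  φ-even-odd N i rewrite odd-double′ N | odd-double′ i = half-double N

  double-+ : ∀ i j → (i + i) + (j + j) ≡ (i + j) + (i + j)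
  double-+ = solve-∀

  suc-double-+ : ∀ i j → suc (i + i) + suc (j + j) ≡ suc (i + j) + suc (i + j)
  suc-double-+ = solve-∀

  drop-first : ∀ i j e → (i + j + e) ∸ i ≡ j + e
  drop-first i j e = trans (cong (_∸ i) (ℕ.+-assoc i j e)) (ℕ.m+n∸m≡n i (j + e))

  drop-second : ∀ i j e → (i + j + e) ∸ j ≡ i + e
  drop-second i j e = trans (cong (_∸ j) (rearrange i j e)) (ℕ.m+n∸n≡m (i + e) j)
    where
    rearrange : ∀ i j e → i + j + e ≡ (i + e) + j
    rearrange = solve-∀

  drop-first-suc : ∀ i j e → (suc (i + j) + e) ∸ i ≡ suc (j + e)
  drop-first-suc i j e = trans (cong (_∸ i) (rearrange i j e)) (ℕ.m+n∸m≡n i (suc (j + e)))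
    where
    rearrange : ∀ i j e → suc (i + j) + e ≡ i + suc (j + e)
    rearrange = solve-∀

  drop-second-suc : ∀ i j e → (suc (i + j) + e) ∸ j ≡ suc (i + e)
  drop-second-suc i j e = trans (cong (_∸ j) (rearrange i j e)) (ℕ.m+n∸m≡n j (suc (i + e)))
    where
    rearrange : ∀ i j e → suc (i + j) + e ≡ j + suc (i + e)
    rearrange = solve-∀

  -- In each of the rows that `φ` counts, none or exactly two of the counts on the two parts and on
  -- their union are odd; this explains all four inequalities. The proof verifies them on closed
  -- forms, by the parities of `n`, `s` and `t`.
  φ-triple : ∀ n s t → s + t ≤ n → Triple n (φ n s) (φ n t) (φ n (s + t))
  φ-triple n s t le with halfView n | halfView s | halfView t
  ... | isDouble N | isDouble i | isDouble j rewrite φ-even-even N i | φ-even-even N j | double-+ i j |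
      φ-even-even N (i + j) = triple z≤n z≤n z≤n z≤n
  ... | isDouble N | isDouble i | isSucDouble j rewrite φ-even-even N i | φ-even-odd N j | ℕ.+-suc (i + i)
      (j + j) | double-+ i j | φ-even-odd N (i + j) =
    triple z≤n ℕ.≤-refl ℕ.≤-refl ℕ.≤-refl
  ... | isDouble N | isSucDouble i | isDouble j rewrite φ-even-even N j | φ-even-odd N i | double-+ i j |
      φ-even-odd N (i + j) =
    triple ℕ.≤-refl z≤n (ℕ.m≤m+n N 0) (ℕ.≤-reflexive (cong (_+ N) (ℕ.+-identityʳ N)))
  ... | isDouble N | isSucDouble i | isSucDouble j rewrite φ-even-odd N j | φ-even-odd N i | trans
      (cong (φ (N + N)) (suc-double-+ i j)) (φ-even-even N (suc (i + j))) =
    triple (ℕ.m≤m+n N 0) (ℕ.m≤m+n N 0) z≤n (ℕ.≤-reflexive (ℕ.+-identityʳ (N + N)))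
  ... | isSucDouble N | isDouble i | isDouble j rewrite φ-odd-even N i | φ-odd-even N j | double-+ i j |
      φ-odd-even N (i + j) =
    triple (ℕ.≤-trans (ℕ.m≤m+n i j) (ℕ.m≤n+m (i + j) j)) (ℕ.≤-trans (ℕ.m≤n+m j i) (ℕ.m≤n+m (i + j) i)) ℕ.≤-refl le
  ... | isSucDouble N | isDouble i | isSucDouble j rewrite φ-odd-even N i | φ-odd-odd N j | ℕ.+-suc (i + i)
      (j + j) | double-+ i j | φ-odd-odd N (i + j)
    with ≤⇒∃+ (double-cancel-≤ {i + j} {N} (ℕ.≤-pred le))
  ... | e , refl rewrite ℕ.m+n∸m≡n (i + j) e | drop-second i j e = triple
      (ℕ.≤-trans (ℕ.m≤m+n i e) (ℕ.m≤m+n (i + e) e)) ℕ.≤-refl (ℕ.≤-trans (ℕ.m≤n+m e i) (ℕ.m≤n+m (i + e) i))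
      (bound i j e)
    where
    bound : ∀ i j e → i + (i + e) + e ≤ suc (i + j + e + (i + j + e))
    bound i j e = ℕ.≤-trans (ℕ.m≤m+n _ (suc (j + j))) (ℕ.≤-reflexive (rearrange i j e))
      where
      rearrange : ∀ i j e → i + (i + e) + e + suc (j + j) ≡ suc (i + j + e + (i + j + e))
      rearrange = solve-∀
  φ-triple n s t le | isSucDouble N | isSucDouble i | isDouble j rewrite φ-odd-even N j | φ-odd-odd N i |
      double-+ i j | φ-odd-odd N (i + j)
    with ≤⇒∃+ (double-cancel-≤ {i + j} {N} (ℕ.≤-pred le))
  ... | e , refl rewrite ℕ.m+n∸m≡n (i + j) e | drop-first i j e = triple ℕ.≤-refl
      (ℕ.≤-trans (ℕ.m≤m+n j e) (ℕ.m≤m+n (j + e) e)) (ℕ.≤-trans (ℕ.m≤n+m e j) (ℕ.m≤m+n (j + e) j))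
      (bound i j e)
    where
    bound : ∀ i j e → (j + e) + j + e ≤ suc (i + j + e + (i + j + e))
    bound i j e = ℕ.≤-trans (ℕ.m≤m+n _ (suc (i + i))) (ℕ.≤-reflexive (rearrange i j e))
      where
      rearrange : ∀ i j e → (j + e) + j + e + suc (i + i) ≡ suc (i + j + e + (i + j + e))
      rearrange = solve-∀
  φ-triple n s t le | isSucDouble N | isSucDouble i | isSucDouble j rewrite φ-odd-odd N j | φ-odd-odd N i |
      trans (cong (φ (suc (N + N))) (suc-double-+ i j)) (φ-odd-even N (suc (i + j)))
    with ≤⇒∃+ (double-cancel-≤-suc {suc (i + j)} {N} (subst (_≤ suc (N + N)) (suc-double-+ i j) le))
  ...   | e , refl rewrite drop-first-suc i j e | drop-second-suc i j e = triple
      (ℕ.≤-trans (ℕ.m≤m+n (suc (j + e)) _) (ℕ.≤-reflexive (t₁ i j e)))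
      (ℕ.≤-trans (ℕ.m≤m+n (suc (i + e)) _) (ℕ.≤-reflexive (t₂ i j e)))
      (ℕ.≤-trans (ℕ.m≤m+n (suc (i + j)) (suc (e + e))) (ℕ.≤-reflexive (t₃ i j e)))
      (ℕ.≤-reflexive (t₄ i j e))
    where
    t₁ : ∀ i j e → suc (j + e) + suc (i + i) ≡ suc (i + e) + suc (i + j)
    t₁ = solve-∀
    t₂ : ∀ i j e → suc (i + e) + suc (j + j) ≡ suc (j + e) + suc (i + j)
    t₂ = solve-∀
    t₃ : ∀ i j e → suc (i + j) + suc (e + e) ≡ suc (j + e) + suc (i + e)
    t₃ = solve-∀
    t₄ : ∀ i j e → suc (j + e) + suc (i + e) + suc (i + j) ≡ suc (suc (i + j) + e + (suc (i + j) + e))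
    t₄ = solve-∀

  -- The rows behind `φ` have an even total, n - 1 or n, so complementary parts have equal parities
  -- in each of them.
  φ-complement : ∀ n s t → s + t ≡ n → φ n s ≡ φ n t
  φ-complement _ s t refl with halfView s | halfView t
  ... | isDouble i | isDouble j rewrite double-+ i j | φ-even-even (i + j) i | φ-even-even (i + j) j = refl
  ... | isDouble i | isSucDouble j rewrite ℕ.+-suc (i + i) (j + j) | double-+ i j | φ-odd-even (i + j) i |
      φ-odd-odd (i + j) j = sym (ℕ.m+n∸n≡m i j)
  ... | isSucDouble i | isDouble j rewrite double-+ i j | φ-odd-even (i + j) j | φ-odd-odd (i + j) i = ℕ.m+n∸m≡n i j
  ... | isSucDouble i | isSucDouble j rewrite trans (cong (λ n → φ n (suc (i + i))) (suc-double-+ i j))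
      (φ-even-odd (suc (i + j)) i)
                              | trans (cong (λ n → φ n (suc (j + j))) (suc-double-+ i j))
                                  (φ-even-odd (suc (i + j)) j) = refl

  -- `φ n 1` is n/2 rounded down. So clipping at `k` gives every leaf edge the value `k` exactly.
  ≤φ-1 : ∀ {n k} → k + k ≤ n → k ≤ φ n 1
  ≤φ-1 {n} {k} le with halfView n
  ... | isDouble N rewrite φ-even-odd N 0 = double-cancel-≤ le
  ... | isSucDouble N rewrite φ-odd-odd N 0 = double-cancel-≤-suc le

  ⊓-subadditive : ∀ k a b c → a ≤ b + c → k ⊓ a ≤ (k ⊓ b) + (k ⊓ c)
  ⊓-subadditive k a b c le with ℕ.≤-total k b | ℕ.≤-total k c
  ... | inj₁ k≤b | _ rewrite ℕ.m≤n⇒m⊓n≡m k≤b = ℕ.≤-trans (ℕ.m⊓n≤m k a) (ℕ.m≤m+n k _)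
  ... | inj₂ _   | inj₁ k≤c rewrite ℕ.m≤n⇒m⊓n≡m k≤c = ℕ.≤-trans (ℕ.m⊓n≤m k a) (ℕ.m≤n+m k _)
  ... | inj₂ b≤k | inj₂ c≤k rewrite ℕ.m≥n⇒m⊓n≡n b≤k | ℕ.m≥n⇒m⊓n≡n c≤k = ℕ.≤-trans (ℕ.m⊓n≤n k a) le

  -- The upper end `k` is the value required at the leaves, the lower end `l` becomes the guarantee.
  -- The hypothesis `lkk` is the sum condition for one value `l` and two values `k`.
  module Clip {n l k : ℕ} (l≤k : l ≤ k) (lkk : l + k + k ≤ n) where

    clip : ℕ → ℕ
    clip a = l ⊔ (k ⊓ a)

    l≤clip : ∀ a → l ≤ clip a
    l≤clip a = ℕ.m≤m⊔n l _

    clip≤k : ∀ a → clip a ≤ k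
    clip≤k a = ℕ.⊔-lub l≤k (ℕ.m⊓n≤m k a)

    clip-≤ : ∀ {a b c} → a ≤ b + c → clip a ≤ clip b + clip c
    clip-≤ {a} {b} {c} le = ℕ.⊔-lub (ℕ.≤-trans (l≤clip b) (ℕ.m≤m+n (clip b) _))
      (ℕ.≤-trans (⊓-subadditive k a b c le) (ℕ.+-mono-≤ (ℕ.m≤n⊔m l _) (ℕ.m≤n⊔m l _)))

    clip-cases : ∀ a → clip a ≤ l ⊎ clip a ≤ a
    clip-cases a with ℕ.≤-total (k ⊓ a) l
    ... | inj₁ le = inj₁ (ℕ.⊔-lub ℕ.≤-refl le)
    ... | inj₂ ge = inj₂ (ℕ.⊔-lub (ℕ.≤-trans ge (ℕ.m⊓n≤n k a)) (ℕ.m⊓n≤n k a))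

    -- For the sum condition, a clipped value exceeds the old one only if it equals `l`. So either
    -- the old sum is an upper bound, or one value is at most `l` and the others are at most `k`.
    clip-triple : ∀ {a b c} → Triple n a b c → Triple n (clip a) (clip b) (clip c)
    clip-triple {a} {b} {c} (triple a≤ b≤ c≤ Σ≤) = triple (clip-≤ a≤) (clip-≤ b≤) (clip-≤ c≤) sum≤
      where
      sum≤ : clip a + clip b + clip c ≤ n
      sum≤ with clip-cases a | clip-cases b | clip-cases c
      ... | inj₁ p | _ | _ = ℕ.≤-trans (ℕ.+-mono-≤ (ℕ.+-mono-≤ p (clip≤k b)) (clip≤k c)) lkk
      ... | _ | inj₁ q | _ = ℕ.≤-trans (ℕ.+-mono-≤ (ℕ.+-mono-≤ (clip≤k a) q) (clip≤k c))
          (ℕ.≤-trans (ℕ.≤-reflexive (cong (_+ k) (ℕ.+-comm k l))) lkk)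
      ... | _ | _ | inj₁ r = ℕ.≤-trans (ℕ.+-mono-≤ (ℕ.+-mono-≤ (clip≤k a) (clip≤k b)) r)
          (ℕ.≤-trans (ℕ.≤-reflexive (trans (ℕ.+-comm (k + k) l) (sym (ℕ.+-assoc l k k)))) lkk)
      ... | inj₂ p | inj₂ q | inj₂ r = ℕ.≤-trans (ℕ.+-mono-≤ (ℕ.+-mono-≤ p q) r) Σ≤

    clip-k : ∀ {a} → k ≤ a → clip a ≡ k
    clip-k {a} k≤a = trans (cong (l ⊔_) (ℕ.m≤n⇒m⊓n≡m k≤a)) (ℕ.m≤n⇒m⊔n≡n l≤k)

open import Defs
open Discrete
open import Algebra.Bundles using (CommutativeMonoid)
import Algebra.Properties.CommutativeSemigroup as CS
open import Data.Bool using (Bool; _xor_; _∧_; false; if_then_else_; not; true)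
open import Data.Bool.Properties using (xor-same)
import Data.Bool.Properties as Bool
open import Data.Empty using (⊥-elim)
import Data.Empty as Empty
open import Data.Fin using (Fin)
import Data.Fin as Fin
import Data.Fin.Properties as Fin
open import Data.Fin.Subset using (Empty; Nonempty; Subset; _∈_; _∉_; _∩_; _∪_; _⊂_; _⊆_; _─_; inside; outside; ⁅_⁆; ∣_∣; ⊤; ⊥)
open import Data.Fin.Subset.Properties
open import Data.Integer using (-[1+_])
import Data.Integer as ℤ
import Data.Integer.Properties as ℤ
open import Data.List using (List; []; _++_; _∷_; allFin; cartesianProduct; filter; foldr; length; map; replicate; tabulate)
import Data.List.Membership.DecPropositional as DecMembership
open import Data.List.Membership.Propositional using () renaming (_∈_ to _∈ˡ_; _∉_ to _∉ˡ_)
open import Data.List.Membership.Propositional.Properties using (∈-++⁺ʳ; ∈-++⁺ˡ; ∈-++⁻; ∈-allFin; ∈-cartesianProduct⁺; ∈-cartesianProduct⁻; ∈-filter⁺; ∈-filter⁻; ∈-map⁺; ∈-map⁻)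
open import Data.List.Membership.Propositional.Properties.WithK using (unique∧set⇒bag)
open import Data.List.Properties using (++-assoc; ++-identityʳ; filter-++; filter-accept; filter-reject; length-++; length-replicate; map-tabulate)
open import Data.List.Relation.Binary.BagAndSetEquality using (∼bag⇒↭)
open import Data.List.Relation.Binary.Permutation.Propositional using (_↭_; ↭-refl; ↭-reflexive; ↭-sym; ↭-trans)
import Data.List.Relation.Binary.Permutation.Propositional as Perm
import Data.List.Relation.Binary.Permutation.Propositional.Properties as Perm
import Data.List.Relation.Binary.Permutation.Setoid.Properties as PermS
open import Data.List.Relation.Binary.Pointwise using (Pointwise; []; _∷_)
open import Data.List.Relation.Unary.All using (All; []; _∷_)
import Data.List.Relation.Unary.All as All
import Data.List.Relation.Unary.All.Properties as All
open import Data.List.Relation.Unary.AllPairs using ([]; _∷_)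
open import Data.List.Relation.Unary.Any using (here; there)
import Data.List.Relation.Unary.Any as Any
open import Data.List.Relation.Unary.Unique.Propositional using (Unique)
import Data.List.Relation.Unary.Unique.Propositional.Properties as Unique
open import Data.Nat using (NonZero; suc; s≤s; zero; z≤n; ℕ) renaming (_<_ to _<ℕ_; _≤_ to _≤ℕ_)
import Data.Nat as ℕ
open import Data.Nat.Divisibility using (_∣?_; _∣_; divides)
import Data.Nat.Properties as ℕ
open import Data.Nat.Tactic.RingSolver using (solve-∀)
open import Data.Product using (_,_; _×_; proj₁; proj₂; ∃)
import Data.Product.Properties as Prod
open import Data.Rational using (-_; 0ℚ; 1ℚ; _*_; _+_; _/_; _<_; _≤_; _⊓_; _⊔_; mkℚ; toℚᵘ; ℚ; ↧ₙ_) renaming (_-_ to _-ℚ_)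
import Data.Rational as ℚ
import Data.Rational.Properties as ℚ
open import Data.Rational.Unnormalised using (*≡*; *≤*; mkℚᵘ) renaming (_≃_ to _≃ᵘ_)
import Data.Rational.Unnormalised as ℚᵘ
import Data.Rational.Unnormalised.Properties as ℚᵘ
open import Data.Sum using (_⊎_; inj₁; inj₂)
open import Data.Vec using ([]; _∷_; here; there)
import Data.Vec as Vec
import Data.Vec.Properties as Vec
open import Function using (Equivalence; _⇔_; _∘_; id; mk⇔)
open import Function.Metric.Rational using (DistanceFunction; IsMetric)
open import Relation.Binary.Definitions using (DecidableEquality)
open import Relation.Binary.PropositionalEquality
open import Relation.Nullary using (Dec; does; no; yes; ¬_)
open import Relation.Nullary.Decidable using (_×-dec_; _⊎-dec_; dec-false; dec-true; decidable-stable; ¬?)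
open import Relation.Unary using (Decidable)

private
  variable
    n : ℕ
    A B X Y : Set

-- Sums and extrema

module +-CS = CS (CommutativeMonoid.commutativeSemigroup ℚ.+-0-commutativeMonoid)

unique-↭ : {xs ys : List A} → Unique xs → Unique ys → (∀ x → x ∈ˡ xs ⇔ x ∈ˡ ys) → xs ↭ ys
unique-↭ u v e = ∼bag⇒↭ (unique∧set⇒bag u v (λ {x} → e x))

∑-++ : ∀ (xs ys : List A) f → ∑ (xs ++ ys) f ≡ ∑ xs f + ∑ ys f
∑-++ []       ys f = sym (ℚ.+-identityˡ _)
∑-++ (x ∷ xs) ys f = trans (cong (f x +_) (∑-++ xs ys f)) (sym (ℚ.+-assoc (f x) _ _))

∑-↭ : ∀ {xs ys : List A} f → xs ↭ ys → ∑ xs f ≡ ∑ ys f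
∑-↭ f Perm.refl         = refl
∑-↭ f (Perm.prep x p)   = cong (f x +_) (∑-↭ f p)
∑-↭ f (Perm.swap x y p) = trans (+-CS.x∙yz≈y∙xz (f x) (f y) _) (cong (λ s → f y + (f x + s)) (∑-↭ f p))
∑-↭ f (Perm.trans p q)  = trans (∑-↭ f p) (∑-↭ f q)

∑-cong : ∀ (xs : List A) {f g} → (∀ x → x ∈ˡ xs → f x ≡ g x) → ∑ xs f ≡ ∑ xs g
∑-cong []       e = refl
∑-cong (x ∷ xs) e = cong₂ _+_ (e x (here refl)) (∑-cong xs λ y y∈ → e y (there y∈))

∑-mono : ∀ (xs : List A) {f g} → (∀ x → x ∈ˡ xs → f x ≤ g x) → ∑ xs f ≤ ∑ xs g
∑-mono []       e = ℚ.≤-refl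
∑-mono (x ∷ xs) e = ℚ.+-mono-≤ (e x (here refl)) (∑-mono xs λ y y∈ → e y (there y∈))

∑-0 : ∀ (xs : List A) → ∑ {A = A} xs (λ _ → 0ℚ) ≡ 0ℚ
∑-0 []       = refl
∑-0 (x ∷ xs) = trans (ℚ.+-identityˡ _) (∑-0 xs)

∑-nonNeg : ∀ (xs : List A) {f} → (∀ x → x ∈ˡ xs → 0ℚ ≤ f x) → 0ℚ ≤ ∑ xs f
∑-nonNeg xs e = ℚ.≤-trans (ℚ.≤-reflexive (sym (∑-0 xs))) (∑-mono xs e)

∑-+ : ∀ (xs : List A) f g → ∑ xs (λ x → f x + g x) ≡ ∑ xs f + ∑ xs g
∑-+ []       f g = sym (ℚ.+-identityˡ _)
∑-+ (x ∷ xs) f g = trans (cong (f x + g x +_) (∑-+ xs f g)) (+-CS.interchange (f x) (g x) _ _)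

∑-*ˡ : ∀ (xs : List A) c f → ∑ xs (λ x → c * f x) ≡ c * ∑ xs f
∑-*ˡ []       c f = sym (ℚ.*-zeroʳ c)
∑-*ˡ (x ∷ xs) c f = trans (cong (c * f x +_) (∑-*ˡ xs c f)) (sym (ℚ.*-distribˡ-+ c (f x) _))

∑-comm : ∀ (xs : List A) (ys : List B) (f : A → B → ℚ) → ∑ xs (λ x → ∑ ys (f x)) ≡ ∑ ys (λ y → ∑ xs (λ x → f x y))
∑-comm [] ys f = sym (∑-0 ys)
∑-comm (x ∷ xs) ys f = trans (cong (∑ ys (f x) +_) (∑-comm xs ys f))
  (sym (∑-+ ys (f x) (λ y → ∑ xs (λ x → f x y))))

∑-filter : ∀ {P : A → Set} (P? : Decidable P) (xs : List A) f →
           ∑ (filter P? xs) f ≡ ∑ xs (λ x → if does (P? x) then f x else 0ℚ)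
∑-filter P? []       f = refl
∑-filter P? (x ∷ xs) f with does (P? x)
... | true  = cong (f x +_) (∑-filter P? xs f)
... | false = trans (∑-filter P? xs f) (sym (ℚ.+-identityˡ _))

∑-map : ∀ (h : A → B) (xs : List A) f → ∑ (map h xs) f ≡ ∑ xs (λ x → f (h x))
∑-map h []       f = refl
∑-map h (x ∷ xs) f = cong (f (h x) +_) (∑-map h xs f)

∈-∑ : ∀ {xs : List A} {x f} → x ∈ˡ xs → (∀ y → y ∈ˡ xs → 0ℚ ≤ f y) → f x ≤ ∑ xs f
∈-∑ {xs = y ∷ xs} {f = f} (here refl) nn = ℚ.≤-trans (ℚ.≤-reflexive (sym (ℚ.+-identityʳ _)))
  (ℚ.+-monoʳ-≤ (f y) (∑-nonNeg xs λ z z∈ → nn z (there z∈)))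
∈-∑ {xs = y ∷ xs} {f = f} (there x∈) nn = ℚ.≤-trans (∈-∑ x∈ λ z z∈ → nn z (there z∈))
  (ℚ.≤-trans (ℚ.≤-reflexive (sym (ℚ.+-identityˡ _))) (ℚ.+-monoˡ-≤ (∑ xs f) (nn y (here refl))))

minimum-≤ : ∀ {xs x} → x ∈ˡ xs → minimum xs ≤ x
minimum-≤ {y ∷ xs} (here refl) = fold-≤ xs
  where
  fold-≤ : ∀ xs → foldr _⊓_ y xs ≤ y
  fold-≤ []       = ℚ.≤-refl
  fold-≤ (z ∷ xs) = ℚ.≤-trans (ℚ.p⊓q≤q z _) (fold-≤ xs)
minimum-≤ {y ∷ xs} (there x∈) = fold-≤ x∈
  where
  fold-≤ : ∀ {xs x} → x ∈ˡ xs → foldr _⊓_ y xs ≤ x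
  fold-≤ {z ∷ xs} (here refl) = ℚ.p⊓q≤p z _
  fold-≤ {z ∷ xs} (there x∈)  = ℚ.≤-trans (ℚ.p⊓q≤q z _) (fold-≤ x∈)

minimum-∈ : ∀ {xs x} → x ∈ˡ xs → minimum xs ∈ˡ xs
minimum-∈ {y ∷ xs} _ = fold-∈ xs
  where
  insert : ∀ {a b c : ℚ} {zs} → c ∈ˡ a ∷ zs → c ∈ˡ a ∷ b ∷ zs
  insert (here e)   = here e
  insert (there c∈) = there (there c∈)
  fold-∈ : ∀ xs → foldr _⊓_ y xs ∈ˡ y ∷ xs
  fold-∈ [] = here refl
  fold-∈ (z ∷ xs) with ℚ.⊓-sel z (foldr _⊓_ y xs)
  ... | inj₁ e = subst (_∈ˡ y ∷ z ∷ xs) (sym e) (there (here refl))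
  ... | inj₂ e = subst (_∈ˡ y ∷ z ∷ xs) (sym e) (insert (fold-∈ xs))

maximum-≤ : ∀ xs {b} → 0ℚ ≤ b → (∀ x → x ∈ˡ xs → x ≤ b) → maximum xs ≤ b
maximum-≤ []       0≤b _ = 0≤b
maximum-≤ (y ∷ xs) _   h = fold-≤ xs λ x x∈ → h x (there x∈)
  where
  fold-≤ : ∀ xs → (∀ x → x ∈ˡ xs → x ≤ _) → foldr _⊔_ y xs ≤ _
  fold-≤ []       _ = h y (here refl)
  fold-≤ (z ∷ xs) k = ℚ.⊔-lub (k z (here refl)) (fold-≤ xs λ x x∈ → k x (there x∈))

maximum-const : ∀ xs {b x} → x ∈ˡ xs → (∀ x → x ∈ˡ xs → x ≡ b) → maximum xs ≡ b
maximum-const (y ∷ xs) _ h = fold-≡ xs λ x x∈ → h x (there x∈)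
  where
  fold-≡ : ∀ xs → (∀ x → x ∈ˡ xs → x ≡ _) → foldr _⊔_ y xs ≡ _
  fold-≡ []       _ = h y (here refl)
  fold-≡ (z ∷ xs) k = trans (cong₂ _⊔_ (k z (here refl)) (fold-≡ xs λ x x∈ → k x (there x∈))) (ℚ.⊔-idem _)

-- Perfect matchings

Unique-↭ : {xs ys : List A} → xs ↭ ys → Unique xs → Unique ys
Unique-↭ p = PermS.Unique-resp-↭ (setoid _) (Perm.↭⇒↭ₛ p)

↭⇒∼ : {xs ys : List A} → xs ↭ ys → xs ∼ ys
↭⇒∼ p = parity λ χ → par-↭ χ p
  where
  par-↭ : ∀ χ {xs ys} → xs ↭ ys → par χ xs ≡ par χ ys
  par-↭ χ Perm.refl = refl
  par-↭ χ (Perm.prep x p) = cong (χ x xor_) (par-↭ χ p)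
  par-↭ χ (Perm.swap {xs} {ys} x y p) = trans (cong (λ b → χ x xor (χ y xor b)) (par-↭ χ p))
    (solve 3 (λ a b c → a xor (b xor c) := b xor (a xor c)) refl (χ x) (χ y) (par χ ys))
  par-↭ χ (Perm.trans p q) = trans (par-↭ χ p) (par-↭ χ q)

elements-unique : (S : Subset n) → Unique (elements S)
elements-unique S = Unique.filter⁺ (_∈? S) (Unique.allFin⁺ _)

∈-elements⁺ : ∀ {S : Subset n} {v} → v ∈ S → v ∈ˡ elements S
∈-elements⁺ {S = S} {v} v∈ = ∈-filter⁺ (_∈? S) (∈-allFin v) v∈

∈-elements⁻ : ∀ {S : Subset n} {v} → v ∈ˡ elements S → v ∈ S
∈-elements⁻ {S = S} v∈ = proj₂ (∈-filter⁻ (_∈? S) {xs = allFin _} v∈)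

module UniqueParity {V : Set} (_≟_ : DecidableEquality V) where
  open Points _≟_

  par-∉ : ∀ {a xs} → a ∉ˡ xs → par (point a) xs ≡ false
  par-∉ {xs = []}     _  = refl
  par-∉ {xs = x ∷ xs} a∉ = cong₂ _xor_ (point-no λ a≡x → a∉ (here a≡x)) (par-∉ λ a∈ → a∉ (there a∈))

  par-∈ : ∀ {a xs} → Unique xs → a ∈ˡ xs → par (point a) xs ≡ true
  par-∈ {a} (x∉ ∷ u) (here refl) = cong₂ _xor_ (point-refl a) (par-∉ (All.All¬⇒¬Any x∉))
  par-∈ {a} (x∉ ∷ u) (there a∈)  = cong₂ _xor_ (point-no λ { refl → All.All¬⇒¬Any x∉ a∈ }) (par-∈ u a∈)

  open DecMembership _≟_ using () renaming (_∈?_ to _∈ˡ?_)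

  ∼⇒⊆ : ∀ {xs ys} → Unique xs → xs ∼ ys → ∀ a → a ∈ˡ xs → a ∈ˡ ys
  ∼⇒⊆ {xs} {ys} u e a a∈ with a ∈ˡ? ys
  ... | yes a∈′ = a∈′
  ... | no a∉ with trans (sym (par-∈ u a∈)) (trans (at e (point a)) (par-∉ a∉))
  ...   | ()

  -- In a list without repetitions the parity at a point is just membership.
  ∼⇒↭ : ∀ {xs ys} → Unique xs → Unique ys → xs ∼ ys → xs ↭ ys
  ∼⇒↭ u v e = unique-↭ u v λ a → mk⇔ (∼⇒⊆ u e a) (∼⇒⊆ v (parity λ χ → sym (at e χ)) a)

_∈ˡ?_ : (a : Fin n) (xs : List (Fin n)) → Dec (a ∈ˡ xs)
_∈ˡ?_ = DecMembership._∈?_ Fin._≟_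

remove-end : (d : DistanceFunction (Fin n)) → (∀ u w → d u w ≡ d w u) →
             ∀ {u} M → u ∈ˡ ends M → ∃ λ u′ → ∃ λ M₁ → ends M ↭ u ∷ u′ ∷ ends M₁ × cost d M ≡ d u u′ + cost d M₁
remove-end d d-sym ((u , w) ∷ M) (here refl)         = w , M , ↭-refl , refl
remove-end d d-sym ((u , w) ∷ M) (there (here refl)) = u , M , Perm.swap u w ↭-refl , cong (_+ cost d M) (d-sym u w)
remove-end d d-sym {x} ((u , w) ∷ M) (there (there x∈)) with remove-end d d-sym M x∈
... | x′ , M₁ , p , c = x′ , (u , w) ∷ M₁
  , ↭-trans (Perm.prep u (Perm.prep w p)) (Perm.shifts (u ∷ w ∷ []) (_ ∷ x′ ∷ []))
  , trans (cong (d u w +_) c) (+-CS.x∙yz≈y∙xz (d u w) (d x x′) (cost d M₁))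

module Metric {n} (d : DistanceFunction (Fin n)) (metric : IsMetric _≡_ d) where
  open IsMetric metric using (nonNegative; triangle; ≈⇒0) renaming (sym to d-sym)

  private
    d-nonNeg : ∀ u w → 0ℚ ≤ d u w
    d-nonNeg u w = nonNegative

    ≤-+ˡ : ∀ {p q} → 0ℚ ≤ p → q ≤ p + q
    ≤-+ˡ {p} {q} 0≤p = ℚ.≤-trans (ℚ.≤-reflexive (sym (ℚ.+-identityˡ q))) (ℚ.+-monoˡ-≤ q 0≤p)

  -- Adds the edge uw to a matching modulo 2. A vertex at which two edges would meet is bypassed by
  -- the triangle inequality, so the ends stay distinct.
  Shortcut : Fin n → Fin n → List (Edge n) → Set
  Shortcut u w M = ∃ λ M′ → Unique (ends M′) × ends M′ ∼ u ∷ w ∷ ends M × cost d M′ ≤ d u w + cost d M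

  shortcut-at-end : ∀ u w M → u ≢ w → Unique (ends M) → u ∈ˡ ends M → w ∉ˡ ends M → Shortcut u w M
  shortcut-at-end u w M u≢w uniq u∈ w∉ with remove-end d d-sym M u∈
  ... | u′ , M₁ , p , c with Unique-↭ p uniq
  ... | (u≢u′ ∷ u∉) ∷ u′∉ ∷ uniq₁ = (u′ , w) ∷ M₁
      , ((λ { refl → w∉′ (there (here refl)) }) ∷ u′∉)
        ∷ All.¬Any⇒All¬ _ (λ w∈ → w∉′ (there (there w∈))) ∷ uniq₁
      , parity (λ χ → combine₁
          (solve 5 (λ u w u′ m m₁ → (u′ xor (w xor m₁)) xor (u xor (w xor m)) := m xor (u xor (u′ xor m₁))) refl
            (χ u) (χ w) (χ u′) (par χ (ends M)) (par χ (ends M₁))) (at (↭⇒∼ p) χ))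
      , (begin
          d u′ w + cost d M₁             ≤⟨ ℚ.+-monoˡ-≤ _ (triangle u′ u w) ⟩
          (d u′ u + d u w) + cost d M₁   ≡⟨ cong (λ x → (x + d u w) + cost d M₁) (d-sym u′ u) ⟩
          (d u u′ + d u w) + cost d M₁   ≡⟨ ℚ.+-assoc (d u u′) _ _ ⟩
          d u u′ + (d u w + cost d M₁)   ≡⟨ +-CS.x∙yz≈y∙xz (d u u′) (d u w) (cost d M₁) ⟩
          d u w + (d u u′ + cost d M₁)   ≡⟨ cong (d u w +_) c ⟨
          d u w + cost d M               ∎)
    where
    open ℚ.≤-Reasoning
    w∉′ : w ∉ˡ u ∷ u′ ∷ ends M₁
    w∉′ w∈ = w∉ (Perm.∈-resp-↭ (↭-sym p) w∈)

  shortcut-between : ∀ u w M → u ≢ w → Unique (ends M) → u ∈ˡ ends M → w ∈ˡ ends M → Shortcut u w M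
  shortcut-between u w M u≢w uniq u∈ w∈ with remove-end d d-sym M u∈
  ... | u′ , M₁ , p , c with Unique-↭ p uniq | Perm.∈-resp-↭ p w∈
  ... | _                      | here refl         = ⊥-elim (u≢w refl)
  -- Here `u` and `w` are matched to each other: modulo 2 both ends disappear, and the edge is
  -- dropped.
  ... | _ ∷ _ ∷ uniq₁          | there (here refl) = M₁ , uniq₁
      , parity (λ χ → combine₁
          (solve 4 (λ u w m m₁ → m₁ xor (u xor (w xor m)) := m xor (u xor (w xor m₁))) refl
            (χ u) (χ w) (par χ (ends M)) (par χ (ends M₁))) (at (↭⇒∼ p) χ))
      , ℚ.≤-trans (≤-+ˡ (d-nonNeg u w)) (ℚ.≤-trans (ℚ.≤-reflexive (sym c)) (≤-+ˡ (d-nonNeg u w)))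
  ... | (_ ∷ _) ∷ u′∉ ∷ uniq₁ | there (there w∈₁) with remove-end d d-sym M₁ w∈₁
  ...   | w′ , M₂ , p₂ , c₂ with Perm.All-resp-↭ p₂ u′∉ | Unique-↭ p₂ uniq₁
  ...     | _ ∷ u′≢w′ ∷ u′∉₂ | _ ∷ w′∉ ∷ uniq₂ = (u′ , w′) ∷ M₂
      , (u′≢w′ ∷ u′∉₂) ∷ w′∉ ∷ uniq₂
      , parity (λ χ → combine₂
          (solve 7 (λ u w u′ w′ m m₁ m₂ → (u′ xor (w′ xor m₂)) xor (u xor (w xor m)) :=
              (m xor (u xor (u′ xor m₁))) xor (m₁ xor (w xor (w′ xor m₂)))) refl
            (χ u) (χ w) (χ u′) (χ w′) (par χ (ends M)) (par χ (ends M₁)) (par χ (ends M₂)))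
          (at (↭⇒∼ p) χ) (at (↭⇒∼ p₂) χ))
      , (begin
          d u′ w′ + cost d M₂ ≤⟨ ℚ.+-monoˡ-≤ _ (ℚ.≤-trans (triangle u′ u w′)
              (ℚ.+-monoʳ-≤ (d u′ u) (triangle u w w′))) ⟩
          (d u′ u + (d u w + d w w′)) + cost d M₂ ≡⟨ cong (λ x → (x + (d u w + d w w′)) + cost d M₂)
              (d-sym u′ u) ⟩
          (d u u′ + (d u w + d w w′)) + cost d M₂          ≡⟨ regroup (d u u′) (d u w) (d w w′) (cost d M₂) ⟩
          d u w + (d u u′ + (d w w′ + cost d M₂))          ≡⟨ cong (λ x → d u w + (d u u′ + x)) c₂ ⟨
          d u w + (d u u′ + cost d M₁)                     ≡⟨ cong (d u w +_) c ⟨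
          d u w + cost d M                                 ∎)
    where
    open ℚ.≤-Reasoning
    regroup : ∀ a b c e → (a + (b + c)) + e ≡ b + (a + (c + e))
    regroup a b c e = trans (cong (_+ e) (+-CS.x∙yz≈y∙xz a b c))
      (trans (ℚ.+-assoc b (a + c) e) (cong (b +_) (ℚ.+-assoc a c e)))

  shortcut : ∀ u w M → Unique (ends M) → Shortcut u w M
  shortcut u w M uniq with u Fin.≟ w
  ... | yes refl = M , uniq
      , parity (λ χ → solve 2 (λ u m → m := u xor (u xor m)) refl (χ u) (par χ (ends M)))
      , ≤-+ˡ (d-nonNeg u u)
  ... | no u≢w with u ∈ˡ? ends M | w ∈ˡ? ends M
  ...   | yes u∈ | no w∉  = shortcut-at-end u w M u≢w uniq u∈ w∉
  ...   | yes u∈ | yes w∈ = shortcut-between u w M u≢w uniq u∈ w∈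
  ...   | no u∉  | no w∉  = (u , w) ∷ M
      , (u≢w ∷ All.¬Any⇒All¬ _ u∉) ∷ All.¬Any⇒All¬ _ w∉ ∷ uniq , parity (λ _ → refl) , ℚ.≤-refl
  ...   | no u∉  | yes w∈ = shortcut-sym (shortcut-at-end w u M (λ e → u≢w (sym e)) uniq w∈ u∉)
    where
    shortcut-sym : Shortcut w u M → Shortcut u w M
    shortcut-sym (M′ , uniq′ , p , c) = M′ , uniq′
      , parity (λ χ → trans (at p χ) (solve 3 (λ u w m → w xor (u xor m) := u xor (w xor m)) refl (χ u)
          (χ w) (par χ (ends M))))
      , ℚ.≤-trans c (ℚ.≤-reflexive (cong (_+ cost d M) (d-sym w u)))

  matching : ∀ L → ∃ λ M → Unique (ends M) × ends M ∼ ends L × cost d M ≤ cost d L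
  matching [] = [] , [] , parity (λ _ → refl) , ℚ.≤-refl
  matching ((u , w) ∷ L) with matching L
  ... | M , uniq , p , c with shortcut u w M uniq
  ...   | M′ , uniq′ , p′ , c′ = M′ , uniq′
      , parity (λ χ → trans (at p′ χ) (cong (λ b → χ u xor (χ w xor b)) (at p χ)))
      , ℚ.≤-trans c′ (ℚ.+-monoʳ-≤ (d u w) c)

∈-edgesWithin⁺ : ∀ {T : Subset n} {u w} → u ∈ T → w ∈ T → u Fin.< w → (u , w) ∈ˡ edgesWithin T
∈-edgesWithin⁺ u∈ w∈ u<w = ∈-filter⁺ _ (∈-cartesianProduct⁺ (∈-elements⁺ u∈) (∈-elements⁺ w∈)) u<w

∈-edgesWithin⁻ : ∀ {T : Subset n} {u w} → (u , w) ∈ˡ edgesWithin T → u ∈ T × w ∈ T × u Fin.< w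
∈-edgesWithin⁻ {T = T} e∈ with ∈-filter⁻ (λ e → proj₁ e Fin.<? proj₂ e)
    {xs = cartesianProduct (elements T) (elements T)} e∈
... | e∈′ , u<w with ∈-cartesianProduct⁻ (elements T) (elements T) e∈′
...   | u∈ , w∈ = ∈-elements⁻ u∈ , ∈-elements⁻ w∈ , u<w

edgesWithin-unique : (T : Subset n) → Unique (edgesWithin T)
edgesWithin-unique T = Unique.filter⁺ _ (Unique.cartesianProduct⁺ (elements-unique T) (elements-unique T))

filter-∈-sublists : ∀ {P : A → Set} (P? : ∀ x → Dec (P x)) xs → filter P? xs ∈ˡ sublists xs
filter-∈-sublists P? []       = here refl
filter-∈-sublists P? (x ∷ xs) with does (P? x)
... | true  = ∈-++⁺ˡ (∈-map⁺ (x ∷_) (filter-∈-sublists P? xs))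
... | false = ∈-++⁺ʳ (map (x ∷_) (sublists xs)) (filter-∈-sublists P? xs)

sublists-⊆ : ∀ (xs : List A) {ys x} → ys ∈ˡ sublists xs → x ∈ˡ ys → x ∈ˡ xs
sublists-⊆ []       (here refl) ()
sublists-⊆ (z ∷ xs) ys∈ x∈ with ∈-++⁻ (map (z ∷_) (sublists xs)) ys∈
... | inj₂ ys∈′ = there (sublists-⊆ xs ys∈′ x∈)
... | inj₁ ys∈′ with ∈-map⁻ (z ∷_) ys∈′
...   | zs , zs∈ , refl with x∈
...     | here refl = here refl
...     | there x∈′ = there (sublists-⊆ xs zs∈ x∈′)

orient : Edge n → Edge n
orient (u , w) with u Fin.<? w
... | yes _ = u , w
... | no _  = w , u

∈-ends⁺ : ∀ {M : List (Edge n)} {e} → e ∈ˡ M → proj₁ e ∈ˡ ends M × proj₂ e ∈ˡ ends M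
∈-ends⁺ (here refl) = here refl , there (here refl)
∈-ends⁺ (there e∈)  = there (there (proj₁ (∈-ends⁺ e∈))) , there (there (proj₂ (∈-ends⁺ e∈)))

ends-orient : ∀ (M : List (Edge n)) → ends (map orient M) ↭ ends M
ends-orient []            = ↭-refl
ends-orient ((u , w) ∷ M) with u Fin.<? w
... | yes _ = Perm.prep u (Perm.prep w (ends-orient M))
... | no _  = Perm.swap w u (ends-orient M)

ends-unique⇒unique : ∀ (M : List (Edge n)) → Unique (ends M) → Unique M
ends-unique⇒unique []      _ = []
ends-unique⇒unique (e ∷ M) ((_ ∷ u∉) ∷ _ ∷ uniq) =
  All.tabulate (λ {e′} e′∈ → λ { refl → All.lookup u∉ (proj₁ (∈-ends⁺ e′∈)) refl }) ∷ ends-unique⇒unique M uniq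

orient-< : ∀ (M : List (Edge n)) → Unique (ends M) → All (λ e → proj₁ e Fin.< proj₂ e) (map orient M)
orient-< []            _ = []
orient-< ((u , w) ∷ M) ((u≢w ∷ _) ∷ _ ∷ uniq) with u Fin.<? w
... | yes u<w = u<w ∷ orient-< M uniq
... | no u≮w  = ℕ.≤∧≢⇒< (ℕ.≮⇒≥ u≮w) (λ e → u≢w (sym (Fin.toℕ-injective e))) ∷ orient-< M uniq

hasEnd? : (v : Fin n) (e : Edge n) → Dec (proj₁ e ≡ v ⊎ proj₂ e ≡ v)
hasEnd? v e = (proj₁ e Fin.≟ v) ⊎-dec (proj₂ e Fin.≟ v)

degree-↭ : ∀ {M N : List (Edge n)} v → M ↭ N → degree M v ≡ degree N v
degree-↭ v p = Perm.↭-length (Perm.filter-↭ (hasEnd? v) p)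

degree-∷⁺ : ∀ {e : Edge n} {M v} → proj₁ e ≡ v ⊎ proj₂ e ≡ v → degree (e ∷ M) v ≡ suc (degree M v)
degree-∷⁺ {v = v} end = cong length (filter-accept (hasEnd? v) end)

degree-∷⁻ : ∀ {e : Edge n} {M v} → ¬ (proj₁ e ≡ v ⊎ proj₂ e ≡ v) → degree (e ∷ M) v ≡ degree M v
degree-∷⁻ {v = v} ¬end = cong length (filter-reject (hasEnd? v) ¬end)

degree-∉ : ∀ (M : List (Edge n)) {v} → v ∉ˡ ends M → degree M v ≡ 0
degree-∉ []      _ = refl
degree-∉ (e ∷ M) {v} v∉ = trans
  (degree-∷⁻ {e = e} {M} λ { (inj₁ refl) → v∉ (here refl) ; (inj₂ refl) → v∉ (there (here refl)) })
  (degree-∉ M λ v∈ → v∉ (there (there v∈)))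

degree-1 : ∀ (M : List (Edge n)) {v} → Unique (ends M) → v ∈ˡ ends M → degree M v ≡ 1
degree-1 (e ∷ M) ((u≢w ∷ u∉) ∷ w∉ ∷ uniq) (here refl) =
  trans (degree-∷⁺ {e = e} {M} (inj₁ refl)) (cong suc (degree-∉ M (All.All¬⇒¬Any u∉)))
degree-1 (e ∷ M) ((u≢w ∷ u∉) ∷ w∉ ∷ uniq) (there (here refl)) =
  trans (degree-∷⁺ {e = e} {M} (inj₂ refl)) (cong suc (degree-∉ M (All.All¬⇒¬Any w∉)))
degree-1 (e ∷ M) ((u≢w ∷ u∉) ∷ w∉ ∷ uniq) (there (there v∈)) =
  trans (degree-∷⁻ {e = e} {M} λ { (inj₁ refl) → All.All¬⇒¬Any u∉ v∈ ; (inj₂ refl) → All.All¬⇒¬Any w∉ v∈ })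
    (degree-1 M uniq v∈)

_∈ᴱ?_ : (e : Edge n) (M : List (Edge n)) → Dec (e ∈ˡ M)
_∈ᴱ?_ = DecMembership._∈?_ (Prod.≡-dec Fin._≟_ Fin._≟_)

module _ {n} (d : DistanceFunction (Fin n)) (d-sym : ∀ u w → d u w ≡ d w u) where

  cost-orient : ∀ M → cost d (map orient M) ≡ cost d M
  cost-orient []            = refl
  cost-orient ((u , w) ∷ M) with u Fin.<? w
  ... | yes _ = cong (d u w +_) (cost-orient M)
  ... | no _  = cong₂ _+_ (d-sym w u) (cost-orient M)

  -- `perfectMatchings` contains only sublists of `edgesWithin T`, with a fixed order and
  -- orientation of the edges. Filtering `edgesWithin T` by membership in the oriented `M` yields
  -- the representative of `M` among them.
  perfect-matching : ∀ T M → Unique (ends M) → ends M ∼ elements T →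
                     ∃ λ E → E ∈ˡ perfectMatchings T × cost d E ≡ cost d M
  perfect-matching T M uniq p = E
    , ∈-filter⁺ (isPerfectOn? T) (filter-∈-sublists (_∈ᴱ? M′) (edgesWithin T))
        (All.tabulate λ {v} v∈ → trans (degree-↭ v (↭-sym M′↭E))
          (degree-1 M′ (Unique-↭ (↭-sym (ends-orient M)) uniq) (Perm.∈-resp-↭ (↭-sym M′↭T) v∈)))
    , trans (sym (∑-↭ _ M′↭E)) (cost-orient M)
    where
    M′ = map orient M
    E  = filter (_∈ᴱ? M′) (edgesWithin T)
    open UniqueParity Fin._≟_
    M′↭T : ends M′ ↭ elements T
    M′↭T = ↭-trans (ends-orient M) (∼⇒↭ uniq (elements-unique T) p)
    in-T : ∀ {v} → v ∈ˡ ends M′ → v ∈ T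
    in-T v∈ = ∈-elements⁻ (Perm.∈-resp-↭ M′↭T v∈)
    M′↭E : M′ ↭ E
    M′↭E = unique-↭ (ends-unique⇒unique M′ (Unique-↭ (↭-sym (ends-orient M)) uniq))
      (Unique.filter⁺ (_∈ᴱ? M′) (edgesWithin-unique T))
      λ e → mk⇔
        (λ e∈ → ∈-filter⁺ (_∈ᴱ? M′) (∈-edgesWithin⁺ (in-T (proj₁ (∈-ends⁺ e∈))) (in-T (proj₂ (∈-ends⁺ e∈)))
                  (All.lookup (orient-< M uniq) e∈)) e∈)
        (λ e∈ → proj₂ (∈-filter⁻ (_∈ᴱ? M′) {xs = edgesWithin T} e∈))

pairUp : ∀ (xs : List A) → odd (length xs) ≡ false → ∃ λ L → ends L ≡ xs
pairUp []           _ = [] , refl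
pairUp (x ∷ [])     ()
pairUp (x ∷ y ∷ xs) e with pairUp xs (trans (sym (Bool.not-involutive _)) e)
... | L , refl = (x , y) ∷ L , refl

module _ {V : Set} (_≟_ : DecidableEquality V) where
  open Points _≟_

  -- Every element occurs an even number of times, so the head cancels against another copy. Two
  -- elements disappear at a time, hence the induction on a bound `k` for the length.
  even-everywhere : ∀ k xs → length xs ℕ.≤ k → (∀ a → par (point a) xs ≡ false) → ∀ χ → par χ xs ≡ false
  even-everywhere k       []       _   _    χ = refl
  even-everywhere (suc k) (x ∷ xs) (ℕ.s≤s len) even χ
    with pluck (point x) (λ _ → 0) xs (trans (sym (Bool.not-involutive _))
           (cong not (trans (sym (cong (_xor par (point x) xs) (point-refl x))) (even x))))
  ... | y , ys , xy , xs∼ , _ , l with point-≡ xy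
  ...   | refl = trans (cancel χ) (even-everywhere k ys
      (ℕ.≤-trans (ℕ.n≤1+n _) (subst (ℕ._≤ k) l len)) (λ a → trans (sym (cancel (point a))) (even a)) χ)
    where
    cancel : ∀ χ → par χ (x ∷ xs) ≡ par χ ys
    cancel χ = combine₁ (solve 3 (λ a b c → (a xor b) xor c := b xor (a xor c)) refl (χ x) (par χ xs)
        (par χ ys)) (at xs∼ χ)

  pointwise⇒∼ : ∀ xs ys → (∀ a → par (point a) xs ≡ par (point a) ys) → xs ∼ ys
  pointwise⇒∼ xs ys e = parity λ χ → xor-≡ (trans (sym (par-++ χ xs ys))
    (even-everywhere _ (xs ++ ys) ℕ.≤-refl (λ a → trans (par-++ (point a) xs ys) (≡-xor (e a))) χ))

-- Loops are excluded because `degree` counts a loop once, while `ends` lists its vertex twice.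
odd-degree : ∀ (M : List (Edge n)) v → (∀ {e} → e ∈ˡ M → proj₁ e ≢ proj₂ e) →
             odd (degree M v) ≡ par (Points.point Fin._≟_ v) (ends M)
odd-degree []            v _ = refl
odd-degree ((u , w) ∷ M) v ≢ with v Fin.≟ u | v Fin.≟ w
... | yes refl | yes refl = ⊥-elim (≢ (here refl) refl)
... | yes refl | no _ = trans (cong odd (degree-∷⁺ {e = u , w} {M} (inj₁ refl)))
    (cong not (odd-degree M v λ e∈ → ≢ (there e∈)))
... | no _ | yes refl = trans (cong odd (degree-∷⁺ {e = u , w} {M} (inj₂ refl)))
    (cong not (odd-degree M v λ e∈ → ≢ (there e∈)))
... | no v≢u | no v≢w = trans (cong odd (degree-∷⁻ {e = u , w} {M} λ
    { (inj₁ e) → v≢u (sym e) ; (inj₂ e) → v≢w (sym e) }))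
                              (odd-degree M v λ e∈ → ≢ (there e∈))

∈-ends⁻ : ∀ {M : List (Edge n)} {v} → v ∈ˡ ends M → ∃ λ e → e ∈ˡ M × (proj₁ e ≡ v ⊎ proj₂ e ≡ v)
∈-ends⁻ {M = e ∷ M} (here refl)         = e , here refl , inj₁ refl
∈-ends⁻ {M = e ∷ M} (there (here refl)) = e , here refl , inj₂ refl
∈-ends⁻ {M = _ ∷ M} (there (there v∈)) with ∈-ends⁻ v∈
... | e , e∈ , end = e , there e∈ , end

module _ {n} {T : Subset n} {M : List (Edge n)} (M∈ : M ∈ˡ perfectMatchings T) where
  open Points {V = Fin n} Fin._≟_
  open UniqueParity {V = Fin n} Fin._≟_

  private
    M∈′ : M ∈ˡ sublists (edgesWithin T) × IsPerfectOn T M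
    M∈′ = ∈-filter⁻ (isPerfectOn? T) {xs = sublists (edgesWithin T)} M∈

    edge∈ : ∀ {e} → e ∈ˡ M → proj₁ e ∈ T × proj₂ e ∈ T × proj₁ e Fin.< proj₂ e
    edge∈ e∈ = ∈-edgesWithin⁻ (sublists-⊆ (edgesWithin T) (proj₁ M∈′) e∈)

  perfect⇒≢ : ∀ {e} → e ∈ˡ M → proj₁ e ≢ proj₂ e
  perfect⇒≢ e∈ u≡w = ℕ.<-irrefl (cong Fin.toℕ u≡w) (proj₂ (proj₂ (edge∈ e∈)))

  perfect⇒∼ : ends M ∼ elements T
  perfect⇒∼ = pointwise⇒∼ Fin._≟_ (ends M) (elements T) λ v → trans (sym (odd-degree M v perfect⇒≢)) (degree-parity v)
    where
    degree-parity : ∀ v → odd (degree M v) ≡ par (point v) (elements T)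
    degree-parity v with v ∈? T
    ... | yes v∈ = trans (cong odd (All.lookup (proj₂ M∈′) (∈-elements⁺ v∈)))
                     (sym (par-∈ (elements-unique T) (∈-elements⁺ v∈)))
    ... | no v∉  = trans (cong odd (degree-∉ M v∉M)) (sym (par-∉ λ v∈ → v∉ (∈-elements⁻ v∈)))
      where
      v∉M : v ∉ˡ ends M
      v∉M v∈ with ∈-ends⁻ {M = M} v∈
      ... | e , e∈ , inj₁ refl = v∉ (proj₁ (edge∈ e∈))
      ... | e , e∈ , inj₂ refl = v∉ (proj₁ (proj₂ (edge∈ e∈)))

-- Cuts crossed by a perfect matching

mem : Subset n → Fin n → Bool
mem S u = does (u ∈? S)

singleCount : ∀ (w : Fin n) S → ∣ ⁅ w ⁆ ∩ S ∣ ≡ bit (mem S w)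
singleCount {suc n} Fin.zero (s ∷ S) with s
... | true  = cong suc (trans (cong ∣_∣ (∩-zeroˡ S)) (∣⊥∣≡0 n))
... | false = trans (cong ∣_∣ (∩-zeroˡ S)) (∣⊥∣≡0 n)
singleCount (Fin.suc w) (s ∷ S) = singleCount w S

crossCount : ∀ {u w : Fin n} (S : Subset n) → u ≢ w →
             ∣ (⁅ u ⁆ ∪ ⁅ w ⁆) ∩ S ∣ ≡ bit (mem S u) ℕ.+ bit (mem S w)
crossCount {u = Fin.zero}  {Fin.zero}  S u≢w = ⊥-elim (u≢w refl)
crossCount {u = Fin.zero} {Fin.suc w} (s ∷ S) _ with s | trans (cong (λ p → ∣ p ∩ S ∣) (∪-identityˡ ⁅ w ⁆))
    (singleCount w S)
... | true  | e = cong suc e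
... | false | e = e
crossCount {u = Fin.suc u} {Fin.zero} (s ∷ S) _ with s | trans (cong (λ p → ∣ p ∩ S ∣) (∪-identityʳ ⁅ u ⁆))
    (singleCount u S)
... | true  | e = trans (cong suc e) (ℕ.+-comm 1 _)
... | false | e = trans e (sym (ℕ.+-identityʳ _))
crossCount {u = Fin.suc u} {Fin.suc w} (s ∷ S) u≢w = crossCount S λ e → u≢w (cong Fin.suc e)

crosses⁺ : ∀ {u w : Fin n} S → u ≢ w → mem S u xor mem S w ≡ true → Crosses u w S
crosses⁺ {u = u} {w} S u≢w e = trans (crossCount S u≢w) (bits (mem S u) (mem S w) e)
  where
  bits : ∀ a b → a xor b ≡ true → bit a ℕ.+ bit b ≡ 1
  bits true  false _ = refl
  bits false true  _ = refl

crosses⁻ : ∀ {u w : Fin n} S → u ≢ w → Crosses u w S → mem S u xor mem S w ≡ true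
crosses⁻ {u = u} {w} S u≢w e = bits (mem S u) (mem S w) (trans (sym (crossCount S u≢w)) e)
  where
  bits : ∀ a b → bit a ℕ.+ bit b ≡ 1 → a xor b ≡ true
  bits true  false _ = refl
  bits false true  _ = refl

crossing-edge : ∀ χ (M : List (Edge n)) → par χ (ends M) ≡ true → ∃ λ e → e ∈ˡ M × χ (proj₁ e) xor χ (proj₂ e) ≡ true
crossing-edge χ ((u , w) ∷ M) o with χ u xor χ w in uw
... | true  = _ , here refl , uw
... | false with crossing-edge χ M (trans (sym (cong (_xor par χ (ends M)) uw))
    (trans (Bool.xor-assoc (χ u) (χ w) _) o))
...   | e , e∈ , c = e , there e∈ , c

-- By parity a perfect matching on T uses some edge of every cut that splits T
-- into odd parts.
packing≤cost : ∀ (d : DistanceFunction (Fin n)) r (y : Packing n) → IsFeasible d ⊤ r y →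
               ∀ {T M} → M ∈ˡ perfectMatchings T →
               ∑ (cuts ⊤ r) (λ S → if par (mem S) (elements T) then y S else 0ℚ) ≤ cost d M
packing≤cost d r y feasible {T} {M} M∈ = begin
  ∑ (cuts ⊤ r) (λ S → if par (mem S) (elements T) then y S else 0ℚ)
    ≤⟨ ∑-mono (cuts ⊤ r) odd-cut ⟩
  ∑ (cuts ⊤ r) (λ S → ∑ M (λ e → load e S))
    ≡⟨ ∑-comm (cuts ⊤ r) M (λ S e → load e S) ⟩
  ∑ M (λ e → ∑ (cuts ⊤ r) (load e))
    ≡⟨ ∑-cong M (λ e _ → ∑-filter (crosses? (proj₁ e) (proj₂ e)) (cuts ⊤ r) y) ⟨
  ∑ M (λ e → ∑ (filter (crosses? (proj₁ e) (proj₂ e)) (cuts ⊤ r)) y)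
    ≤⟨ ∑-mono M (λ e e∈ → capacity _ _ ∈⊤ ∈⊤ (perfect⇒≢ M∈ e∈)) ⟩
  cost d M ∎
  where
  open ℚ.≤-Reasoning
  open IsFeasible feasible
  load : Edge _ → Subset _ → ℚ
  load e S = if does (crosses? (proj₁ e) (proj₂ e) S) then y S else 0ℚ
  y-nonNeg : ∀ S → S ∈ˡ cuts ⊤ r → 0ℚ ≤ y S
  y-nonNeg S S∈ = nonNegative S (proj₂ (∈-filter⁻ (isCut? ⊤ r) {xs = allSubsets _} S∈))
  load-nonNeg : ∀ e S → S ∈ˡ cuts ⊤ r → 0ℚ ≤ load e S
  load-nonNeg e S S∈ with does (crosses? (proj₁ e) (proj₂ e) S)
  ... | true  = y-nonNeg S S∈
  ... | false = ℚ.≤-refl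
  odd-cut : ∀ S → S ∈ˡ cuts ⊤ r → (if par (mem S) (elements T) then y S else 0ℚ) ≤ ∑ M (λ e → load e S)
  odd-cut S S∈ with par (mem S) (elements T) in o
  ... | false = ∑-nonNeg M λ e _ → load-nonNeg e S S∈
  ... | true with crossing-edge (mem S) M (trans (at (perfect⇒∼ M∈) (mem S)) o)
  ...   | e , e∈ , c = ℚ.≤-trans (ℚ.≤-reflexive (sym
          (cong (λ b → if b then y S else 0ℚ) (dec-true (crosses? (proj₁ e) (proj₂ e) S)
              (crosses⁺ S (perfect⇒≢ M∈ e∈) c)))))
          (∈-∑ {f = λ e → load e S} e∈ (λ e _ → load-nonNeg e S S∈))

-- Natural numbers as rationals

opaque
  ι : ℕ → ℚ
  ι n = ℤ.+ n / 1

  ι≡/1 : ∀ n → ι n ≡ ℤ.+ n / 1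
  ι≡/1 n = refl

  toℚᵘ-ι : ∀ n → toℚᵘ (ι n) ≃ᵘ mkℚᵘ (ℤ.+ n) 0
  toℚᵘ-ι n = ℚ.toℚᵘ-fromℚᵘ (mkℚᵘ (ℤ.+ n) 0)

ι-+ : ∀ m n → ι (m ℕ.+ n) ≡ ι m + ι n
ι-+ m n = ℚ.toℚᵘ-injective (ℚᵘ.≃-trans (toℚᵘ-ι (m ℕ.+ n)) (ℚᵘ.≃-trans
  (*≡* (cong (ℤ._* ℤ.+ 1) (sym (cong₂ ℤ._+_ (ℤ.*-identityʳ (ℤ.+ m)) (ℤ.*-identityʳ (ℤ.+ n))))))
  (ℚᵘ.≃-sym (ℚᵘ.≃-trans (ℚ.toℚᵘ-homo-+ (ι m) (ι n)) (ℚᵘ.+-cong (toℚᵘ-ι m) (toℚᵘ-ι n))))))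

ι-* : ∀ m n → ι (m ℕ.* n) ≡ ι m * ι n
ι-* m n = ℚ.toℚᵘ-injective (ℚᵘ.≃-trans (toℚᵘ-ι (m ℕ.* n)) (ℚᵘ.≃-trans
  (*≡* (cong (ℤ._* ℤ.+ 1) (ℤ.pos-* m n)))
  (ℚᵘ.≃-sym (ℚᵘ.≃-trans (ℚ.toℚᵘ-homo-* (ι m) (ι n)) (ℚᵘ.*-cong (toℚᵘ-ι m) (toℚᵘ-ι n))))))

ι-mono-≤ : ∀ {m n} → m ℕ.≤ n → ι m ≤ ι n
ι-mono-≤ {m} {n} m≤n = ℚ.toℚᵘ-cancel-≤ (ℚᵘ.≤-respˡ-≃ (ℚᵘ.≃-sym (toℚᵘ-ι m)) (ℚᵘ.≤-respʳ-≃ (ℚᵘ.≃-sym (toℚᵘ-ι n))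
  (*≤* (ℤ.*-monoʳ-≤-nonNeg (ℤ.+ 1) (ℤ.+≤+ m≤n)))))

ι-cancel-≤ : ∀ {m n} → ι m ≤ ι n → m ℕ.≤ n
ι-cancel-≤ {m} {n} h with ℚᵘ.≤-respˡ-≃ (toℚᵘ-ι m) (ℚᵘ.≤-respʳ-≃ (toℚᵘ-ι n) (ℚ.toℚᵘ-mono-≤ h))
... | *≤* le = ℤ.drop‿+≤+ (subst₂ ℤ._≤_ (ℤ.*-identityʳ (ℤ.+ m)) (ℤ.*-identityʳ (ℤ.+ n)) le)

ι-injective : ∀ {m n} → ι m ≡ ι n → m ≡ n
ι-injective e = ℕ.≤-antisym (ι-cancel-≤ (ℚ.≤-reflexive e)) (ι-cancel-≤ (ℚ.≤-reflexive (sym e)))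

0≤ι : ∀ n → 0ℚ ≤ ι n
0≤ι n = ℚ.≤-trans (ℚ.≤-reflexive (sym (ι≡/1 0))) (ι-mono-≤ ℕ.z≤n)

ι-*-/ : ∀ k n → .{{_ : NonZero n}} → ι n * (ℤ.+ k / n) ≡ ι k
ι-*-/ k (suc n) = ℚ.toℚᵘ-injective (ℚᵘ.≃-trans (ℚ.toℚᵘ-homo-* (ι (suc n)) (ℤ.+ k / suc n))
  (ℚᵘ.≃-trans (ℚᵘ.*-cong (toℚᵘ-ι (suc n)) (ℚ.toℚᵘ-fromℚᵘ (mkℚᵘ (ℤ.+ k) n))) (ℚᵘ.≃-trans
    (*≡* (trans (ℤ.*-identityʳ _) (trans (ℤ.*-comm (ℤ.+ suc n) (ℤ.+ k))
        (cong (λ m → ℤ.+ k ℤ.* ℤ.+ m) (sym (ℕ.+-identityʳ (suc n)))))))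
    (ℚᵘ.≃-sym (toℚᵘ-ι k)))))

integral-multiple : ∀ q → 0ℚ ≤ q → ∃ λ m → ι m ≡ ι (↧ₙ q) * q
integral-multiple q@(mkℚ (ℤ.+ m) b c) _ = m , sym (trans (cong (ι (suc b) *_) (sym (ℚ.↥p/↧p≡p q)))
    (ι-*-/ m (suc b)))
integral-multiple (mkℚ -[1+ m ] b c) 0≤q with ℚ.drop-*≤* 0≤q
... | ()

common-denominator : ∀ qs → (∀ q → q ∈ˡ qs → 0ℚ ≤ q) →
                     ∃ λ K → NonZero K × (∀ q → q ∈ˡ qs → ∃ λ m → ι m ≡ ι K * q)
common-denominator []       _  = 1 , _ , λ _ ()
common-denominator (q ∷ qs) nn with common-denominator qs (λ p p∈ → nn p (there p∈)) | integral-multiple q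
    (nn q (here refl))
... | K , K≢0 , h | m , e = ↧ₙ q ℕ.* K , ℕ.m*n≢0 (↧ₙ q) K {{_}} {{K≢0}} , multiple
  where
  multiple : ∀ p → p ∈ˡ q ∷ qs → ∃ λ m → ι m ≡ ι (↧ₙ q ℕ.* K) * p
  multiple p (here refl) = K ℕ.* m , (begin
    ι (K ℕ.* m)              ≡⟨ ι-* K m ⟩
    ι K * ι m                ≡⟨ cong (ι K *_) e ⟩
    ι K * (ι (↧ₙ p) * p)     ≡⟨ ℚ.*-assoc (ι K) (ι (↧ₙ p)) p ⟨
    (ι K * ι (↧ₙ p)) * p     ≡⟨ cong (_* p) (ℚ.*-comm (ι K) (ι (↧ₙ p))) ⟩
    (ι (↧ₙ p) * ι K) * p     ≡⟨ cong (_* p) (ι-* (↧ₙ p) K) ⟨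
    ι (↧ₙ p ℕ.* K) * p       ∎)
    where open ≡-Reasoning
  multiple p (there p∈) with h p p∈
  ... | m′ , e′ = ↧ₙ q ℕ.* m′ , (begin
    ι (↧ₙ q ℕ.* m′)          ≡⟨ ι-* (↧ₙ q) m′ ⟩
    ι (↧ₙ q) * ι m′          ≡⟨ cong (ι (↧ₙ q) *_) e′ ⟩
    ι (↧ₙ q) * (ι K * p)     ≡⟨ ℚ.*-assoc (ι (↧ₙ q)) (ι K) p ⟨
    (ι (↧ₙ q) * ι K) * p     ≡⟨ cong (_* p) (ι-* (↧ₙ q) K) ⟨
    ι (↧ₙ q ℕ.* K) * p       ∎)
    where open ≡-Reasoning

-- From packings of T-cuts to all-cut packings

mem-true : ∀ {S : Subset n} {v} → v ∈ S → mem S v ≡ true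
mem-true {S = S} {v} v∈ = dec-true (v ∈? S) v∈

mem-false : ∀ {S : Subset n} {v} → v ∉ S → mem S v ≡ false
mem-false {S = S} {v} v∉ = dec-false (v ∈? S) v∉

mem-tabulate : ∀ (χ : Fin n → Bool) v → mem (Vec.tabulate χ) v ≡ χ v
mem-tabulate χ Fin.zero with χ Fin.zero
... | true  = refl
... | false = refl
mem-tabulate χ (Fin.suc v) = mem-tabulate (χ ∘ Fin.suc) v

∈-allSubsets : ∀ (S : Subset n) → S ∈ˡ allSubsets n
∈-allSubsets []            = here refl
∈-allSubsets (inside ∷ S)  = ∈-++⁺ˡ (∈-map⁺ (inside ∷_) (∈-allSubsets S))
∈-allSubsets (outside ∷ S) = ∈-++⁺ʳ (map (inside ∷_) (allSubsets _)) (∈-map⁺ (outside ∷_) (∈-allSubsets S))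

allSubsets-unique : ∀ n → Unique (allSubsets n)
allSubsets-unique zero    = [] ∷ []
allSubsets-unique (suc n) = Unique.++⁺
  (Unique.map⁺ Vec.∷-injectiveʳ (allSubsets-unique n))
  (Unique.map⁺ Vec.∷-injectiveʳ (allSubsets-unique n))
  λ (∈₁ , ∈₂) → different (∈-map⁻ (inside ∷_) ∈₁) (∈-map⁻ (outside ∷_) ∈₂)
  where
  different : ∀ {S : Subset (suc n)} → ∃ (λ S₁ → S₁ ∈ˡ allSubsets n × S ≡ inside ∷ S₁) →
              ∃ (λ S₁ → S₁ ∈ˡ allSubsets n × S ≡ outside ∷ S₁) → Empty.⊥
  different (_ , _ , refl) (_ , _ , ())

length-elements : ∀ (S : Subset n) → length (elements S) ≡ ∣ S ∣
length-elements []      = refl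
length-elements {suc n} (s ∷ S) = trans (cong (λ xs → length (filter (_∈? (s ∷ S)) (Fin.zero ∷ xs)))
    (sym (map-tabulate id Fin.suc))) (head s)
  where
  tail : ∀ s xs → length (filter (_∈? (s ∷ S)) (map Fin.suc xs)) ≡ length (filter (_∈? S) xs)
  tail s []       = refl
  tail s (x ∷ xs) with does (x ∈? S)
  ... | true  = cong suc (tail s xs)
  ... | false = tail s xs
  head : ∀ s → length (filter (_∈? (s ∷ S)) (Fin.zero ∷ map Fin.suc (allFin n))) ≡ ∣ s ∷ S ∣
  head true  = cong suc (trans (tail true (allFin n)) (length-elements S))
  head false = trans (tail false (allFin n)) (length-elements S)

odd-double : ∀ m → odd (2 ℕ.* m) ≡ false
odd-double m = trans (odd-+ m (m ℕ.+ 0)) (≡-xor (cong odd (sym (ℕ.+-identityʳ m))))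

even⇒odd-false : ∀ {m} → 2 ∣ m → odd m ≡ false
even⇒odd-false (divides q refl) = trans (cong odd (ℕ.*-comm q 2)) (odd-double q)

∑-indicator-∉ : ∀ {xs : List A} (_≟_ : ∀ (x y : A) → Dec (x ≡ y)) a ε → a ∉ˡ xs →
                ∑ xs (λ x → if does (x ≟ a) then ε else 0ℚ) ≡ 0ℚ
∑-indicator-∉ {xs = []}     _≟_ a ε _  = refl
∑-indicator-∉ {xs = x ∷ xs} _≟_ a ε a∉ = trans
  (cong₂ _+_ (cong (λ b → if b then ε else 0ℚ) (dec-false (x ≟ a) λ e → a∉ (here (sym e))))
      (∑-indicator-∉ _≟_ a ε (λ a∈ → a∉ (there a∈))))
  (ℚ.+-identityˡ 0ℚ)

∑-indicator-∈ : ∀ {xs : List A} (_≟_ : ∀ (x y : A) → Dec (x ≡ y)) a ε → Unique xs → a ∈ˡ xs →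
                ∑ xs (λ x → if does (x ≟ a) then ε else 0ℚ) ≡ ε
∑-indicator-∈ {xs = x ∷ xs} _≟_ a ε (x∉ ∷ u) (here refl) = trans
  (cong₂ _+_ (cong (λ b → if b then ε else 0ℚ) (dec-true (x ≟ a) refl)) (∑-indicator-∉ _≟_ a ε (All.All¬⇒¬Any x∉)))
  (ℚ.+-identityʳ ε)
∑-indicator-∈ {xs = x ∷ xs} _≟_ a ε (x∉ ∷ u) (there a∈) = trans
  (cong₂ _+_ (cong (λ b → if b then ε else 0ℚ) (dec-false (x ≟ a) λ { refl → All.All¬⇒¬Any x∉ a∈ }))
      (∑-indicator-∈ _≟_ a ε u a∈))
  (ℚ.+-identityˡ ε)

∑-const : ∀ (xs : List A) ε → ∑ xs (λ _ → ε) ≡ ι (length xs) * ε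
∑-const []       ε = sym (trans (cong (_* ε) (ι≡/1 0)) (ℚ.*-zeroˡ ε))
∑-const (x ∷ xs) ε = sym (begin
  ι (suc (length xs)) * ε          ≡⟨ cong (_* ε) (ι-+ 1 (length xs)) ⟩
  (ι 1 + ι (length xs)) * ε        ≡⟨ ℚ.*-distribʳ-+ ε (ι 1) (ι (length xs)) ⟩
  ι 1 * ε + ι (length xs) * ε      ≡⟨ cong₂ _+_ (trans (cong (_* ε) (ι≡/1 1)) (ℚ.*-identityˡ ε)) (sym (∑-const xs ε)) ⟩
  ε + ∑ xs (λ _ → ε)               ∎)
  where open ≡-Reasoning

-- With a constant c, IsIntegral makes all values even.
record Scaling {n} (d : DistanceFunction (Fin n)) : Set where
  field
    scale      : ℕ
    scale≢0    : NonZero scale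
    distance   : Fin n → Fin n → ℕ
    ι-distance : ∀ u w → ι (distance u w) ≡ ι scale * d u w
    integral   : IsIntegral distance (λ _ → false)

module _ {n} (d : DistanceFunction (Fin n)) (metric : IsMetric _≡_ d) where
  open IsMetric metric using (nonNegative; triangle; ≈⇒0) renaming (sym to d-sym)

  scaling : Scaling d
  scaling with common-denominator (map (λ e → d (proj₁ e) (proj₂ e))
      (cartesianProduct (allFin n) (allFin n))) values-nonNeg
    where
    values-nonNeg : ∀ q → q ∈ˡ map (λ e → d (proj₁ e) (proj₂ e)) (cartesianProduct (allFin n) (allFin n)) → 0ℚ ≤ q
    values-nonNeg q q∈ with ∈-map⁻ (λ e → d (proj₁ e) (proj₂ e)) q∈
    ... | e , _ , refl = nonNegative
  ... | K , K≢0 , mult = record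
    -- The factor 2 is for the parity: integral distances alone need not admit a 2-colouring.
    { scale = 2 ℕ.* K ; scale≢0 = ℕ.m*n≢0 2 K {{_}} {{K≢0}} ; distance = w
    ; ι-distance = ι-w
    ; integral = record
      { d-sym = λ u x → ι-injective (trans (ι-w u x) (trans (cong (ι (2 ℕ.* K) *_) (d-sym u x)) (sym (ι-w x u))))
      ; d-self = λ u → ι-injective (trans (ι-w u u)
          (trans (cong (ι (2 ℕ.* K) *_) (≈⇒0 refl)) (trans (ℚ.*-zeroʳ (ι (2 ℕ.* K))) (sym (ι≡/1 0)))))
      ; d-triangle = λ u x z → ι-cancel-≤ (begin
          ι (w u z)                               ≡⟨ ι-w u z ⟩
          ι (2 ℕ.* K) * d u z ≤⟨ ℚ.*-monoˡ-≤-nonNeg (ι (2 ℕ.* K)) {{ℚ.nonNegative (0≤ι (2 ℕ.* K))}}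
              (triangle u x z) ⟩
          ι (2 ℕ.* K) * (d u x + d x z)           ≡⟨ ℚ.*-distribˡ-+ (ι (2 ℕ.* K)) (d u x) (d x z) ⟩
          ι (2 ℕ.* K) * d u x + ι (2 ℕ.* K) * d x z ≡⟨ cong₂ _+_ (ι-w u x) (ι-w x z) ⟨
          ι (w u x) + ι (w x z)                   ≡⟨ ι-+ (w u x) (w x z) ⟨
          ι (w u x ℕ.+ w x z)                     ∎)
      ; d-parity = λ u x → odd-double (half u x) } }
    where
    open ℚ.≤-Reasoning
    pair∈ : ∀ u x → d u x ∈ˡ map (λ e → d (proj₁ e) (proj₂ e)) (cartesianProduct (allFin n) (allFin n))
    pair∈ u x = ∈-map⁺ (λ e → d (proj₁ e) (proj₂ e)) (∈-cartesianProduct⁺ (∈-allFin u) (∈-allFin x))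
    half : Fin n → Fin n → ℕ
    half u x = proj₁ (mult (d u x) (pair∈ u x))
    w : Fin n → Fin n → ℕ
    w u x = 2 ℕ.* half u x
    ι-w : ∀ u x → ι (w u x) ≡ ι (2 ℕ.* K) * d u x
    ι-w u x = trans (ι-* 2 (half u x)) (trans (cong (ι 2 *_) (proj₂ (mult (d u x) (pair∈ u x))))
      (trans (sym (ℚ.*-assoc (ι 2) (ι K) (d u x))) (cong (_* d u x) (sym (ι-* 2 K)))))

  -- Shortcutting turns a T-join into a perfect matching on T at no extra cost. So a cheapest
  -- matching is also a cheapest join, which is what `T-cut-packing` asks for.
  join-bound : ∀ (T : Subset n) L → ends L ∼ elements T → μ d T ≤ cost d L
  join-bound T L L∼ with Metric.matching d metric L
  ... | M , uniq , M∼ , M≤L with perfect-matching d d-sym T M uniq (parity λ χ → trans (at M∼ χ) (at L∼ χ))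
  ...   | E , E∈ , E≡M = ℚ.≤-trans (minimum-≤ (∈-map⁺ (cost d) E∈)) (ℚ.≤-trans (ℚ.≤-reflexive E≡M) M≤L)

  even-join : ∀ (T : Subset n) → odd ∣ T ∣ ≡ false → ∃ λ L → ends L ≡ elements T
  even-join T e = pairUp (elements T) (trans (cong odd (length-elements T)) e)

  -- An even set has a perfect matching, so the default value of `minimum` on the empty list does
  -- not occur.
  μ-attained : ∀ (T : Subset n) → odd ∣ T ∣ ≡ false → ∃ λ E → E ∈ˡ perfectMatchings T × μ d T ≡ cost d E
  μ-attained T e with even-join T e
  ... | L , L≡ with Metric.matching d metric L
  ...   | M , uniq , M∼ , _ with perfect-matching d d-sym T M uniq (parity λ χ → trans (at M∼ χ) (cong (par χ) L≡))
  ...     | E , E∈ , _ = ∈-map⁻ (cost d) (minimum-∈ (∈-map⁺ (cost d) E∈))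

  module _ (r : Fin n) (sc : Scaling d) where
    open Scaling sc

    private
      instance
        scale-nonZero : NonZero scale
        scale-nonZero = scale≢0

      ε : ℚ
      ε = ℤ.+ 1 / scale

      scale*ε : ι scale * ε ≡ 1ℚ
      scale*ε = trans (ι-*-/ 1 scale) (ι≡/1 1)

      0≤ε : 0ℚ ≤ ε
      0≤ε = ℚ.nonNegative⁻¹ ε {{ℚ.normalize-nonNeg 1 scale}}

      unscale : ∀ {m q} → ι m ≡ ι scale * q → ι m * ε ≡ q
      unscale {m} {q} e = begin
        ι m * ε               ≡⟨ cong (_* ε) e ⟩
        (ι scale * q) * ε     ≡⟨ cong (_* ε) (ℚ.*-comm (ι scale) q) ⟩
        (q * ι scale) * ε     ≡⟨ ℚ.*-assoc q (ι scale) ε ⟩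
        q * (ι scale * ε)     ≡⟨ cong (q *_) scale*ε ⟩
        q * 1ℚ                ≡⟨ ℚ.*-identityʳ q ⟩
        q                     ∎
        where open ≡-Reasoning

      ι-total : ∀ L → ι (totalLength distance L) ≡ ι scale * cost d L
      ι-total []            = trans (ι≡/1 0) (sym (ℚ.*-zeroʳ (ι scale)))
      ι-total ((u , w) ∷ L) = trans (ι-+ (distance u w) (totalLength distance L))
        (trans (cong₂ _+_ (ι-distance u w) (ι-total L)) (sym (ℚ.*-distribˡ-+ (ι scale) (d u w) (cost d L))))

      infix 4 _≟ˢ_
      _≟ˢ_ : (S S′ : Subset n) → Dec (S ≡ S′)
      _≟ˢ_ = Vec.≡-dec Bool._≟_

      -- The side of the cut χ that avoids the root.
      side : (Fin n → Bool) → Subset n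
      side χ = Vec.tabulate λ v → χ v xor χ r

      mem-side : ∀ χ v → mem (side χ) v ≡ χ v xor χ r
      mem-side χ = mem-tabulate λ v → χ v xor χ r

      par-const : ∀ {χ : Fin n → Bool} {b} xs → (∀ v → χ v ≡ b) → odd (length xs) ≡ false → par χ xs ≡ false
      par-const []           _ _ = refl
      par-const {χ} {b} (x ∷ y ∷ xs) c e = trans (cong₂ (λ a b → a xor (b xor par χ xs)) (c x) (c y))
        (trans (sym (Bool.xor-assoc b b (par χ xs))) (trans (cong (_xor par χ xs) (Bool.xor-same b))
          (par-const xs c (trans (sym (Bool.not-involutive _)) e))))

      -- A constant `χ` would be even on a set of even size, so some point lies on the other side of
      -- the cut than the root.
      side-cut : ∀ {T χ} → odd ∣ T ∣ ≡ false → par χ (elements T) ≡ true → IsCut ⊤ r (side χ)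
      side-cut {T} {χ} e o = nonempty , λ v∈ → x∈p∧x≢y⇒x∈p-y ∈⊤ λ { refl → root∉ (mem-true v∈) }
        where
        root∉ : mem (side χ) r ≢ true
        root∉ m with trans (sym m) (trans (mem-side χ r) (Bool.xor-same (χ r)))
        ... | ()
        nonempty : Nonempty (side χ)
        nonempty with nonempty? (side χ)
        ... | yes ne = ne
        ... | no empty with trans (sym o) (par-const (elements T)
            (λ v → xor-≡ (trans (sym (mem-side χ v)) (mem-false λ v∈ → empty (v , v∈))))
            (trans (cong odd (length-elements T)) e))
        ...   | ()

      -- Each `χ` contributes ε to its side; a cut that is listed several times, possibly by its two
      -- different sides, collects its multiplicity.
      spread : List (Fin n → Bool) → Packing n
      spread χs S = ∑ χs (λ χ → if does (S ≟ˢ side χ) then ε else 0ℚ)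

      indicator-nonNeg : ∀ b → 0ℚ ≤ (if b then ε else 0ℚ)
      indicator-nonNeg true  = 0≤ε
      indicator-nonNeg false = ℚ.≤-refl

      cuts-unique : Unique (cuts ⊤ r)
      cuts-unique = Unique.filter⁺ (isCut? ⊤ r) (allSubsets-unique n)

      cut∈ : ∀ {S} → IsCut ⊤ r S → S ∈ˡ cuts ⊤ r
      cut∈ {S} = ∈-filter⁺ (isCut? ⊤ r) (∈-allSubsets S)

      spread-total : ∀ χs → All (λ χ → IsCut ⊤ r (side χ)) χs → total ⊤ r (spread χs) ≡ ι (length χs) * ε
      spread-total χs cut = begin
        ∑ (cuts ⊤ r) (λ S → ∑ χs (λ χ → if does (S ≟ˢ side χ) then ε else 0ℚ))
          ≡⟨ ∑-comm (cuts ⊤ r) χs _ ⟩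
        ∑ χs (λ χ → ∑ (cuts ⊤ r) (λ S → if does (S ≟ˢ side χ) then ε else 0ℚ))
          ≡⟨ ∑-cong χs (λ χ χ∈ → ∑-indicator-∈ _≟ˢ_ (side χ) ε cuts-unique (cut∈ (All.lookup cut χ∈))) ⟩
        ∑ χs (λ _ → ε)
          ≡⟨ ∑-const χs ε ⟩
        ι (length χs) * ε ∎
        where open ≡-Reasoning

      ∑-crossings : ∀ (χs : List (Fin n → Bool)) (u w : Fin n) → ∑ χs (λ χ → if χ u xor χ w then ε else 0ℚ)
          ≡ ι (crossings χs u w) * ε
      ∑-crossings []       u w = sym (trans (cong (_* ε) (ι≡/1 0)) (ℚ.*-zeroˡ ε))
      ∑-crossings (χ ∷ χs) u w = sym (trans (cong (_* ε) (ι-+ (bit (χ u xor χ w)) (crossings χs u w)))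
        (trans (ℚ.*-distribʳ-+ ε (ι (bit (χ u xor χ w))) (ι (crossings χs u w)))
          (cong₂ _+_ (bit*ε (χ u xor χ w)) (sym (∑-crossings χs u w)))))
        where
        bit*ε : ∀ b → ι (bit b) * ε ≡ (if b then ε else 0ℚ)
        bit*ε true  = trans (cong (_* ε) (ι≡/1 1)) (ℚ.*-identityˡ ε)
        bit*ε false = trans (cong (_* ε) (ι≡/1 0)) (ℚ.*-zeroˡ ε)

      spread-load : ∀ (χs : List (Fin n → Bool)) (u w : Fin n) → u ≢ w →
        ∑ (filter (crosses? u w) (cuts ⊤ r)) (spread χs) ≤ ι (crossings χs u w) * ε
      spread-load χs u w u≢w = begin
        ∑ crossing-cuts (λ S → ∑ χs (λ χ → if does (S ≟ˢ side χ) then ε else 0ℚ))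
          ≡⟨ ∑-comm crossing-cuts χs _ ⟩
        ∑ χs (λ χ → ∑ crossing-cuts (λ S → if does (S ≟ˢ side χ) then ε else 0ℚ))
          ≤⟨ ∑-mono χs (λ χ _ → load χ) ⟩
        ∑ χs (λ χ → if χ u xor χ w then ε else 0ℚ)
          ≡⟨ ∑-crossings χs u w ⟩
        ι (crossings χs u w) * ε ∎
        where
        open ℚ.≤-Reasoning
        crossing-cuts : List (Subset n)
        crossing-cuts = filter (crosses? u w) (cuts ⊤ r)
        indicator≤ε : ∀ {xs : List (Subset n)} S → Unique xs → ∑ xs (λ S′ → if does (S′ ≟ˢ S) then ε else 0ℚ) ≤ ε
        indicator≤ε {xs} S u with Any.any? (S ≟ˢ_) xs
        ... | yes S∈ = ℚ.≤-reflexive (∑-indicator-∈ _≟ˢ_ S ε u S∈)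
        ... | no S∉  = ℚ.≤-trans (ℚ.≤-reflexive (∑-indicator-∉ _≟ˢ_ S ε S∉)) 0≤ε
        load : ∀ (χ : Fin n → Bool) → ∑ crossing-cuts (λ S → if does (S ≟ˢ side χ) then ε else 0ℚ) ≤
            (if χ u xor χ w then ε else 0ℚ)
        load χ with χ u xor χ w in uw
        ... | true  = indicator≤ε (side χ) (Unique.filter⁺ (crosses? u w) cuts-unique)
        ... | false = ℚ.≤-reflexive (∑-indicator-∉ _≟ˢ_ (side χ) ε λ side∈ →
                        not-crossed (crosses⁻ (side χ) u≢w (proj₂ (∈-filter⁻ (crosses? u w) {xs = cuts ⊤ r} side∈))))
          where
          not-crossed : mem (side χ) u xor mem (side χ) w ≢ true
          not-crossed m with trans (sym m) (trans (cong₂ _xor_ (mem-side χ u) (mem-side χ w))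
            (combine₁ (solve 3 (λ a b c → ((a xor c) xor (b xor c)) xor false := (a xor b) xor false) refl
                (χ u) (χ w) (χ r)) uw))
          ... | ()

    -- At the integral scale a minimum matching is as long as a packing of T-cuts is large. Scaled
    -- back, this packing is a feasible all-cut packing and cannot beat the optimal one. The order
    -- of ℚ is decidable, hence stable, which removes the double negation of `T-cut-packing`.
    μ≤total-scaled : ∀ {y} → IsOptimal d ⊤ r y → ∀ T → odd ∣ T ∣ ≡ false → μ d T ≤ total ⊤ r y
    μ≤total-scaled {y} opt T e with even-join T e | μ-attained T e
    ... | L , L≡ | E , E∈ , μ≡ = decidable-stable (_ ℚ.≤? _) λ ¬le →
      T-cut-packing Fin._≟_ (elements T) L (parity λ χ → cong (par χ) L≡) (totalLength distance E) distance
          (λ _ → false) integral lower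
        λ p → ¬le (packed p)
      where
      open ℚ.≤-Reasoning
      lower : ∀ L → ends L ∼ elements T → totalLength distance E ℕ.≤ totalLength distance L
      lower L L∼ = ι-cancel-≤ (begin
        ι (totalLength distance E)     ≡⟨ ι-total E ⟩
        ι scale * cost d E ≤⟨ ℚ.*-monoˡ-≤-nonNeg (ι scale) {{ℚ.nonNegative (0≤ι scale)}}
            (ℚ.≤-trans (ℚ.≤-reflexive (sym μ≡)) (join-bound T L L∼)) ⟩
        ι scale * cost d L       ≡⟨ ι-total L ⟨
        ι (totalLength distance L)     ∎)
      packed : CutPacking Fin._≟_ (elements T) L (parity λ χ → cong (par χ) L≡) distance
          (totalLength distance E) → μ d T ≤ total ⊤ r y
      packed p = begin
        μ d T                                   ≡⟨ μ≡ ⟩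
        cost d E                                ≡⟨ unscale (ι-total E) ⟨
        ι (totalLength distance E) * ε                ≡⟨ cong (λ m → ι m * ε) size ⟨
        ι (length χs) * ε                       ≡⟨ spread-total χs (All.map side-cut′ T-odd) ⟨
        total ⊤ r (spread χs)              ≤⟨ IsOptimal.optimal opt (spread χs) feasible ⟩
        total ⊤ r y                        ∎
        where
        open CutPacking p renaming (cuts to χs)
        side-cut′ : ∀ {χ} → par χ (elements T) ≡ true → IsCut ⊤ r (side χ)
        side-cut′ = side-cut {T} e
        feasible : IsFeasible d ⊤ r (spread χs)
        feasible = record
          { nonNegative = λ S _ → ∑-nonNeg χs λ χ _ → indicator-nonNeg (does (S ≟ˢ side χ))
          ; capacity = λ u w _ _ u≢w → begin
              ∑ (filter (crosses? u w) (cuts ⊤ r)) (spread χs)  ≤⟨ spread-load χs u w u≢w ⟩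
              ι (crossings χs u w) * ε ≤⟨ ℚ.*-monoʳ-≤-nonNeg ε {{ℚ.nonNegative 0≤ε}}
                  (ι-mono-≤ (capacity u w)) ⟩
              ι (distance u w) * ε                              ≡⟨ unscale (ι-distance u w) ⟩
              d u w                                             ∎ }

  μ≤total : ∀ {r y} → IsOptimal d ⊤ r y → ∀ T → odd ∣ T ∣ ≡ false → μ d T ≤ total ⊤ r y
  μ≤total {r} = μ≤total-scaled r scaling

  -- Apart from the bound for single sets, the total has to be nonnegative because `maximum` is 0 on
  -- the empty list.
  OPT≤total : ∀ {r y k} → IsOptimal d ⊤ r y → odd k ≡ false → OPT d k ≤ total ⊤ r y
  OPT≤total {r} {y} {k} opt e = maximum-≤ _ total-nonNeg bound
    where
    total-nonNeg : 0ℚ ≤ total ⊤ r y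
    total-nonNeg = ∑-nonNeg (cuts ⊤ r) λ S S∈ → IsFeasible.nonNegative (IsOptimal.feasible opt) S
      (proj₂ (∈-filter⁻ (isCut? ⊤ r) {xs = allSubsets n} S∈))
    bound : ∀ x → x ∈ˡ map (μ d) (filter (λ T → ∣ T ∣ ℕ.≟ k) (allSubsets n)) → x ≤ total ⊤ r y
    bound x x∈ with ∈-map⁻ (μ d) x∈
    ... | T , T∈ , refl = μ≤total opt T (trans (cong odd
        (proj₂ (∈-filter⁻ (λ T → ∣ T ∣ ℕ.≟ k) {xs = allSubsets n} T∈))) e)

-- Laminar trees

mutual
  treeLeaves : Tree n → List (Fin n)
  treeLeaves (leaf v)  = v ∷ []
  treeLeaves (node es) = forestLeaves es

  forestLeaves : List (ℚ × Tree n) → List (Fin n)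
  forestLeaves []             = []
  forestLeaves ((_ , t) ∷ es) = treeLeaves t ++ forestLeaves es

-- Weighted sums over the tree edges are evaluated for two functions `g` of the leaves below: the
-- indicator of an odd intersection with T, and the number of rows in which an edge is odd.
module _ (g : List (Fin n) → ℚ) where

  mutual
    treeSum : Tree n → ℚ
    treeSum (leaf _)  = 0ℚ
    treeSum (node es) = forestSum es

    forestSum : List (ℚ × Tree n) → ℚ
    forestSum []             = 0ℚ
    forestSum ((w , t) ∷ es) = (w * g (treeLeaves t) + treeSum t) + forestSum es

  binarySum : BinaryTree n → ℚ
  binarySum b = ∑ (treeEdges b) λ e → proj₁ e * g (leaves (proj₂ e))

  binarySum-node : ∀ w₁ t₁ w₂ t₂ → binarySum (node (w₁ , t₁) (w₂ , t₂)) ≡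
                   (w₁ * g (leaves t₁) + binarySum t₁) + (w₂ * g (leaves t₂) + binarySum t₂)
  binarySum-node w₁ t₁ w₂ t₂ = trans
    (cong (λ s → w₁ * g (leaves t₁) + (w₂ * g (leaves t₂) + s)) (∑-++ (treeEdges t₁) (treeEdges t₂) _))
    (trans (sym (ℚ.+-assoc (w₁ * g (leaves t₁)) (w₂ * g (leaves t₂)) _))
        (+-CS.interchange (w₁ * g (leaves t₁)) (w₂ * g (leaves t₂)) (binarySum t₁) (binarySum t₂)))

forestLeaves-++ : ∀ (es es′ : List (ℚ × Tree n)) → forestLeaves (es ++ es′) ≡ forestLeaves es ++ forestLeaves es′
forestLeaves-++ []             es′ = refl
forestLeaves-++ ((_ , t) ∷ es) es′ = trans (cong (treeLeaves t ++_) (forestLeaves-++ es es′))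
  (sym (++-assoc (treeLeaves t) (forestLeaves es) (forestLeaves es′)))

forestLeaves-↭ : ∀ {es es′ : List (ℚ × Tree n)} → es ↭ es′ → forestLeaves es ↭ forestLeaves es′
forestLeaves-↭ Perm.refl = ↭-refl
forestLeaves-↭ (Perm.prep (_ , t) p) = Perm.++⁺ˡ (treeLeaves t) (forestLeaves-↭ p)
forestLeaves-↭ (Perm.swap (_ , t) (_ , t′) p) = ↭-trans (Perm.shifts (treeLeaves t) (treeLeaves t′))
  (Perm.++⁺ˡ (treeLeaves t′) (Perm.++⁺ˡ (treeLeaves t) (forestLeaves-↭ p)))
forestLeaves-↭ (Perm.trans p q) = ↭-trans (forestLeaves-↭ p) (forestLeaves-↭ q)

mutual
  refines-leaves : ∀ {t : Tree n} {b} → Refines t b → leaves b ↭ treeLeaves t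
  refines-leaves leaf = ↭-refl
  refines-leaves (node {es₁ = es₁} {es₂} p g₁ g₂) = ↭-trans
    (Perm.++⁺ (group-leaves g₁) (group-leaves g₂))
    (↭-trans (↭-reflexive (sym (forestLeaves-++ es₁ es₂))) (forestLeaves-↭ (↭-sym p)))

  group-leaves : ∀ {es : List (ℚ × Tree n)} {e} → RefinesGroup es e → leaves (proj₂ e) ↭ forestLeaves es
  group-leaves (single ref)  = ↭-trans (refines-leaves ref) (↭-reflexive (sym (++-identityʳ _)))
    where open import Data.List.Properties using (++-identityʳ)
  group-leaves (newNode ref) = refines-leaves ref

module _ (g : List (Fin n) → ℚ) (g-↭ : ∀ {xs ys} → xs ↭ ys → g xs ≡ g ys) where

  forestSum-++ : ∀ es es′ → forestSum g (es ++ es′) ≡ forestSum g es + forestSum g es′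
  forestSum-++ []             es′ = sym (ℚ.+-identityˡ _)
  forestSum-++ ((w , t) ∷ es) es′ = trans (cong ((w * g (treeLeaves t) + treeSum g t) +_) (forestSum-++ es es′))
    (sym (ℚ.+-assoc (w * g (treeLeaves t) + treeSum g t) (forestSum g es) (forestSum g es′)))

  forestSum-↭ : ∀ {es es′} → es ↭ es′ → forestSum g es ≡ forestSum g es′
  forestSum-↭ Perm.refl = refl
  forestSum-↭ (Perm.prep (w , t) p) = cong ((w * g (treeLeaves t) + treeSum g t) +_) (forestSum-↭ p)
  forestSum-↭ (Perm.swap {xs} {ys} (w , t) (w′ , t′) p) = trans
    (+-CS.x∙yz≈y∙xz (w * g (treeLeaves t) + treeSum g t) (w′ * g (treeLeaves t′) + treeSum g t′) (forestSum g xs))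
    (cong (λ s → (w′ * g (treeLeaves t′) + treeSum g t′) + ((w * g (treeLeaves t) + treeSum g t) + s)) (forestSum-↭ p))
  forestSum-↭ (Perm.trans p q) = trans (forestSum-↭ p) (forestSum-↭ q)

  mutual
    -- Edges added by the refinement have weight 0, and an old edge keeps its leaves up to order, to
    -- which `g` is insensitive.
    refines-sum : ∀ {t : Tree n} {b} → Refines t b → binarySum g b ≡ treeSum g t
    refines-sum leaf = refl
    refines-sum (node {es₁ = es₁} {es₂} {w₁ , t₁} {w₂ , t₂} p g₁ g₂) = trans (binarySum-node g w₁ t₁ w₂ t₂)
      (trans (cong₂ _+_ (group-sum g₁) (group-sum g₂)) (trans (sym (forestSum-++ es₁ es₂)) (forestSum-↭ (↭-sym p))))

    group-sum : ∀ {es : List (ℚ × Tree n)} {w b} → RefinesGroup es (w , b) → w * g (leaves b) + binarySum g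
        b ≡ forestSum g es
    group-sum (single {w} ref) = trans (cong₂ (λ l s → w * l + s) (g-↭ (refines-leaves ref))
        (refines-sum ref)) (sym (ℚ.+-identityʳ _))
    group-sum (newNode {b = b} ref) = trans (cong₂ _+_ (ℚ.*-zeroˡ (g (leaves b))) (refines-sum ref)) (ℚ.+-identityˡ _)

open Equivalence using (to; from)

∑-support : ∀ {P : A → Set} (P? : ∀ x → Dec (P x)) (xs : List A) f →
            (∀ x → x ∈ˡ xs → ¬ P x → f x ≡ 0ℚ) → ∑ xs f ≡ ∑ (filter P? xs) f
∑-support P? []       f z = refl
∑-support P? (x ∷ xs) f z with P? x
... | yes _ = cong (f x +_) (∑-support P? xs f λ y y∈ → z y (there y∈))
... | no ¬p = trans (cong₂ _+_ (z x (here refl) ¬p) (∑-support P? xs f λ y y∈ → z y (there y∈))) (ℚ.+-identityˡ _)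

⊆⇒≡⊎⊂ : ∀ {n} {p q : Subset n} → p ⊆ q → p ≡ q ⊎ p ⊂ q
⊆⇒≡⊎⊂ {p = p} {q} p⊆q with p ⊂? q | q ⊆? p
... | yes p⊂q | _       = inj₂ p⊂q
... | no _    | yes q⊆p = inj₁ (⊆-antisym p⊆q q⊆p)
... | no p⊄q  | no q⊈p  = ⊥-elim (q⊈p λ {x} x∈q → in-p x∈q (x ∈? p))
  where
  in-p : ∀ {x} → x ∈ q → Dec (x ∈ p) → x ∈ p
  in-p x∈q (yes x∈p) = x∈p
  in-p x∈q (no x∉p)  = ⊥-elim (p⊄q (p⊆q , _ , x∈q , x∉p))

x∈p─q⇒x∉q : ∀ {n} (p q : Subset n) {x} → x ∈ p ─ q → x ∉ q
x∈p─q⇒x∉q (_ ∷ p) (true ∷ q)  (there x∈) (there x∈q) = x∈p─q⇒x∉q p q x∈ x∈q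
x∈p─q⇒x∉q (_ ∷ p) (false ∷ q) (there x∈) (there x∈q) = x∈p─q⇒x∉q p q x∈ x∈q

module Inclusion {n} (r : Fin n) (y : Packing n) (laminar : IsLaminar ⊤ r y) where

  private
    Family : Subset n → Set
    Family = InFamily ⊤ r y

    Parent : Subset n → Subset n → Set
    Parent = IsParent ⊤ r y

  support-nonempty : ∀ {S} → InSupport ⊤ r y S → Nonempty S
  support-nonempty ((ne , _) , _) = ne

  family-nonempty : ∀ {S} → Family S → Nonempty S
  family-nonempty (inj₁ s)                        = support-nonempty s
  family-nonempty (inj₂ (inj₁ refl))              = r , ∈⊤
  family-nonempty (inj₂ (inj₂ (v , _ , refl)))    = v , x∈⁅x⁆ v

  singleton-family : ∀ v → Family ⁅ v ⁆
  singleton-family v = inj₂ (inj₂ (v , ∈⊤ , refl))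

  singleton-⊆ : ∀ {v} {S : Subset n} → v ∈ S → ⁅ v ⁆ ⊆ S
  singleton-⊆ {v} v∈ x∈ with x∈⁅y⁆⇒x≡y v x∈
  ... | refl = v∈

  Compatible : Subset n → Subset n → Set
  Compatible S S′ = Empty (S ∩ S′) ⊎ S ⊆ S′ ⊎ S′ ⊆ S

  singleton-compatible : ∀ v S → Compatible ⁅ v ⁆ S
  singleton-compatible v S with v ∈? S
  ... | yes v∈ = inj₂ (inj₁ (singleton-⊆ v∈))
  ... | no v∉  = inj₁ λ (x , x∈) → v∉ (in-S (x∈p∩q⁻ ⁅ v ⁆ S x∈))
    where
    in-S : ∀ {x} → x ∈ ⁅ v ⁆ × x ∈ S → v ∈ S
    in-S (x∈₁ , x∈₂) with x∈⁅y⁆⇒x≡y v x∈₁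
    ... | refl = x∈₂

  compatible-sym : ∀ {S S′} → Compatible S S′ → Compatible S′ S
  compatible-sym {S} {S′} (inj₁ e) = inj₁ λ (x , x∈) → e
      (x , x∈p∩q⁺ (proj₂ (x∈p∩q⁻ S′ S x∈) , proj₁ (x∈p∩q⁻ S′ S x∈)))
  compatible-sym (inj₂ (inj₁ s)) = inj₂ (inj₂ s)
  compatible-sym (inj₂ (inj₂ s)) = inj₂ (inj₁ s)

  family-compatible : ∀ {S S′} → Family S → Family S′ → Compatible S S′
  family-compatible (inj₁ s) (inj₁ s′)                   = laminar _ _ s s′
  family-compatible (inj₂ (inj₁ refl)) _                 = inj₂ (inj₂ ⊆⊤)
  family-compatible (inj₂ (inj₂ (v , _ , refl))) _       = singleton-compatible v _
  family-compatible (inj₁ _) (inj₂ (inj₁ refl))          = inj₂ (inj₁ ⊆⊤)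
  family-compatible (inj₁ _) (inj₂ (inj₂ (v , _ , refl))) = compatible-sym (singleton-compatible v _)

  family? : ∀ S → Dec (Family S)
  family? S = inSupport? ⊤ r y S ⊎-dec ((Vec.≡-dec Bool._≟_ S ⊤) ⊎-dec
    Fin.any? (λ v → (v ∈? ⊤) ×-dec Vec.≡-dec Bool._≟_ S ⁅ v ⁆))

  -- Two members that contain `U` meet, so by laminarity they are comparable. If none lies strictly
  -- between `U` and `S`, then `S` is contained in all members strictly above `U`.
  parent-of-maximal : ∀ {S U} → Family S → Family U → U ⊂ S → (∀ W → Family W → U ⊂ W → ¬ W ⊂ S) → Parent S U
  parent-of-maximal {S} {U} fS fU U⊂S max = record
    { parent∈family = fS ; child∈family = fU ; child⊂parent = U⊂S ; smallest = smallest }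
    where
    smallest : ∀ W → Family W → U ⊂ W → S ⊆ W
    smallest W fW U⊂W with family-compatible fS fW | family-nonempty fU
    ... | inj₁ empty       | x , x∈ = ⊥-elim (empty (x , x∈p∩q⁺ (proj₁ U⊂S x∈ , proj₁ U⊂W x∈)))
    ... | inj₂ (inj₁ S⊆W)  | _      = S⊆W
    ... | inj₂ (inj₂ W⊆S)  | _ with ⊆⇒≡⊎⊂ W⊆S
    ...   | inj₁ refl = λ z → z
    ...   | inj₂ W⊂S  = ⊥-elim (max W fW U⊂W W⊂S)

  -- Climbs from `U` through members strictly inside `S` until none is left; `k` bounds the
  -- difference of the sizes, which shrinks at every step.
  child-above : ∀ k {S U} → Family S → Family U → U ⊂ S → ∣ S ∣ ℕ.≤ k ℕ.+ ∣ U ∣ → ∃ λ C → Parent S C × U ⊆ C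
  child-above zero    fS fU U⊂S le = ⊥-elim (ℕ.<⇒≱ (p⊂q⇒∣p∣<∣q∣ U⊂S) le)
  child-above (suc k) {S} {U} fS fU U⊂S le
    with Any.any? (λ W → family? W ×-dec (U ⊂? W) ×-dec (W ⊂? S)) (allSubsets n)
  ... | no none = U , parent-of-maximal fS fU U⊂S (λ W fW U⊂W W⊂S →
          none (Any.map (λ { refl → fW , U⊂W , W⊂S }) (∈-allSubsets W))) , λ z → z
  ... | yes some with Any.satisfied some
  ...   | W , fW , U⊂W , W⊂S with child-above k fS fW W⊂S
              (ℕ.≤-trans le (ℕ.≤-trans (ℕ.≤-reflexive (sym (ℕ.+-suc k ∣ U ∣))) (ℕ.+-monoʳ-≤ k (p⊂q⇒∣p∣<∣q∣ U⊂W))))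
  ...     | C , pC , W⊆C = C , pC , λ x∈ → W⊆C (proj₁ U⊂W x∈)

  siblings-disjoint : ∀ {S C C′} → Parent S C → Parent S C′ → C ≢ C′ → Empty (C ∩ C′)
  siblings-disjoint {S} {C} {C′} p p′ C≢ with family-compatible (IsParent.child∈family p) (IsParent.child∈family p′)
  ... | inj₁ empty = empty
  ... | inj₂ (inj₁ C⊆) with ⊆⇒≡⊎⊂ C⊆
  ...   | inj₁ eq  = ⊥-elim (C≢ eq)
  ... | inj₂ C⊂ = ⊥-elim (⊂-irref refl (⊂-⊆-trans (IsParent.child⊂parent p′)
      (IsParent.smallest p C′ (IsParent.child∈family p′) C⊂)))
  siblings-disjoint {S} {C} {C′} p p′ C≢ | inj₂ (inj₂ C′⊆) with ⊆⇒≡⊎⊂ C′⊆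
  ...   | inj₁ eq  = ⊥-elim (C≢ (sym eq))
  ... | inj₂ C′⊂ = ⊥-elim (⊂-irref refl (⊂-⊆-trans (IsParent.child⊂parent p)
      (IsParent.smallest p′ C (IsParent.child∈family p) C′⊂)))

  module _ (g : List (Fin n) → ℚ) (g-↭ : ∀ {xs ys} → xs ↭ ys → g xs ≡ g ys) where

    term : Subset n → ℚ
    term U = edgeWeight ⊤ r y U * g (elements U)

    -- The list `members` reindexes the edges below `S` by sets: the tree sum becomes a sum over all
    -- family members strictly inside `S`, each occurring once.
    record Below (S : Subset n) (t : Tree n) : Set where
      field
        leaves↭      : treeLeaves t ↭ elements S
        members      : List (Subset n)
        unique       : Unique members
        ∈-members    : ∀ U → U ∈ˡ members ⇔ (Family U × U ⊂ S)
        sum≡         : treeSum g t ≡ ∑ members term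

    record BelowAll (Cs : List (Subset n)) (es : List (ℚ × Tree n)) : Set where
      field
        leaves-unique : Unique (forestLeaves es)
        ∈-leaves      : ∀ v → v ∈ˡ forestLeaves es ⇔ (∃ λ C → C ∈ˡ Cs × v ∈ C)
        members       : List (Subset n)
        unique        : Unique members
        ∈-members     : ∀ U → U ∈ˡ members ⇔ (Family U × ∃ λ C → C ∈ˡ Cs × U ⊆ C)
        sum≡          : forestSum g es ≡ ∑ members term

    below-leaf : ∀ v → Below ⁅ v ⁆ (leaf v)
    below-leaf v = record
      { leaves↭ = unique-↭ ([] ∷ []) (elements-unique ⁅ v ⁆) λ x → mk⇔
          (λ { (here refl) → ∈-elements⁺ (x∈⁅x⁆ v) })
          (λ x∈ → here (x∈⁅y⁆⇒x≡y v (∈-elements⁻ x∈)))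
      ; members = [] ; unique = []
      ; ∈-members = λ U → mk⇔ (λ ()) (λ (fU , U⊂) → ⊥-elim (nothing-below fU U⊂))
      ; sum≡ = refl }
      where
      nothing-below : ∀ {U} → Family U → ¬ U ⊂ ⁅ v ⁆
      nothing-below fU (U⊆ , x , x∈ , x∉) with family-nonempty fU
      ... | z , z∈ with x∈⁅y⁆⇒x≡y v (U⊆ z∈) | x∈⁅y⁆⇒x≡y v x∈
      ...   | refl | refl = x∉ z∈

    below-cons : ∀ {C t Cs es} → Family C → All (λ C′ → Empty (C ∩ C′)) Cs →
                 Below C t → BelowAll Cs es → BelowAll (C ∷ Cs) ((edgeWeight ⊤ r y C , t) ∷ es)
    below-cons {C} {t} {Cs} {es} fC disjoint b bs = record
      { leaves-unique = Unique.++⁺ (Unique-↭ (↭-sym B.leaves↭) (elements-unique C)) Bs.leaves-unique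
          λ (v∈ , v∈′) → apart (in-C v∈) (to (Bs.∈-leaves _) v∈′)
      ; ∈-leaves = λ v → mk⇔
          (λ v∈ → split-leaf v (∈-++⁻ (treeLeaves t) v∈))
          (λ { (_ , here refl , v∈) → ∈-++⁺ˡ (Perm.∈-resp-↭ (↭-sym B.leaves↭) (∈-elements⁺ v∈))
             ; (C′ , there C′∈ , v∈) → ∈-++⁺ʳ (treeLeaves t) (from (Bs.∈-leaves v) (C′ , C′∈ , v∈)) })
      ; members = C ∷ B.members ++ Bs.members
      ; unique = All.¬Any⇒All¬ _ C∉ ∷ Unique.++⁺ B.unique Bs.unique
          λ (U∈ , U∈′) → apart-sets (proj₁ (proj₂ (to (B.∈-members _) U∈))) (to (Bs.∈-members _) U∈′)
      ; ∈-members = λ U → mk⇔ (split-member U) (join-member U)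
      ; sum≡ = begin
          (edgeWeight ⊤ r y C * g (treeLeaves t) + treeSum g t) + forestSum g es
            ≡⟨ cong₂ _+_ (cong₂ _+_ (cong (edgeWeight ⊤ r y C *_) (g-↭ B.leaves↭)) B.sum≡) Bs.sum≡ ⟩
          (term C + ∑ B.members term) + ∑ Bs.members term
            ≡⟨ ℚ.+-assoc (term C) (∑ B.members term) (∑ Bs.members term) ⟩
          term C + (∑ B.members term + ∑ Bs.members term)
            ≡⟨ cong (term C +_) (∑-++ B.members Bs.members term) ⟨
          term C + ∑ (B.members ++ Bs.members) term ∎ }
      where
      open ≡-Reasoning
      module B = Below b
      module Bs = BelowAll bs
      in-C : ∀ {v} → v ∈ˡ treeLeaves t → v ∈ C
      in-C v∈ = ∈-elements⁻ (Perm.∈-resp-↭ B.leaves↭ v∈)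
      apart : ∀ {v} → v ∈ C → ¬ (∃ λ C′ → C′ ∈ˡ Cs × v ∈ C′)
      apart v∈ (C′ , C′∈ , v∈′) = All.lookup disjoint C′∈ (_ , x∈p∩q⁺ (v∈ , v∈′))
      apart-sets : ∀ {U} → U ⊆ C → ¬ (Family U × ∃ λ C′ → C′ ∈ˡ Cs × U ⊆ C′)
      apart-sets U⊆ (fU , C′ , C′∈ , U⊆′) with family-nonempty fU
      ... | x , x∈ = apart (U⊆ x∈) (C′ , C′∈ , U⊆′ x∈)
      split-leaf : ∀ v → v ∈ˡ treeLeaves t ⊎ v ∈ˡ forestLeaves es → ∃ λ C′ → C′ ∈ˡ C ∷ Cs × v ∈ C′
      split-leaf v (inj₁ v∈) = C , here refl , in-C v∈
      split-leaf v (inj₂ v∈) with to (Bs.∈-leaves v) v∈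
      ... | C′ , C′∈ , v∈′ = C′ , there C′∈ , v∈′
      C∉ : C ∉ˡ B.members ++ Bs.members
      C∉ C∈ with ∈-++⁻ B.members C∈
      ... | inj₁ C∈′ = ⊂-irref refl (proj₂ (to (B.∈-members C) C∈′))
      ... | inj₂ C∈′ = apart-sets (λ z → z) (to (Bs.∈-members C) C∈′)
      split-member : ∀ U → U ∈ˡ C ∷ B.members ++ Bs.members → Family U × ∃ λ C′ → C′ ∈ˡ C ∷ Cs × U ⊆ C′
      split-member U (here refl) = fC , C , here refl , λ z → z
      split-member U (there U∈) with ∈-++⁻ B.members U∈
      ... | inj₁ U∈′ with to (B.∈-members U) U∈′
      ...   | fU , U⊂ = fU , C , here refl , proj₁ U⊂
      split-member U (there U∈) | inj₂ U∈′ with to (Bs.∈-members U) U∈′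
      ...   | fU , C′ , C′∈ , U⊆ = fU , C′ , there C′∈ , U⊆
      join-member : ∀ U → (Family U × ∃ λ C′ → C′ ∈ˡ C ∷ Cs × U ⊆ C′) → U ∈ˡ C ∷ B.members ++ Bs.members
      join-member U (fU , C′ , there C′∈ , U⊆) = there (∈-++⁺ʳ B.members (from (Bs.∈-members U) (fU , C′ , C′∈ , U⊆)))
      join-member U (fU , C′ , here refl , U⊆) with ⊆⇒≡⊎⊂ U⊆
      ... | inj₁ refl = here refl
      ... | inj₂ U⊂   = there (∈-++⁺ˡ (from (B.∈-members U) (fU , U⊂)))

    below-node : ∀ {S Cs es} → Family S → (∀ v → S ≢ ⁅ v ⁆) → (∀ C → C ∈ˡ Cs ⇔ Parent S C) →
                 BelowAll Cs es → Below S (node es)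
    below-node {S} {Cs} {es} fS S≢ Cs⇔ bs = record
      { leaves↭ = unique-↭ Bs.leaves-unique (elements-unique S) λ v → mk⇔
          (λ v∈ → ∈-elements⁺ (leaf-in-S (to (Bs.∈-leaves v) v∈)))
          (λ v∈ → from (Bs.∈-leaves v) (leaf-in-child (∈-elements⁻ v∈)))
      ; members = Bs.members
      ; unique = Bs.unique
      ; ∈-members = λ U → mk⇔
          (λ U∈ → strictly-below (to (Bs.∈-members U) U∈))
          (λ (fU , U⊂) → from (Bs.∈-members U) (fU , child fU U⊂))
      ; sum≡ = Bs.sum≡ }
      where
      module Bs = BelowAll bs
      strictly-below : ∀ {U} → (Family U × ∃ λ C → C ∈ˡ Cs × U ⊆ C) → Family U × U ⊂ S
      strictly-below (fU , C , C∈ , U⊆) = fU , ⊆-⊂-trans U⊆ (IsParent.child⊂parent (to (Cs⇔ C) C∈))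
      child : ∀ {U} → Family U → U ⊂ S → ∃ λ C → C ∈ˡ Cs × U ⊆ C
      child fU U⊂ with child-above ∣ S ∣ fS fU U⊂ (ℕ.m≤m+n ∣ S ∣ _)
      ... | C , pC , U⊆ = C , from (Cs⇔ C) pC , U⊆
      leaf-in-S : ∀ {v} → (∃ λ C → C ∈ˡ Cs × v ∈ C) → v ∈ S
      leaf-in-S (C , C∈ , v∈) = proj₁ (IsParent.child⊂parent (to (Cs⇔ C) C∈)) v∈
      leaf-in-child : ∀ {v} → v ∈ S → ∃ λ C → C ∈ˡ Cs × v ∈ C
      leaf-in-child {v} v∈ with ⊆⇒≡⊎⊂ (singleton-⊆ v∈)
      ... | inj₁ eq = ⊥-elim (S≢ v (sym eq))
      ... | inj₂ v⊂ with child (singleton-family v) v⊂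
      ...   | C , C∈ , v⊆ = C , C∈ , v⊆ (x∈⁅x⁆ v)

    mutual
      below : ∀ {S t} → IsInclusionTree ⊤ r y S t → Below S t
      below (leaf {v} _) = below-leaf v
      below (node {S} {Cs} fS S≢ uniq Cs⇔ ts) = below-node fS S≢ Cs⇔
        (below-all (λ C∈ → to (Cs⇔ _) C∈) uniq ts)

      below-all : ∀ {S Cs es} → (∀ {C} → C ∈ˡ Cs → Parent S C) → Unique Cs →
        Pointwise (λ S′ e → proj₁ e ≡ edgeWeight ⊤ r y S′ × IsInclusionTree ⊤ r y S′ (proj₂ e)) Cs es → BelowAll Cs es
      below-all _ _ [] = record
        { leaves-unique = [] ; ∈-leaves = λ v → mk⇔ (λ ()) (λ { (_ , () , _) })
        ; members = [] ; unique = [] ; ∈-members = λ U → mk⇔ (λ ()) (λ { (_ , _ , () , _) }) ; sum≡ = refl }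
      below-all {S} {C ∷ Cs} par (C∉ ∷ uniq) (_∷_ {y = _ , t} {ys = es} (refl , tr) ts) = below-cons
          (IsParent.child∈family (par (here refl)))
        (All.tabulate λ C′∈ → siblings-disjoint (par (here refl)) (par (there C′∈)) (All.lookup C∉ C′∈))
        (below tr) (below-all (λ C∈ → par (there C∈)) uniq ts)

    module _ {d : DistanceFunction (Fin n)} (feasible : IsFeasible d ⊤ r y) where

      private
        off-support : ∀ S → ¬ InSupport ⊤ r y S → term S ≡ 0ℚ
        off-support S ¬s = trans
          (cong (λ b → (if b then y S else 0ℚ) * g (elements S)) (dec-false (inSupport? ⊤ r y S) ¬s))
          (ℚ.*-zeroˡ (g (elements S)))

        on-cut : ∀ S → IsCut ⊤ r S → edgeWeight ⊤ r y S ≡ y S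
        on-cut S cut = value (inSupport? ⊤ r y S)
          where
          value : (s? : Dec (InSupport ⊤ r y S)) → (if does s? then y S else 0ℚ) ≡ y S
          value (yes _) = refl
          value (no ¬s) = ℚ.≤-antisym (IsFeasible.nonNegative feasible S cut) (ℚ.≮⇒≥ λ pos → ¬s (cut , pos))

      -- The left side runs over the family, which also contains singletons of weight 0, the right
      -- side over all cuts. Terms off the support vanish on both sides, and each index set contains
      -- the whole support.
      treeSum≡∑cuts : ∀ {t} → IsInclusionTree ⊤ r y ⊤ t → treeSum g t ≡ ∑ (cuts ⊤ r) (λ S → y S * g (elements S))
      treeSum≡∑cuts {t} tr = begin
        treeSum g t                                       ≡⟨ B.sum≡ ⟩
        ∑ B.members term ≡⟨ ∑-support (inSupport? ⊤ r y) B.members term (λ S _ → off-support S) ⟩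
        ∑ (filter (inSupport? ⊤ r y) B.members) term      ≡⟨ ∑-↭ term same-support ⟩
        ∑ (filter (inSupport? ⊤ r y) (cuts ⊤ r)) term ≡⟨ ∑-support (inSupport? ⊤ r y) (cuts ⊤ r) term
            (λ S _ → off-support S) ⟨
        ∑ (cuts ⊤ r) term ≡⟨ ∑-cong (cuts ⊤ r) (λ S S∈ → cong (_* g (elements S)) (on-cut S (cut S∈))) ⟩
        ∑ (cuts ⊤ r) (λ S → y S * g (elements S))         ∎
        where
        open ≡-Reasoning
        module B = Below (below tr)
        cut : ∀ {S} → S ∈ˡ cuts ⊤ r → IsCut ⊤ r S
        cut S∈ = proj₂ (∈-filter⁻ (isCut? ⊤ r) {xs = allSubsets n} S∈)
        support⊂⊤ : ∀ {S} → InSupport ⊤ r y S → S ⊂ ⊤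
        support⊂⊤ ((_ , S⊆) , _) = ⊆⊤ , r , ∈⊤ , λ r∈ → x∈p─q⇒x∉q ⊤ ⁅ r ⁆ (S⊆ r∈) (x∈⁅x⁆ r)
        same-support : filter (inSupport? ⊤ r y) B.members ↭ filter (inSupport? ⊤ r y) (cuts ⊤ r)
        same-support = unique-↭ (Unique.filter⁺ _ B.unique)
            (Unique.filter⁺ _ (Unique.filter⁺ _ (allSubsets-unique n))) λ S → mk⇔
          (λ S∈ → on-right (proj₂ (∈-filter⁻ (inSupport? ⊤ r y) {xs = B.members} S∈)))
          (λ S∈ → on-left (proj₂ (∈-filter⁻ (inSupport? ⊤ r y) {xs = cuts ⊤ r} S∈)))
          where
          on-right : ∀ {S} → InSupport ⊤ r y S → S ∈ˡ filter (inSupport? ⊤ r y) (cuts ⊤ r)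
          on-right {S} s = ∈-filter⁺ (inSupport? ⊤ r y) (∈-filter⁺ (isCut? ⊤ r) (∈-allSubsets S) (proj₁ s)) s
          on-left : ∀ {S} → InSupport ⊤ r y S → S ∈ˡ filter (inSupport? ⊤ r y) B.members
          on-left {S} s = ∈-filter⁺ (inSupport? ⊤ r y) (from (B.∈-members S) (inj₁ s , support⊂⊤ s)) s

      refined-sum≡∑cuts : ∀ {t b} → IsInclusionTree ⊤ r y ⊤ t → Refines t b →
                          binarySum g b ≡ ∑ (cuts ⊤ r) (λ S → y S * g (elements S))
      refined-sum≡∑cuts tr ref = trans (refines-sum g g-↭ ref) (treeSum≡∑cuts tr)

  refined-leaves : ∀ {t b} → IsInclusionTree ⊤ r y ⊤ t → Refines t b → leaves b ↭ elements ⊤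
  refined-leaves tr ref = ↭-trans (refines-leaves ref) (Below.leaves↭ (below (λ _ → 0ℚ) (λ _ → refl) tr))

-- Selections of leaves

sumOf-++ : ∀ (c : X → ℕ) xs ys → sumOf c (xs ++ ys) ≡ sumOf c xs ℕ.+ sumOf c ys
sumOf-++ c []       ys = refl
sumOf-++ c (x ∷ xs) ys = trans (cong (c x ℕ.+_) (sumOf-++ c xs ys)) (sym (ℕ.+-assoc (c x) _ _))

sumOf-↭ : ∀ (c : X → ℕ) {xs ys} → xs ↭ ys → sumOf c xs ≡ sumOf c ys
sumOf-↭ c Perm.refl = refl
sumOf-↭ c (Perm.prep x p) = cong (c x ℕ.+_) (sumOf-↭ c p)
sumOf-↭ c (Perm.swap {xs} {ys} x y p) = trans (ℕ-swap (c x) (c y) (sumOf c xs))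
    (cong (λ s → c y ℕ.+ (c x ℕ.+ s)) (sumOf-↭ c p))
sumOf-↭ c (Perm.trans p q) = trans (sumOf-↭ c p) (sumOf-↭ c q)

sumOf-const : ∀ (c : X → ℕ) {v xs} → All (λ x → c x ≡ v) xs → sumOf c xs ≡ length xs ℕ.* v
sumOf-const c []       = refl
sumOf-const c (e ∷ es) = cong₂ ℕ._+_ e (sumOf-const c es)

sumOf-⊞ : ∀ (c₁ : X → ℕ) (c₂ : Y → ℕ) zs → sumOf (c₁ ⊞ c₂) zs ≡ sumOf c₁ (map proj₁ zs) ℕ.+ sumOf c₂ (map proj₂ zs)
sumOf-⊞ c₁ c₂ []             = refl
sumOf-⊞ c₁ c₂ ((x , y) ∷ zs) = trans (cong (c₁ x ℕ.+ c₂ y ℕ.+_) (sumOf-⊞ c₁ c₂ zs))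
  (interchange (c₁ x) (c₂ y) (sumOf c₁ (map proj₁ zs)) (sumOf c₂ (map proj₂ zs)))
  where
  interchange : ∀ a b c d → (a ℕ.+ b) ℕ.+ (c ℕ.+ d) ≡ (a ℕ.+ c) ℕ.+ (b ℕ.+ d)
  interchange = solve-∀

size : BinaryTree n → ℕ
size t = length (leaves t)

Selection : BinaryTree n → Set
Selection (leaf _)                 = Bool
Selection (node (_ , t₁) (_ , t₂)) = Selection t₁ × Selection t₂

count : (t : BinaryTree n) → Selection t → ℕ
count (leaf _)                 b = bit b
count (node (_ , t₁) (_ , t₂))   = count t₁ ⊞ count t₂

indicator : Bool → ℚ
indicator b = if b then 1ℚ else 0ℚ

mutual
  -- The weight of the odd edges of a row, computed from the row below each node alone so that it
  -- can be summed bottom-up.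
  gain : (t : BinaryTree n) → Selection t → ℚ
  gain (leaf _)     _         = 0ℚ
  gain (node (w₁ , t₁) (w₂ , t₂)) (s₁ , s₂) = edgeGain w₁ t₁ s₁ + edgeGain w₂ t₂ s₂

  edgeGain : ℚ → (t : BinaryTree n) → Selection t → ℚ
  edgeGain w t s = w * indicator (odd (count t s)) + gain t s

indicators-const : ∀ (c : X → ℕ) {v xs} → All (λ x → c x ≡ v) xs →
                   ∑ xs (λ x → indicator (odd (c x))) ≡ ι (if odd v then length xs else 0)
indicators-const c {v} {xs} es = trans (∑-cong xs λ x x∈ → cong (λ m → indicator (odd m))
    (All.lookup es x∈)) (const (odd v) xs)
  where
  const : ∀ b xs → ∑ xs (λ _ → indicator b) ≡ ι (if b then length xs else 0)
  const true  xs = trans (∑-const xs 1ℚ) (ℚ.*-identityʳ _)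
  const false xs = trans (∑-0 xs) (sym (ι≡/1 0))

odd-rows : ∀ {c : X → ℕ} {O E xs} → Window c O E xs → ∑ xs (λ x → indicator (odd (c x))) ≡ ι O
odd-rows {c = c} {O} {xs = xs} w = trans (sym (∑-↭ ind perm)) (trans (∑-++ low (mid ++ high) ind)
  (trans (cong (∑ low ind +_) (∑-++ mid high ind))
  (trans (cong₂ _+_ (indicators-const c low≡) (cong₂ _+_ (indicators-const c mid≡) (indicators-const c high≡)))
    (odd-count parities))))
  where
  open Window w
  open Rows rows
  ind : _ → ℚ
  ind x = indicator (odd (c x))
  odd-count : (odd base ≡ true × l ℕ.+ h ≡ O × m ≡ _) ⊎ (odd base ≡ false × m ≡ O × l ℕ.+ h ≡ _) →
    ι (if odd base then length low else 0) + (ι (if not (odd base) then length mid else 0) + ι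
        (if not (not (odd base)) then length high else 0)) ≡ ι O
  odd-count (inj₁ (b , lh , _)) rewrite b | low-length | high-length = trans
      (cong (ι l +_) (trans (cong (_+ ι h) (ι≡/1 0)) (ℚ.+-identityˡ (ι h))))
      (trans (sym (ι-+ l h)) (cong ι lh))
  odd-count (inj₂ (b , m≡ , _)) rewrite b | mid-length = trans
      (cong₂ _+_ (ι≡/1 0) (trans (cong (ι m +_) (ι≡/1 0)) (ℚ.+-identityʳ (ι m))))
      (trans (ℚ.+-identityˡ (ι m)) (cong ι m≡))

-- Here `k` is half the cardinality that the rows have at the root, and `2 * l` bounds from below
-- the number of rows in which an edge is odd.
module TreeRows {n k l : ℕ} (l≤k : l ℕ.≤ k) (lkk : l ℕ.+ k ℕ.+ k ℕ.≤ n) where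
  open Clip {n} l≤k lkk

  half : ℕ → ℕ
  half s = clip (φ n s)

  k+k≤n : k ℕ.+ k ℕ.≤ n
  k+k≤n = ℕ.≤-trans (ℕ.m≤n+m (k ℕ.+ k) l) (ℕ.≤-trans (ℕ.≤-reflexive (sym (ℕ.+-assoc l k k))) lkk)

  -- The rows are n selections of leaves below the root of t; in 2 * half s of
  -- them the edge above a subtree with s leaves is odd.
  record Family {N} (t : BinaryTree N) (O E : ℕ) : Set where
    field
      rows   : List (Selection t)
      window : Window (count t) O E rows
      counts : sumOf (count t) rows ≡ 2 ℕ.* k ℕ.* size t
      gains  : ∑ rows (gain t) ≡ binarySum (λ xs → ι (2 ℕ.* half (length xs))) t

  -- The leaf is selected in `2 * k` of the n rows. As this holds for all leaves, the average count
  -- at the root will be `2 * k`.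
  family-leaf : ∀ {N} (v : Fin N) → ∃ λ E → 2 ℕ.* half 1 ℕ.+ E ≡ n × Family (leaf v) (2 ℕ.* half 1) E
  family-leaf v with ≤⇒∃+ k+k≤n
  ... | E , refl = E , (trans (cong (λ x → 2 ℕ.* x ℕ.+ E) half1)
      (cong (λ x → k ℕ.+ x ℕ.+ E) (ℕ.+-identityʳ k))) , record
    { rows = replicate E false ++ replicate (2 ℕ.* k) true
    ; window = record
      { rows = record
        { low = replicate E false ; mid = replicate (2 ℕ.* k) true ; high = []
        ; perm = ↭-reflexive (cong (replicate E false ++_) (++-identityʳ _))
        ; low≡ = All.replicate⁺ E refl ; mid≡ = All.replicate⁺ (2 ℕ.* k) refl ; high≡ = []
        ; low-length = refl ; mid-length = refl ; high-length = refl }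
      ; parities = inj₂ (refl , trans (length-replicate (2 ℕ.* k)) (cong (2 ℕ.*_) (sym half1)) , trans
          (ℕ.+-identityʳ _) (length-replicate E)) }
    ; counts = trans (sumOf-++ bit (replicate E false) (replicate (2 ℕ.* k) true))
        (cong₂ ℕ._+_ (trans (sumOf-const bit {0} {replicate E false} (All.replicate⁺ E refl))
            (ℕ.*-zeroʳ (length (replicate E false))))
          (trans (sumOf-const bit {1} {replicate (2 ℕ.* k) true} (All.replicate⁺ (2 ℕ.* k) refl))
              (cong (ℕ._* 1) (length-replicate (2 ℕ.* k)))))
    ; gains = ∑-0 (replicate E false ++ replicate (2 ℕ.* k) true) }
    where
    half1 : half 1 ≡ k
    half1 = clip-k (≤φ-1 {n} {k} k+k≤n)

  edge-gains : ∀ {N} {t : BinaryTree N} {E} w (F : Family t (2 ℕ.* half (size t)) E) →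
    ∑ (Family.rows F) (edgeGain w t) ≡ w * ι (2 ℕ.* half (size t)) + binarySum (λ xs → ι (2 ℕ.* half (length xs))) t
  edge-gains {t = t} w F = trans (∑-+ rows (λ s → w * indicator (odd (count t s))) (gain t))
    (cong₂ _+_ (trans (∑-*ˡ rows w (λ s → indicator (odd (count t s)))) (cong (w *_) (odd-rows window))) gains)
    where open Family F

  -- The value `c` at the new node is left open: inner nodes use the clipped `φ`, the root uses 0.
  family-node : ∀ {N} {w₁ w₂ : ℚ} {t₁ t₂ : BinaryTree N} {E₁ E₂ c} → Split n (half (size t₁)) (half (size t₂)) c →
    2 ℕ.* half (size t₁) ℕ.+ E₁ ≡ n → 2 ℕ.* half (size t₂) ℕ.+ E₂ ≡ n →
    Family t₁ (2 ℕ.* half (size t₁)) E₁ → Family t₂ (2 ℕ.* half (size t₂)) E₂ →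
    ∃ λ E → 2 ℕ.* c ℕ.+ E ≡ n × Family (node (w₁ , t₁) (w₂ , t₂)) (2 ℕ.* c) E
  family-node {w₁ = w₁} {w₂} {t₁} {t₂} {E₁} {E₂} {c} sp e₁ e₂ F₁ F₂ = build
      (combine-windows Oo Oe Eo Ee window₁ window₂)
    where
    open Split sp
    module F₁ = Family F₁
    module F₂ = Family F₂
    E₁≡ : E₁ ≡ Eo ℕ.+ Ee
    E₁≡ = ℕ.+-cancelˡ-≡ (2 ℕ.* half (size t₁)) _ _ (trans e₁ (trans (sym all) (cong (ℕ._+ (Eo ℕ.+ Ee)) first)))
    E₂≡ : E₂ ≡ Oe ℕ.+ Ee
    E₂≡ = ℕ.+-cancelˡ-≡ (2 ℕ.* half (size t₂)) _ _ (trans e₂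
        (trans (sym all) (trans (rearrange Oo Oe Eo Ee) (cong (ℕ._+ (Oe ℕ.+ Ee)) second))))
      where
      rearrange : ∀ a b c d → a ℕ.+ b ℕ.+ (c ℕ.+ d) ≡ a ℕ.+ c ℕ.+ (b ℕ.+ d)
      rearrange = solve-∀
    window₁ : Window (count t₁) (Oo ℕ.+ Oe) (Eo ℕ.+ Ee) F₁.rows
    window₁ = subst₂ (λ O E → Window (count t₁) O E F₁.rows) (sym first) E₁≡ F₁.window
    window₂ : Window (count t₂) (Oo ℕ.+ Eo) (Oe ℕ.+ Ee) F₂.rows
    window₂ = subst₂ (λ O E → Window (count t₂) O E F₂.rows) (sym second) E₂≡ F₂.window
    g : List (Fin _) → ℚ
    g xs = ι (2 ℕ.* half (length xs))
    build : (∃ λ zs → map proj₁ zs ↭ F₁.rows × map proj₂ zs ↭ F₂.rows × Window (count t₁ ⊞ count t₂)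
        (Oe ℕ.+ Eo) (Oo ℕ.+ Ee) zs) →
            ∃ λ E → 2 ℕ.* c ℕ.+ E ≡ n × Family (node (w₁ , t₁) (w₂ , t₂)) (2 ℕ.* c) E
    build (zs , p₁ , p₂ , win) = Oo ℕ.+ Ee
      , trans (cong (ℕ._+ (Oo ℕ.+ Ee)) (sym sum)) (trans (rearrange Oo Oe Eo Ee) all)
      , record
        { rows = zs
        ; window = subst (λ O → Window (count t₁ ⊞ count t₂) O (Oo ℕ.+ Ee) zs) sum win
        ; counts = trans (sumOf-⊞ (count t₁) (count t₂) zs)
            (trans (cong₂ ℕ._+_ (trans (sumOf-↭ (count t₁) p₁) F₁.counts) (trans (sumOf-↭ (count t₂) p₂) F₂.counts))
              (trans (sym (ℕ.*-distribˡ-+ (2 ℕ.* k) (size t₁) (size t₂)))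
                  (cong (2 ℕ.* k ℕ.*_) (sym (length-++ (leaves t₁))))))
        ; gains = begin
            ∑ zs (λ z → edgeGain w₁ t₁ (proj₁ z) + edgeGain w₂ t₂ (proj₂ z))
              ≡⟨ ∑-+ zs (λ z → edgeGain w₁ t₁ (proj₁ z)) (λ z → edgeGain w₂ t₂ (proj₂ z)) ⟩
            ∑ zs (λ z → edgeGain w₁ t₁ (proj₁ z)) + ∑ zs (λ z → edgeGain w₂ t₂ (proj₂ z))
              ≡⟨ cong₂ _+_ (∑-map proj₁ zs (edgeGain w₁ t₁)) (∑-map proj₂ zs (edgeGain w₂ t₂)) ⟨
            ∑ (map proj₁ zs) (edgeGain w₁ t₁) + ∑ (map proj₂ zs) (edgeGain w₂ t₂)
              ≡⟨ cong₂ _+_ (∑-↭ (edgeGain w₁ t₁) p₁) (∑-↭ (edgeGain w₂ t₂) p₂) ⟩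
            ∑ F₁.rows (edgeGain w₁ t₁) + ∑ F₂.rows (edgeGain w₂ t₂)
              ≡⟨ cong₂ _+_ (edge-gains w₁ F₁) (edge-gains w₂ F₂) ⟩
            (w₁ * g (leaves t₁) + binarySum g t₁) + (w₂ * g (leaves t₂) + binarySum g t₂)
              ≡⟨ binarySum-node g w₁ t₁ w₂ t₂ ⟨
            binarySum g (node (w₁ , t₁) (w₂ , t₂)) ∎ }
      where
      open ≡-Reasoning
      rearrange : ∀ a b c d → b ℕ.+ c ℕ.+ (a ℕ.+ d) ≡ a ℕ.+ b ℕ.+ (c ℕ.+ d)
      rearrange = solve-∀

  family : ∀ {N} (t : BinaryTree N) → size t ℕ.≤ n → ∃ λ E → 2 ℕ.* half (size t) ℕ.+ E ≡ n × Family t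
      (2 ℕ.* half (size t)) E
  family (leaf v) _ = family-leaf v
  family (node (w₁ , t₁) (w₂ , t₂)) le with family t₁
      (ℕ.≤-trans (ℕ.≤-trans (ℕ.m≤m+n (size t₁) (size t₂)) (ℕ.≤-reflexive (sym (length-++ (leaves t₁))))) le)
    | family t₂ (ℕ.≤-trans (ℕ.≤-trans (ℕ.m≤n+m (size t₂) (size t₁)) (ℕ.≤-reflexive (sym (length-++ (leaves t₁))))) le)
  ... | E₁ , e₁ , F₁ | E₂ , e₂ , F₂ = family-node
    (split-triple (subst (λ s → Triple n (half (size t₁)) (half (size t₂)) (half s)) (sym (length-++ (leaves t₁)))
      (clip-triple (φ-triple n (size t₁) (size t₂) (ℕ.≤-trans (ℕ.≤-reflexive (sym (length-++ (leaves t₁)))) le)))))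
    e₁ e₂ F₁ F₂

  -- For the whole tree the parities can be aligned completely.
  family-root : ∀ {N} {w₁ w₂ : ℚ} {t₁ t₂ : BinaryTree N} → size t₁ ℕ.+ size t₂ ≡ n → Family
      (node (w₁ , t₁) (w₂ , t₂)) 0 n
  family-root {w₁ = w₁} {w₂} {t₁} {t₂} e with family t₁ (ℕ.≤-trans (ℕ.m≤m+n _ _) (ℕ.≤-reflexive e)) | family
      t₂ (ℕ.≤-trans (ℕ.m≤n+m _ _) (ℕ.≤-reflexive e))
  ... | E₁ , e₁ , F₁ | E₂ , e₂ , F₂ with family-node {w₁ = w₁} {w₂} {c = 0} aligned e₁ e₂ F₁ F₂
    where
    half≡ : half (size t₁) ≡ half (size t₂)
    half≡ = cong clip (φ-complement n (size t₁) (size t₂) e)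
    aligned : Split n (half (size t₁)) (half (size t₂)) 0
    aligned = record
      { Oo = 2 ℕ.* half (size t₁) ; Oe = 0 ; Eo = 0 ; Ee = E₁
      ; first = ℕ.+-identityʳ _ ; second = trans (ℕ.+-identityʳ _) (cong (2 ℕ.*_) half≡) ; sum = refl
      ; all = trans (cong (ℕ._+ E₁) (ℕ.+-identityʳ _)) e₁ }
  ...   | E , refl , F = F

  -- The average count is `2 * k`, and all counts are even. In a window of three values this leaves
  -- the middle one alone, or the two outer ones. In the latter case no even number lies strictly
  -- between them, so an even average forces one of them to be taken by all rows.
  root-counts : ∀ {N} {t : BinaryTree N} → size t ≡ n → .{{_ : NonZero n}} → (F : Family t 0 n) → All
      (λ s → count t s ≡ 2 ℕ.* k) (Family.rows F)
  root-counts {t = t} size≡ F = Perm.All-resp-↭ perm (all-rows parities)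
    where
    open Family F renaming (rows to sels)
    open Window window renaming (l to l₁)
    open Rows rows
    counted : length low ℕ.* base ℕ.+ (length mid ℕ.* (1 ℕ.+ base) ℕ.+ length high ℕ.* (2 ℕ.+ base)) ≡ 2 ℕ.* k ℕ.* n
    counted = trans (sym (trans (sumOf-++ (count t) low (mid ++ high)) (cong₂ ℕ._+_ (sumOf-const (count t) low≡)
      (trans (sumOf-++ (count t) mid high) (cong₂ ℕ._+_ (sumOf-const (count t) mid≡) (sumOf-const (count t) high≡))))))
      (trans (sumOf-↭ (count t) perm) (trans counts (cong (2 ℕ.* k ℕ.*_) size≡)))
    only : ∀ {v} {xs : List (Selection t)} → All (λ s → count t s ≡ v) xs → length xs ≡ 0 ⊎ v ≡ 2 ℕ.* k →
        All (λ s → count t s ≡ 2 ℕ.* k) xs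
    only es (inj₂ refl)                = es
    only {xs = []} es (inj₁ _)         = []
    only {xs = _ ∷ _} es (inj₁ ())
    all-rows : (odd base ≡ true × l₁ ℕ.+ h ≡ 0 × m ≡ n) ⊎ (odd base ≡ false × m ≡ 0 × l₁ ℕ.+ h ≡ n) → All
        (λ s → count t s ≡ 2 ℕ.* k) (low ++ mid ++ high)
    all-rows (inj₁ (_ , lh , m≡)) = All.++⁺ (only low≡ (inj₁ low0))
        (All.++⁺ (only mid≡ (inj₂ mid2k)) (only high≡ (inj₁ high0)))
      where
      low0 : length low ≡ 0
      low0 = trans low-length (ℕ.m+n≡0⇒m≡0 l₁ lh)
      high0 : length high ≡ 0
      high0 = trans high-length (ℕ.m+n≡0⇒n≡0 l₁ lh)
      mid2k : 1 ℕ.+ base ≡ 2 ℕ.* k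
      mid2k = ℕ.*-cancelˡ-≡ _ _ n (trans (sym (trans
          (cong₂ (λ x y → x ℕ.* base ℕ.+ (length mid ℕ.* (1 ℕ.+ base) ℕ.+ y ℕ.* (2 ℕ.+ base))) low0 high0)
        (trans (ℕ.+-identityʳ _) (cong (ℕ._* (1 ℕ.+ base)) (trans mid-length m≡)))))
            (trans counted (ℕ.*-comm (2 ℕ.* k) n)))
    all-rows (inj₂ (b-even , m0 , lh)) with halfView base in view
    ... | isSucDouble b with trans (sym b-even) (cong not (odd-double′ b))
    ...   | ()
    all-rows (inj₂ (b-even , m0 , lh)) | isDouble b = conclude (≤⇒∃+ b≤k)
      where
      -- The total of the counts, divided by 2: relative to 2b, exactly the `h` high rows carry a
      -- surplus of 2. It makes `h` a multiple of n, and as `h` is at most n, it is 0 or n.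
      halved : n ℕ.* b ℕ.+ h ≡ k ℕ.* n
      halved = ℕ.*-cancelˡ-≡ _ _ 2 (begin
        2 ℕ.* (n ℕ.* b ℕ.+ h)                                     ≡⟨ cong (λ x → 2 ℕ.* (x ℕ.* b ℕ.+ h)) lh ⟨
        2 ℕ.* ((l₁ ℕ.+ h) ℕ.* b ℕ.+ h)                            ≡⟨ rearrange l₁ h b ⟩
        l₁ ℕ.* (b ℕ.+ b) ℕ.+ (0 ℕ.+ h ℕ.* (2 ℕ.+ (b ℕ.+ b)))      ≡⟨ cong₂ ℕ._+_ (cong (ℕ._* (b ℕ.+ b)) low-length)
                                                                       (cong₂ ℕ._+_ (cong (ℕ._* (1 ℕ.+ (b ℕ.+ b))) (trans mid-length m0)) (cong (ℕ._* (2 ℕ.+ (b ℕ.+ b))) high-length)) ⟨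
        length low ℕ.* (b ℕ.+ b) ℕ.+ (length mid ℕ.* (1 ℕ.+ (b ℕ.+ b)) ℕ.+ length high ℕ.*
            (2 ℕ.+ (b ℕ.+ b))) ≡⟨ counted ⟩
        2 ℕ.* k ℕ.* n                                             ≡⟨ ℕ.*-assoc 2 k n ⟩
        2 ℕ.* (k ℕ.* n)                                           ∎)
        where
        open ≡-Reasoning
        rearrange : ∀ l h b → 2 ℕ.* ((l ℕ.+ h) ℕ.* b ℕ.+ h) ≡ l ℕ.* (b ℕ.+ b) ℕ.+ (0 ℕ.+ h ℕ.* (2 ℕ.+ (b ℕ.+ b)))
        rearrange = solve-∀
      b≤k : b ℕ.≤ k
      b≤k = ℕ.*-cancelˡ-≤ n (ℕ.≤-trans (ℕ.m≤m+n (n ℕ.* b) h) (ℕ.≤-reflexive (trans halved (ℕ.*-comm k n))))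
      conclude : (∃ λ e → k ≡ b ℕ.+ e) → All (λ s → count t s ≡ 2 ℕ.* k) (low ++ mid ++ high)
      conclude (e , k≡) = pick e k≡ h≡
        where
        h≡ : h ≡ e ℕ.* n
        h≡ = ℕ.+-cancelˡ-≡ (n ℕ.* b) _ _ (trans halved
            (trans (cong (ℕ._* n) k≡) (trans (ℕ.*-distribʳ-+ n b e) (cong (ℕ._+ e ℕ.* n) (ℕ.*-comm b n)))))
        mid0 : length mid ≡ 0
        mid0 = trans mid-length m0
        pick : ∀ e → k ≡ b ℕ.+ e → h ≡ e ℕ.* n → All (λ s → count t s ≡ 2 ℕ.* k) (low ++ mid ++ high)
        pick 0 k≡ h≡ = All.++⁺ (only low≡ (inj₂ (trans (double b)
            (cong (2 ℕ.*_) (trans (sym (ℕ.+-identityʳ b)) (sym k≡))))))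
          (All.++⁺ (only mid≡ (inj₁ mid0)) (only high≡ (inj₁ (trans high-length h≡))))
          where
          double : ∀ b → b ℕ.+ b ≡ 2 ℕ.* b
          double = solve-∀
        pick 1 k≡ h≡ = All.++⁺ (only low≡ (inj₁ (trans low-length l0)))
          (All.++⁺ (only mid≡ (inj₁ mid0)) (only high≡ (inj₂ (trans (double b) (cong (2 ℕ.*_) (sym k≡))))))
          where
          double : ∀ b → 2 ℕ.+ (b ℕ.+ b) ≡ 2 ℕ.* (b ℕ.+ 1)
          double = solve-∀
          l0 : l₁ ≡ 0
          l0 = ℕ.+-cancelʳ-≡ h l₁ 0 (trans lh (sym (trans h≡ (ℕ.*-identityˡ n))))
        -- Then `h` would be at least 2n, but there are only n rows.
        pick (suc (suc e)) k≡ h≡ = ⊥-elim (ℕ.<⇒≱ (ℕ.m<m+n n (ℕ.>-nonZero⁻¹ n)) (ℕ.≤-trans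
          (ℕ.+-monoʳ-≤ n (ℕ.m≤m+n n (e ℕ.* n))) (ℕ.≤-trans (ℕ.≤-reflexive (sym h≡))
              (ℕ.≤-trans (ℕ.m≤n+m h l₁) (ℕ.≤-reflexive lh)))))

-- Outputs of the algorithm

does-cong : ∀ {P Q : Set} (p? : Dec P) (q? : Dec Q) → (P → Q) → (Q → P) → does p? ≡ does q?
does-cong (yes p) q? f g = sym (dec-true q? (f p))
does-cong (no ¬p) q? f g = sym (dec-false q? λ q → ¬p (g q))

odd-false⇒even : ∀ {m} → odd m ≡ false → 2 ∣ m
odd-false⇒even {m} e with halfView m
... | isDouble i = divides i (double i)
  where
  double : ∀ i → i ℕ.+ i ≡ i ℕ.* 2
  double = solve-∀
... | isSucDouble i with trans (sym e) (cong not (odd-double′ i))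
...   | ()

¬2∣?≡odd : ∀ m → does (¬? (2 ∣? m)) ≡ odd m
¬2∣?≡odd m with odd m in o
... | true  = dec-true (¬? (2 ∣? m)) λ 2∣m → true≢false (trans (sym o) (even⇒odd-false 2∣m))
  where
  true≢false : true ≢ false
  true≢false ()
... | false = dec-false (¬? (2 ∣? m)) λ ¬2∣m → ¬2∣m (odd-false⇒even o)

-- The contribution of an edge to w (J(T)), as a function of the leaves below it.
oddBelow : Subset n → List (Fin n) → ℚ
oddBelow T xs = indicator (odd (length (filter (_∈? T) xs)))

oddBelow-↭ : ∀ {T : Subset n} {xs ys} → xs ↭ ys → oddBelow T xs ≡ oddBelow T ys
oddBelow-↭ {T = T} p = cong (λ m → indicator (odd m)) (Perm.↭-length (Perm.filter-↭ (_∈? T) p))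

weight-oddEdges : ∀ (t : BinaryTree n) T → weight (oddEdges t T) ≡ binarySum (oddBelow T) t
weight-oddEdges t T = trans (∑-filter (λ e → ¬? (2 ∣? length (filter (_∈? T) (leaves (proj₂ e))))) (treeEdges t) proj₁)
  (∑-cong (treeEdges t) λ e _ → trans (cong (λ b → if b then proj₁ e else 0ℚ)
      (¬2∣?≡odd (length (filter (_∈? T) (leaves (proj₂ e))))))
    (times (proj₁ e) (odd (length (filter (_∈? T) (leaves (proj₂ e)))))))
  where
  times : ∀ w b → (if b then w else 0ℚ) ≡ w * indicator b
  times w true  = sym (ℚ.*-identityʳ w)
  times w false = sym (ℚ.*-zeroʳ w)

chosen : (t : BinaryTree n) → Selection t → List (Fin n)
chosen (leaf v) true  = v ∷ []
chosen (leaf v) false = []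
chosen (node (_ , t₁) (_ , t₂)) (s₁ , s₂) = chosen t₁ s₁ ++ chosen t₂ s₂

chosen⊆leaves : ∀ (t : BinaryTree n) s {v} → v ∈ˡ chosen t s → v ∈ˡ leaves t
chosen⊆leaves (leaf v) true v∈ = v∈
chosen⊆leaves (leaf v) false ()
chosen⊆leaves (node (_ , t₁) (_ , t₂)) (s₁ , s₂) v∈ with ∈-++⁻ (chosen t₁ s₁) v∈
... | inj₁ v∈₁ = ∈-++⁺ˡ (chosen⊆leaves t₁ s₁ v∈₁)
... | inj₂ v∈₂ = ∈-++⁺ʳ (leaves t₁) (chosen⊆leaves t₂ s₂ v∈₂)

Agrees : Subset n → (t : BinaryTree n) → Selection t → Set
Agrees T (leaf v) b = mem T v ≡ b
Agrees T (node (_ , t₁) (_ , t₂)) (s₁ , s₂) = Agrees T t₁ s₁ × Agrees T t₂ s₂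

agrees-count : ∀ (T : Subset n) t s → Agrees T t s → length (filter (_∈? T) (leaves t)) ≡ count t s
agrees-count T (leaf v) b a with does (v ∈? T) | a
... | true  | refl = refl
... | false | refl = refl
agrees-count T (node (_ , t₁) (_ , t₂)) (s₁ , s₂) (a₁ , a₂) = trans
    (cong length (filter-++ (_∈? T) (leaves t₁) (leaves t₂)))
  (trans (length-++ (filter (_∈? T) (leaves t₁))) (cong₂ ℕ._+_ (agrees-count T t₁ s₁ a₁) (agrees-count T t₂ s₂ a₂)))

agrees-gain : ∀ (T : Subset n) t s → Agrees T t s → binarySum (oddBelow T) t ≡ gain t s
agrees-gain T (leaf v) b a = refl
agrees-gain T (node (w₁ , t₁) (w₂ , t₂)) (s₁ , s₂) (a₁ , a₂) = trans (binarySum-node (oddBelow T) w₁ t₁ w₂ t₂)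
  (cong₂ _+_ (edge w₁ t₁ s₁ a₁) (edge w₂ t₂ s₂ a₂))
  where
  edge : ∀ w t s → Agrees T t s → w * oddBelow T (leaves t) + binarySum (oddBelow T) t ≡ edgeGain w t s
  edge w t s a = cong₂ (λ m q → w * indicator (odd m) + q) (agrees-count T t s a) (agrees-gain T t s a)

unique-++⁻ : ∀ (xs : List A) {ys} → Unique (xs ++ ys) → Unique xs × Unique ys × (∀ {v} → v ∈ˡ xs → v ∉ˡ ys)
unique-++⁻ []       u        = [] , u , λ ()
unique-++⁻ (x ∷ xs) (x∉ ∷ u) with unique-++⁻ xs u
... | u₁ , u₂ , disjoint = All.++⁻ˡ xs x∉ ∷ u₁ , u₂ , λ
  { (here refl) v∈ → All.All¬⇒¬Any (All.++⁻ʳ xs x∉) v∈ ; (there v∈) → disjoint v∈ }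

-- Since the leaves are distinct, a leaf of one subtree cannot be chosen in the other, so membership
-- in the whole choice restricts to both subtrees.
agrees : ∀ (T : Subset n) t s → Unique (leaves t) →
    (∀ v → v ∈ˡ leaves t → mem T v ≡ does (v ∈ˡ? chosen t s)) → Agrees T t s
agrees T (leaf v) true  _ h = trans (h v (here refl)) (dec-true (v ∈ˡ? (v ∷ [])) (here refl))
agrees T (leaf v) false _ h = h v (here refl)
agrees T (node (_ , t₁) (_ , t₂)) (s₁ , s₂) u h with unique-++⁻ (leaves t₁) u
... | u₁ , u₂ , disjoint = agrees T t₁ s₁ u₁ (λ v v∈ → trans (h v (∈-++⁺ˡ v∈))
        (does-cong (v ∈ˡ? (chosen t₁ s₁ ++ chosen t₂ s₂)) (v ∈ˡ? chosen t₁ s₁) (left v∈) ∈-++⁺ˡ))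
    , agrees T t₂ s₂ u₂ (λ v v∈ → trans (h v (∈-++⁺ʳ (leaves t₁) v∈))
        (does-cong (v ∈ˡ? (chosen t₁ s₁ ++ chosen t₂ s₂)) (v ∈ˡ? chosen t₂ s₂) (right v∈) (∈-++⁺ʳ (chosen t₁ s₁))))
  where
  left : ∀ {v} → v ∈ˡ leaves t₁ → v ∈ˡ chosen t₁ s₁ ++ chosen t₂ s₂ → v ∈ˡ chosen t₁ s₁
  left v∈ c∈ with ∈-++⁻ (chosen t₁ s₁) c∈
  ... | inj₁ c∈₁ = c∈₁
  ... | inj₂ c∈₂ = ⊥-elim (disjoint v∈ (chosen⊆leaves t₂ s₂ c∈₂))
  right : ∀ {v} → v ∈ˡ leaves t₂ → v ∈ˡ chosen t₁ s₁ ++ chosen t₂ s₂ → v ∈ˡ chosen t₂ s₂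
  right v∈ c∈ with ∈-++⁻ (chosen t₁ s₁) c∈
  ... | inj₁ c∈₁ = ⊥-elim (disjoint (chosen⊆leaves t₁ s₁ c∈₁) v∈)
  ... | inj₂ c∈₂ = c∈₂

toSubset : (t : BinaryTree n) → Selection t → Subset n
toSubset t s = Vec.tabulate λ v → does (v ∈ˡ? chosen t s)

toSubset-agrees : ∀ (t : BinaryTree n) s → Unique (leaves t) → Agrees (toSubset t s) t s
toSubset-agrees t s u = agrees (toSubset t s) t s u λ v _ → mem-tabulate (λ v → does (v ∈ˡ? chosen t s)) v

allFin↭⊤ : allFin n ↭ elements (⊤ {n})
allFin↭⊤ {n} = unique-↭ (Unique.allFin⁺ n) (elements-unique ⊤) λ v → mk⇔ (λ _ → ∈-elements⁺ ∈⊤) (λ _ → ∈-allFin v)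

toSubset-size : ∀ (t : BinaryTree n) s → leaves t ↭ elements ⊤ → ∣ toSubset t s ∣ ≡ count t s
toSubset-size t s p = trans (sym (length-elements (toSubset t s)))
  (trans (Perm.↭-length (Perm.filter-↭ (_∈? toSubset t s) (↭-trans allFin↭⊤ (↭-sym p))))
    (agrees-count (toSubset t s) t s (toSubset-agrees t s (Unique-↭ (↭-sym p) (elements-unique ⊤)))))

par-filter : ∀ {P : A → Set} (P? : ∀ x → Dec (P x)) χ xs → par χ (filter P? xs) ≡ par (λ x → does (P? x) ∧ χ x) xs
par-filter P? χ []       = refl
par-filter P? χ (x ∷ xs) with does (P? x)
... | true  = cong (χ x xor_) (par-filter P? χ xs)
... | false = par-filter P? χ xs

par-cong : ∀ {χ ψ : A → Bool} → (∀ x → χ x ≡ ψ x) → ∀ xs → par χ xs ≡ par ψ xs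
par-cong e []       = refl
par-cong e (x ∷ xs) = cong₂ _xor_ (e x) (par-cong e xs)

odd-length : ∀ (xs : List A) → odd (length xs) ≡ par (λ _ → true) xs
odd-length []       = refl
odd-length (x ∷ xs) = cong not (odd-length xs)

-- Both sides are the parity of S ∩ T, obtained by filtering all points by S and T in either order.
odd-intersection : ∀ (S T : Subset n) → odd (length (filter (_∈? T) (elements S))) ≡ par (mem S) (elements T)
odd-intersection {n} S T = begin
  odd (length (filter (_∈? T) (elements S)))           ≡⟨ odd-length (filter (_∈? T) (elements S)) ⟩
  par (λ _ → true) (filter (_∈? T) (elements S))       ≡⟨ par-filter (_∈? T) _ (elements S) ⟩
  par (λ x → mem T x ∧ true) (elements S)              ≡⟨ par-filter (_∈? S) _ (allFin n) ⟩
  par (λ x → mem S x ∧ (mem T x ∧ true)) (allFin n) ≡⟨ par-cong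
      (λ x → trans (cong (mem S x ∧_) (Bool.∧-identityʳ (mem T x))) (Bool.∧-comm (mem S x) (mem T x)))
      (allFin n) ⟩
  par (λ x → mem T x ∧ mem S x) (allFin n)             ≡⟨ par-filter (_∈? T) (mem S) (allFin n) ⟨
  par (mem S) (elements T)                             ∎
  where open ≡-Reasoning

-- Farthest-first selection of all points

firstArgmax-∈ : ∀ (f : A → ℚ) x xs → firstArgmax f x xs ∈ˡ x ∷ xs
firstArgmax-∈ f x []       = here refl
firstArgmax-∈ f x (y ∷ ys) with does (f x ℚ.<? f y)
... | true  = there (firstArgmax-∈ f y ys)
... | false with firstArgmax-∈ f x ys
...   | here e   = here e
...   | there u∈ = there (there u∈)

module _ (d : DistanceFunction (Fin n)) where

  addFarthest-grows : ∀ S → suc ∣ S ∣ ℕ.≤ ∣ addFarthest d ⊤ S ∣ ⊎ n ℕ.≤ ∣ addFarthest d ⊤ S ∣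
  addFarthest-grows S with elements (⊤ ─ S) in eq
  ... | []     = inj₂ (ℕ.≤-reflexive (sym (trans (cong ∣_∣ S≡⊤) (∣⊤∣≡n n))))
    where
    S≡⊤ : S ≡ ⊤
    S≡⊤ = ⊆-antisym ⊆⊤ λ {x} _ → in-S (x ∈? S)
      where
      in-S : ∀ {x} → Dec (x ∈ S) → x ∈ S
      in-S (yes x∈) = x∈
      in-S {x} (no x∉) with subst (x ∈ˡ_) eq (∈-elements⁺ (x∈p∧x∉q⇒x∈p─q ∈⊤ x∉))
      ... | ()
  ... | v ∷ vs = inj₁ (p⊂q⇒∣p∣<∣q∣ (p⊆p∪q ⁅ u ⁆ , u , x∈p∪q⁺ (inj₂ (x∈⁅x⁆ u)) , x∈p─q⇒x∉q ⊤ S u∈))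
    where
    u : Fin n
    u = firstArgmax (distanceTo d S) v vs
    u∈ : u ∈ ⊤ ─ S
    u∈ = ∈-elements⁻ (subst (u ∈ˡ_) (sym eq) (firstArgmax-∈ (distanceTo d S) v vs))

  farthestFirst-size : ∀ ℓ → ℓ ℕ.≤ n → ℓ ℕ.≤ ∣ farthestFirst d ⊤ ℓ ∣
  farthestFirst-size zero    _  = z≤n
  farthestFirst-size (suc ℓ) le with addFarthest-grows (farthestFirst d ⊤ ℓ)
  ... | inj₁ grows = ℕ.≤-trans (s≤s (farthestFirst-size ℓ (ℕ.≤-trans (ℕ.n≤1+n ℓ) le))) grows
  ... | inj₂ full  = ℕ.≤-trans le full

  -- Every step adds a new point until none is left, so for m = n the centres are all of V, whatever
  -- the distances are.
  farthestFirst-all : farthestFirst d ⊤ n ≡ ⊤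
  farthestFirst-all = ∣p∣≡n⇒p≡⊤ (ℕ.≤-antisym (∣p∣≤n (farthestFirst d ⊤ n)) (farthestFirst-size n ℕ.≤-refl))

-- The guarantee by averaging over the rows

ι-⊓ : ∀ a b → ι a ⊓ ι b ≡ ι (a ℕ.⊓ b)
ι-⊓ a b with ℕ.≤-total a b
... | inj₁ a≤b = trans (ℚ.p≤q⇒p⊓q≡p (ι-mono-≤ a≤b)) (cong ι (sym (ℕ.m≤n⇒m⊓n≡m a≤b)))
... | inj₂ b≤a = trans (ℚ.p≥q⇒p⊓q≡q (ι-mono-≤ b≤a)) (cong ι (sym (ℕ.m≥n⇒m⊓n≡n b≤a)))

ι-∸ : ∀ {a b} → b ℕ.≤ a → ι a + - ι b ≡ ι (a ℕ.∸ b)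
ι-∸ {a} {b} b≤a = begin
  ι a + - ι b                        ≡⟨ cong (λ m → ι m + - ι b) (ℕ.m∸n+n≡m b≤a) ⟨
  ι (a ℕ.∸ b ℕ.+ b) + - ι b          ≡⟨ cong (_+ - ι b) (ι-+ (a ℕ.∸ b) b) ⟩
  (ι (a ℕ.∸ b) + ι b) + - ι b        ≡⟨ ℚ.+-assoc (ι (a ℕ.∸ b)) (ι b) (- ι b) ⟩
  ι (a ℕ.∸ b) + (ι b + - ι b)        ≡⟨ cong (λ q → ι (a ℕ.∸ b) + q) (ℚ.+-inverseʳ (ι b)) ⟩
  ι (a ℕ.∸ b) + 0ℚ                   ≡⟨ ℚ.+-identityʳ _ ⟩
  ι (a ℕ.∸ b)                        ∎
  where open ≡-Reasoning

guarantee-scaled : ∀ k n → .{{_ : NonZero n}} → k ℕ.≤ n → ι n * guarantee k n ≡ ι (k ℕ.⊓ (2 ℕ.* (n ℕ.∸ k)))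
guarantee-scaled k n k≤n = trans (ℚ.*-distribˡ-⊓-nonNeg (ι n) {{ℚ.nonNegative (0≤ι n)}} p (ℤ.+ 2 / 1 * (1ℚ -ℚ p)))
  (trans (cong₂ _⊓_ (ι-*-/ k n) complement) (ι-⊓ k (2 ℕ.* (n ℕ.∸ k))))
  where
  p : ℚ
  p = ℤ.+ k / n
  open ≡-Reasoning
  complement : ι n * (ℤ.+ 2 / 1 * (1ℚ -ℚ p)) ≡ ι (2 ℕ.* (n ℕ.∸ k))
  complement = begin
    ι n * (ℤ.+ 2 / 1 * (1ℚ + - p))       ≡⟨ ℚ.*-assoc (ι n) (ℤ.+ 2 / 1) (1ℚ + - p) ⟨
    (ι n * (ℤ.+ 2 / 1)) * (1ℚ + - p)     ≡⟨ cong (_* (1ℚ + - p)) (ℚ.*-comm (ι n) (ℤ.+ 2 / 1)) ⟩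
    (ℤ.+ 2 / 1 * ι n) * (1ℚ + - p)       ≡⟨ ℚ.*-assoc (ℤ.+ 2 / 1) (ι n) (1ℚ + - p) ⟩
    ℤ.+ 2 / 1 * (ι n * (1ℚ + - p))       ≡⟨ cong (λ q → ℤ.+ 2 / 1 * q) (ℚ.*-distribˡ-+ (ι n) 1ℚ (- p)) ⟩
    ℤ.+ 2 / 1 * (ι n * 1ℚ + ι n * - p) ≡⟨ cong₂ (λ a b → ℤ.+ 2 / 1 * (a + b)) (ℚ.*-identityʳ (ι n))
        (trans (sym (ℚ.neg-distribʳ-* (ι n) p)) (cong -_ (ι-*-/ k n))) ⟩
    ℤ.+ 2 / 1 * (ι n + - ι k)            ≡⟨ cong₂ _*_ (sym (ι≡/1 2)) (ι-∸ k≤n) ⟩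
    ι 2 * ι (n ℕ.∸ k)                  ≡⟨ ι-* 2 (n ℕ.∸ k) ⟨
    ι (2 ℕ.* (n ℕ.∸ k))                ∎

window-length : ∀ {X : Set} {c : X → ℕ} {O E xs} → Window c O E xs → length xs ≡ O ℕ.+ E
window-length w = trans (sym (Perm.↭-length perm)) (trans (length-++ low)
    (trans (cong (length low ℕ.+_) (length-++ mid))
  (trans (cong₂ ℕ._+_ low-length (cong₂ ℕ._+_ mid-length high-length)) (total-length parities))))
  where
  open Window w
  open Rows rows
  rearrange₁ : ∀ l m h → l ℕ.+ (m ℕ.+ h) ≡ (l ℕ.+ h) ℕ.+ m
  rearrange₁ = solve-∀
  rearrange₂ : ∀ l m h → l ℕ.+ (m ℕ.+ h) ≡ m ℕ.+ (l ℕ.+ h)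
  rearrange₂ = solve-∀
  total-length : _ → l ℕ.+ (m ℕ.+ h) ≡ _
  total-length (inj₁ (_ , lh , m≡)) = trans (rearrange₁ l m h) (cong₂ ℕ._+_ lh m≡)
  total-length (inj₂ (_ , m≡ , lh)) = trans (rearrange₂ l m h) (cong₂ ℕ._+_ m≡ lh)

module Approximation {n} .{{_ : NonZero n}} (2≤n : 2 ℕ.≤ n) (d : DistanceFunction (Fin n)) (metric : IsMetric _≡_ d)
  {k : ℕ} (2k≤n : 2 ℕ.* k ℕ.≤ n) {r : Fin n} {y : Packing n} (opt : IsOptimal d ⊤ r y) (laminar : IsLaminar ⊤ r y)
  {incl : Tree n} (isInclusion : IsInclusionTree ⊤ r y ⊤ incl) {tree : BinaryTree n} (refines : Refines incl tree) where

  open IsOptimal opt using (feasible)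
  open Inclusion r y laminar

  -- The largest lower end that `Clip` admits. With sets of size `2 * k`, the number `2 * l` is n
  -- times the guarantee.
  l : ℕ
  l = k ℕ.⊓ (n ℕ.∸ 2 ℕ.* k)

  lkk : l ℕ.+ k ℕ.+ k ℕ.≤ n
  lkk = ℕ.≤-trans (ℕ.≤-reflexive (double l k)) (ℕ.≤-trans (ℕ.+-monoˡ-≤ (2 ℕ.* k) (ℕ.m⊓n≤n k _))
      (ℕ.≤-reflexive (ℕ.m∸n+n≡m 2k≤n)))
    where
    double : ∀ l k → l ℕ.+ k ℕ.+ k ≡ l ℕ.+ 2 ℕ.* k
    double = solve-∀

  open TreeRows {n} {k} {l} (ℕ.m⊓n≤m k _) lkk
  open Clip {n} {l} {k} (ℕ.m⊓n≤m k _) lkk using (l≤clip)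

  tree-leaves : leaves tree ↭ elements ⊤
  tree-leaves = refined-leaves isInclusion refines

  tree-size : size tree ≡ n
  tree-size = trans (Perm.↭-length tree-leaves) (trans (length-elements (⊤ {n})) (∣⊤∣≡n n))

  -- Every cut S of the packing adds `y S` to the gain of at least `2 * l` of the rows.
  total≤gains : ∀ {rows : List (Selection tree)} → ∑ rows (gain tree) ≡ binarySum
      (λ xs → ι (2 ℕ.* half (length xs))) tree →
                ι (2 ℕ.* l) * total ⊤ r y ≤ ∑ rows (gain tree)
  total≤gains {rows} e = begin
    ι (2 ℕ.* l) * total ⊤ r y                        ≡⟨ ∑-*ˡ (cuts ⊤ r) (ι (2 ℕ.* l)) y ⟨
    ∑ (cuts ⊤ r) (λ S → ι (2 ℕ.* l) * y S)           ≤⟨ ∑-mono (cuts ⊤ r) scaled ⟩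
    ∑ (cuts ⊤ r) (λ S → y S * g (elements S)) ≡⟨ refined-sum≡∑cuts g
        (λ p → cong (λ s → ι (2 ℕ.* half s)) (Perm.↭-length p)) feasible isInclusion refines ⟨
    binarySum g tree                                 ≡⟨ e ⟨
    ∑ rows (gain tree)                               ∎
    where
    open ℚ.≤-Reasoning
    g : List (Fin n) → ℚ
    g xs = ι (2 ℕ.* half (length xs))
    scaled : ∀ S → S ∈ˡ cuts ⊤ r → ι (2 ℕ.* l) * y S ≤ y S * g (elements S)
    scaled S S∈ = ℚ.≤-trans (ℚ.≤-reflexive (ℚ.*-comm (ι (2 ℕ.* l)) (y S)))
      (ℚ.*-monoˡ-≤-nonNeg (y S) {{ℚ.nonNegative (IsFeasible.nonNegative feasible S
          (proj₂ (∈-filter⁻ (isCut? ⊤ r) {xs = allSubsets n} S∈)))}}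
        (ι-mono-≤ (ℕ.*-monoʳ-≤ 2 (l≤clip (φ n (length (elements S)))))))

  root-family : Family tree 0 n
  root-family = at-node tree tree-size
    where
    at-node : ∀ t → size t ≡ n → Family t 0 n
    at-node (leaf _) e = ⊥-elim (ℕ.<⇒≱ 2≤n (ℕ.≤-reflexive (sym e)))
    at-node (node (_ , t₁) (_ , t₂)) e = family-root (trans (sym (length-++ (leaves t₁))) e)

  weight≤μ : ∀ T → odd ∣ T ∣ ≡ false → weight (oddEdges tree T) ≤ μ d T
  weight≤μ T e with μ-attained d metric T e
  ... | M , M∈ , μ≡ = begin
    weight (oddEdges tree T)                                                    ≡⟨ weight-oddEdges tree T ⟩
    binarySum (oddBelow T) tree ≡⟨ refined-sum≡∑cuts (oddBelow T) (oddBelow-↭ {T = T}) feasible isInclusion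
        refines ⟩
    ∑ (cuts ⊤ r) (λ S → y S * oddBelow T (elements S)) ≡⟨ ∑-cong (cuts ⊤ r)
        (λ S _ → trans (cong (λ b → y S * indicator b) (odd-intersection S T))
        (times (y S) (par (mem S) (elements T)))) ⟩
    ∑ (cuts ⊤ r) (λ S → if par (mem S) (elements T) then y S else 0ℚ) ≤⟨ packing≤cost d r y feasible {T} {M}
        M∈ ⟩
    cost d M                                                                    ≡⟨ μ≡ ⟨
    μ d T                                                                       ∎
    where
    open ℚ.≤-Reasoning
    times : ∀ w b → w * indicator b ≡ (if b then w else 0ℚ)
    times w true  = ℚ.*-identityʳ w
    times w false = ℚ.*-zeroʳ w

  -- Averaging: the n rows are sets of the right size, so none of them gains more than the
  -- maximiser, and the total gain is at most n times its weight. The factor n is cancelled at the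
  -- end.
  approximation : ∀ T → ∣ T ∣ ≡ 2 ℕ.* k → (∀ T′ → T′ ⊆ ⊤ → ∣ T′ ∣ ≡ 2 ℕ.* k → weight (oddEdges tree T′) ≤
      weight (oddEdges tree T)) →
                  guarantee (2 ℕ.* k) n * OPT d (2 ℕ.* k) ≤ μ d T
  approximation T size≡ maximal = ℚ.≤-trans (ℚ.*-cancelˡ-≤-pos (ι n) {{ι-positive}} (begin
    ι n * (guarantee (2 ℕ.* k) n * OPT d (2 ℕ.* k))    ≡⟨ ℚ.*-assoc (ι n) (guarantee (2 ℕ.* k) n) (OPT d (2 ℕ.* k)) ⟨
    (ι n * guarantee (2 ℕ.* k) n) * OPT d (2 ℕ.* k) ≡⟨ cong (_* OPT d (2 ℕ.* k))
        (trans (guarantee-scaled (2 ℕ.* k) n 2k≤n) (cong ι (sym (ℕ.*-distribˡ-⊓ 2 k (n ℕ.∸ 2 ℕ.* k))))) ⟩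
    ι (2 ℕ.* l) * OPT d (2 ℕ.* k) ≤⟨ ℚ.*-monoˡ-≤-nonNeg (ι (2 ℕ.* l)) {{ℚ.nonNegative (0≤ι (2 ℕ.* l))}}
        (OPT≤total d metric opt (odd-double k)) ⟩
    ι (2 ℕ.* l) * total ⊤ r y                          ≤⟨ total≤gains {rows} gains ⟩
    ∑ rows (gain tree)                                 ≤⟨ ∑-mono rows row≤ ⟩
    ∑ rows (λ _ → W)                                   ≡⟨ ∑-const rows W ⟩
    ι (length rows) * W                                ≡⟨ cong (λ m → ι m * W) (window-length window) ⟩
    ι n * W                                            ∎)) (weight≤μ T (trans (cong odd size≡) (odd-double k)))
    where
    open ℚ.≤-Reasoning
    open Family root-family
    W : ℚ
    W = weight (oddEdges tree T)
    ι-positive : ℚ.Positive (ι n)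
    ι-positive = ℚ.positive (ℚ.<-≤-trans 0<1 (ℚ.≤-trans (ℚ.≤-reflexive (sym (ι≡/1 1)))
        (ι-mono-≤ (ℕ.≤-trans (ℕ.n≤1+n 1) 2≤n))))
      where
      0<1 : 0ℚ ℚ.< 1ℚ
      0<1 = ℚ.positive⁻¹ 1ℚ
    row≤ : ∀ s → s ∈ˡ rows → gain tree s ≤ W
    row≤ s s∈ = begin
      gain tree s ≡⟨ agrees-gain T′ tree s (toSubset-agrees tree s
          (Unique-↭ (↭-sym tree-leaves) (elements-unique ⊤))) ⟨
      binarySum (oddBelow T′) tree               ≡⟨ weight-oddEdges tree T′ ⟨
      weight (oddEdges tree T′) ≤⟨ maximal T′ ⊆⊤ (trans (toSubset-size tree s tree-leaves)
          (All.lookup (root-counts tree-size root-family) s∈)) ⟩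
      W                                          ∎
      where
      T′ : Subset n
      T′ = toSubset tree s

output-approximation : ∀ {n} .{{_ : NonZero n}} → 2 ℕ.≤ n → (d : DistanceFunction (Fin n)) → IsMetric _≡_ d →
  ∀ {k} → 2 ∣ k → k ℕ.< n → ∀ {T} → IsOutput d k n T → guarantee k n * OPT d k ≤ μ d T
output-approximation {n} 2≤n d metric {k} (divides h k≡) k<n {T} o = on-⊤ (farthestFirst-all d)
    (h , trans k≡ (ℕ.*-comm h 2)) isOptimal isLaminar isInclusion maximal
  where
  open IsOutput o
  -- The set of centres is generalised to a variable here, so that it can be replaced by `⊤` in all
  -- components of the output at once.
  on-⊤ : ∀ {C} → C ≡ ⊤ → (∃ λ h → k ≡ 2 ℕ.* h) → IsOptimal d C root y → IsLaminar C root y → IsInclusionTree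
      C root y C inclusionTree →
         (∀ T′ → T′ ⊆ C → ∣ T′ ∣ ≡ k → weight (oddEdges tree T′) ≤ weight (oddEdges tree T)) → guarantee k n
             * OPT d k ≤ μ d T
  on-⊤ refl (h , refl) opt lam inc max = Approximation.approximation 2≤n d metric {h} (ℕ.<⇒≤ k<n) opt lam
      inc refines T ∣T∣≡k max

-- Serves the two endpoint cases, in which only one set has the prescribed size and the maximum is
-- over a single value.
OPT-forced : ∀ (d : DistanceFunction (Fin n)) {k} S → ∣ S ∣ ≡ k → (∀ T → ∣ T ∣ ≡ k → T ≡ S) → μ d S ≡ OPT d k
OPT-forced {n} d {k} S e only = sym (maximum-const _
    (∈-map⁺ (μ d) (∈-filter⁺ (λ T → ∣ T ∣ ℕ.≟ k) (∈-allSubsets S) e)) values)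
  where
  values : ∀ x → x ∈ˡ map (μ d) (filter (λ T → ∣ T ∣ ℕ.≟ k) (allSubsets n)) → x ≡ μ d S
  values x x∈ with ∈-map⁻ (μ d) x∈
  ... | T , T∈ , refl = cong (μ d) (only T (proj₂ (∈-filter⁻ (λ T → ∣ T ∣ ℕ.≟ k) {xs = allSubsets n} T∈)))

∣p∣≡0⇒p≡⊥ : ∀ (p : Subset n) → ∣ p ∣ ≡ 0 → p ≡ ⊥
∣p∣≡0⇒p≡⊥ Vec.[]            _ = refl
∣p∣≡0⇒p≡⊥ (false Vec.∷ p) e = cong (false Vec.∷_) (∣p∣≡0⇒p≡⊥ p e)

corollary2 : ∀ (n : ℕ) .{{_ : NonZero n}} → 2 ≤ℕ n →
    (d : DistanceFunction (Fin n)) → IsMetric _≡_ d →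
    (∀ k → 2 ∣ k → 0 <ℕ k → k <ℕ n →
    ∀ T → IsOutput d k n T →
    ∣ T ∣ ≡ k × guarantee k n * OPT d k ≤ μ d T)
    × (∣ ⊥ {n} ∣ ≡ 0 × μ d ⊥ ≡ OPT d 0)
    × (2 ∣ n → ∣ ⊤ {n} ∣ ≡ n × μ d ⊤ ≡ OPT d n)
corollary2 n 2≤n d metric =
  (λ k 2∣k _ k<n T o → IsOutput.∣T∣≡k o , output-approximation 2≤n d metric 2∣k k<n o)
  , (∣⊥∣≡0 n , OPT-forced d ⊥ (∣⊥∣≡0 n) ∣p∣≡0⇒p≡⊥)
  , λ _ → ∣⊤∣≡n n , OPT-forced d ⊤ (∣⊤∣≡n n) λ T → ∣p∣≡n⇒p≡⊤
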